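{- Let the U-Process start from any configuration $\mathbf{x}\in\mathcal{C}$. Then the process converges to a (valid) monochromatic configuration within $O(\log n)$ rounds, w.h.p. Furthermore, if the initial configuration has at least one colored node (i.e. $q(\mathbf{x})\le n-1$), then the process converges to a configuration such that $|s|=n$, w.h.p. (The constants hidden in $O(\log n)$ and in "w.h.p." are absolute; in particular they do not depend on $n$ or on the initial configuration.)
   Context: U-Dynamics (Undecided-State Dynamics) with two colors in the parallel uniform PULL model on the complete graph with $n$ nodes. Each node is in one of three states: color Alpha, color Beta, or undecided. In every synchronous round every node $u$, independently of the others, picks a node $v$ uniformly at random among the $n$ nodes and looks at the state of $v$ at the beginning of the round; then all nodes update simultaneously: if $u$ is colored and $v$ has the other color, $u$ becomes undecided; if $u$ is colored and $v$ is undecided or has the same color as $u$, $u$ keeps its color; if $u$ is undecided, $u$ takes the state of $v$ (a color, or undecided). (The choice of $v$ is over all $n$ nodes, as in the paper's formulas, e.g. $\mathbf{E}[a(\mathbf{X}_{t+1})\mid \mathbf{X}_t=\mathbf{x}]=a(a+2q)/n$.) A configuration $\mathbf{x}$ is determined by the number $a(\mathbf{x})$ of Alpha-colored nodes and the number $b(\mathbf{x})$ of Beta-colored nodes; $\mathcal{C}$ is the set of all configurations. $q(\mathbf{x})=n-a(\mathbf{x})-b(\mathbf{x})$ is the number of undecided nodes and $s(\mathbf{x})=a(\mathbf{x})-b(\mathbf{x})$ is the bias. The resulting Markov chain $\{\mathbf{X}_t\}_{t\ge 0}$ on $\mathcal{C}$ is called the U-Process; its absorbing states are $q=n$, $a=n$,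 $b=n$. A monochromatic configuration is one in which all nodes are in the same state, i.e. one of the three absorbing states ($|s|=n$ means all nodes support the same color; the all-undecided configuration $q=n$ is included and is the case covered trivially when the process starts from $q=n$). Valid means that, if the final common state is a color, this color was supported by at least one node initially. An event $\mathcal{E}_n$ holds w.h.p. if $\mathbf{P}(\mathcal{E}_n)\ge 1-n^{ -\Theta(1)}$, i.e. there is a constant $c>0$ with $\mathbf{P}(\mathcal{E}_n)\ge 1-n^{ -c}$ for all sufficiently large $n$. -}

module Defs where

open import Data.Fin using (Fin; zero; suc; finToFun)
open import Data.Fin.Properties using (all?; any?)
open import Data.Integer as ℤ using (ℤ; +_)
open import Data.List using (length; filter; allFin)
open import Data.Nat as ℕ using (ℕ; NonZero)
open import Data.Nat.Properties using (m^n≢0)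
open import Data.Product using (∃; _×_; _,_)
open import Data.Rational as ℚ using (ℚ; 1ℚ; _/_; ↧ₙ_; ↥_)
open import Algebra.Definitions.RawSemiring ℚ.+-*-rawSemiring using (_^_)
open import Function using (_∘_)
open import Level using (0ℓ)
open import Relation.Binary.Definitions using (DecidableEquality)
open import Relation.Binary.PropositionalEquality using (_≡_; _≢_; refl)
open import Relation.Nullary using (Dec; yes; no; ¬?; _×-dec_; _→-dec_)
open import Relation.Unary using (Pred; Decidable)

data State : Set where
  alpha beta undecided : State

_≟ₛ_ : DecidableEquality State
alpha     ≟ₛ alpha     = yes refl
alpha     ≟ₛ beta      = no λ ()
alpha     ≟ₛ undecided = no λ ()
beta      ≟ₛ alpha     = no λ ()
beta      ≟ₛ beta      = yes refl
beta      ≟ₛ undecided = no λ ()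
undecided ≟ₛ alpha     = no λ ()
undecided ≟ₛ beta      = no λ ()
undecided ≟ₛ undecided = yes refl

anyState? : {P : Pred State 0ℓ} → Decidable P → Dec (∃ P)
anyState? P? with P? alpha | P? beta | P? undecided
... | yes p | _     | _     = yes (alpha , p)
... | no _  | yes p | _     = yes (beta , p)
... | no _  | no _  | yes p = yes (undecided , p)
... | no ¬a | no ¬b | no ¬u = no λ where
  (alpha , p)     → ¬a p
  (beta , p)      → ¬b p
  (undecided , p) → ¬u p

-- First argument: the node's own state; second: the state it pulls.
update : State → State → State
update alpha     alpha     = alpha
update alpha     beta      = undecided
update alpha     undecided = alpha
update beta      alpha     = undecided
update beta      beta      = beta
update beta      undecided = beta
update undecided v         = v

Config : ℕ → Set
Config n = Fin n → State

count : ∀ {m} {P : Pred (Fin m) 0ℓ} → Decidable P → ℕ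
count {m} P? = length (filter P? (allFin m))

a b q : ∀ {n} → Config n → ℕ
a x = count (λ u → x u ≟ₛ alpha)
b x = count (λ u → x u ≟ₛ beta)
q x = count (λ u → x u ≟ₛ undecided)

s : ∀ {n} → Config n → ℤ
s x = + a x ℤ.- + b x

-- `ω t u` is the node pulled by node u in round t.
Choices : ℕ → ℕ → Set
Choices n T = Fin T → Fin n → Fin n

step : ∀ {n} → (Fin n → Fin n) → Config n → Config n
step pull x u = update (x u) (x (pull u))

-- X x ω t is the configuration at time t ∈ {0, …, T}, started from x.
X : ∀ {n T} → Config n → Choices n T → Fin (ℕ.suc T) → Config n
X             x ω zero    = x
X {T = ℕ.suc T} x ω (suc t) = X (step (ω zero) x) (ω ∘ suc) t

-- The pulls are independent and uniform over all n nodes, so every element of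
-- Choices n T, a set with (nⁿ)ᵀ elements enumerated by finToFun, is equally
-- likely.
Pr : ∀ n T .{{_ : NonZero n}} {E : Pred (Choices n T) 0ℓ} → Decidable E → ℚ
Pr n T E? = (+ count (λ i → E? (λ t → finToFun (finToFun i t)))) / ((n ℕ.^ n) ℕ.^ T)
  where instance
    nⁿ≢0 : NonZero (n ℕ.^ n)
    nⁿ≢0 = m^n≢0 n n
    total≢0 : NonZero ((n ℕ.^ n) ℕ.^ T)
    total≢0 = m^n≢0 (n ℕ.^ n) T

-- For 0 < c and p ≤ 1 this is p ≥ 1 - n^(-c): writing c = k / d, it says
-- (1 - p)^d · n^k ≤ 1.  A positive real exponent can always be lowered to a
-- positive rational one, so rational c suffice to express "w.h.p.".
_≥1-_^-_ : ℚ → ℕ → ℚ → Set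
p ≥1- n ^- c =
  ((1ℚ ℚ.- p) ^ (↧ₙ c)) ℚ.* (+ (n ℕ.^ ℤ.∣ ↥ c ∣) / 1) ℚ.≤ 1ℚ

ValidMonochromatic : ∀ {n} → Config n → Config n → Set
ValidMonochromatic x₀ x =
  ∃ λ σ → (∀ u → x u ≡ σ) × (σ ≢ undecided → ∃ λ u → x₀ u ≡ σ)

validMonochromatic? : ∀ {n} (x₀ x : Config n) → Dec (ValidMonochromatic x₀ x)
validMonochromatic? x₀ x = anyState? λ σ →
  all? (λ u → x u ≟ₛ σ) ×-dec
  (¬? (σ ≟ₛ undecided) →-dec any? (λ u → x₀ u ≟ₛ σ))

ColorConsensus : ∀ {n} → Config n → Set
ColorConsensus {n} x = ℤ.∣ s x ∣ ≡ n

colorConsensus? : ∀ {n} (x : Config n) → Dec (ColorConsensus x)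
colorConsensus? {n} x = ℤ.∣ s x ∣ ℕ.≟ n

-- The target sets used are made of absorbing configurations, so converging to
-- one of them within T rounds is the same as visiting it at some time t ≤ T.
ConvergesTo : ∀ {n T} → Pred (Config n) 0ℓ → Config n → Pred (Choices n T) 0ℓ
ConvergesTo S x ω = ∃ λ t → S (X x ω t)

convergesTo? : ∀ {n T} {S : Pred (Config n) 0ℓ} → Decidable S →
               (x : Config n) → Decidable (ConvergesTo {T = T} S x)
convergesTo? S? x ω = any? (λ t → S? (X x ω t))

{-# OPTIONS --safe #-}
module Submission where

-- Write α, β, κ for the fractions of Alpha, Beta and undecided nodes, γ = α + β, ς = α − β and
-- ν = 1/n. The process goes through four phases. In each of them a Lyapunov function with values
-- between 1 and O(n) contracts in mean by a constant factor r < 1 per round, outside an event of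
-- probability O(1/n), so O(log n) rounds fail to finish the phase with probability O(log n / n).
--   Growth, until κ ≤ 15/16: 1/γ contracts, because the undecided nodes almost double γ while
--     by Chebyshev at most a fraction γ/16 of the nodes loses its colour.
--   Mixing, one round: E κ' = κ² + 2αβ brings κ into [1/512, 15/16] unless a colour has almost won.
--   Bias: 1/(Aν + ς²) contracts. For small ς this is due to the variance of ς', of order ν, which
--     breaks the symmetry; for large ς it is due to E ς' = (1 + κ)ς. The inverse is controlled by
--     its mean and variance alone, and the variance of ς'² by the fourth moment of ς'.
--   Last, once β + κ/4 ≤ 1/32 (or α + κ/4 ≤ 1/32): this quantity contracts by the factor 3/4, and
--     it is at least ν/4 unless everything is Alpha (or Beta).

open import Defs

-- A growing mean of γ or ς² does not exclude that the quantity stays small with noticeable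
-- probability. A contracting mean of its reciprocal does: the reciprocal potential is at least 1
-- off the goal, so Markov's inequality bounds the probability that the goal has not been reached.
-- No exponential moments and no limit theorem enter; second and fourth moments of sums of
-- independent terms suffice, and every estimate is a polynomial inequality over the rationals. A
-- bad round is charged as outright failure, so its probability must be O(1/n) uniformly. In the
-- last three phases the bad deviations have constant size and Chebyshev gives this at once. In the
-- growth phase γ can be as small as 1/n, and the fluctuation of γ itself is too large; the loss of
-- coloured nodes is therefore separated from the gain. A loss needs both colours to meet, so its
-- variance is of order νγ², and the factor γ² cancels against the threshold. The price of this
-- crude method is the size of the constants: the slowest rate is 1 - 2⁻⁵², and each phase is given
-- 3·2⁵² rounds per unit of log₂ n.

module Analysis where

  open import Algebra.Bundles using (CommutativeRing)
  open import Data.Bool using (true; false; if_then_else_)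
  open import Data.Fin using (Fin; zero; suc; finToFun; combine; _↑ˡ_; _↑ʳ_)
  open import Data.Fin.Properties using (remQuot-combine)
  open import Data.Integer as ℤ using (+_)
  import Data.Integer.Properties as ℤ
  open import Data.List using ([]; _∷_; length; filter; tabulate; allFin)
  open import Data.List.Membership.Propositional using (lose)
  open import Data.List.Membership.Propositional.Properties using (∈-allFin)
  open import Data.List.Properties using (length-filter; length-tabulate; filter-notAll)
  open import Data.Nat as ℕ using (ℕ; zero; suc; NonZero; z≤n; s≤s; ⌊_/2⌋)
  open import Data.Nat.Induction using (<-rec)
  open import Data.Nat.Logarithm using (⌊log₂_⌋; ⌊log₂⌋-mono-≤; ⌊log₂⌊n/2⌋⌋≡⌊log₂n⌋∸1; ⌊log₂[2^n]⌋≡n)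
  import Data.Nat.Properties as ℕ
  open import Data.Product using (∃-syntax; _×_; _,_; proj₁; proj₂)
  open import Data.Rational as ℚ
    using (ℚ; _+_; _*_; _-_; -_; 0ℚ; 1ℚ; _/_; 1/_; _≤_; _<_; _≤?_; _<?_; positive; nonNegative; toℚᵘ)
  open import Data.Rational.Properties
  open import Data.Rational.Unnormalised as ℚᵘ using (mkℚᵘ)
  import Data.Rational.Unnormalised.Properties as ℚᵘ
  open import Data.Sum as Sum using (_⊎_; inj₁; inj₂)
  open import Data.Unit using (tt)
  import Data.Vec.Functional as Vector
  open import Function using (_∘_; id)
  open import Level using (0ℓ)
  open import Relation.Binary.PropositionalEquality
  open import Relation.Nullary using (Dec; does; yes; no; ¬_; contradiction; _×-dec_; _⊎-dec_)
  open import Relation.Nullary.Decidable using (dec⇒maybe; True; toWitness)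
  open import Relation.Unary using (Pred; Decidable)
  open import Tactic.RingSolver using (solve; solve-∀)
  open import Tactic.RingSolver.Core.AlmostCommutativeRing using (AlmostCommutativeRing; fromCommutativeRing)
  open import Algebra.Definitions.RawSemiring ℚ.+-*-rawSemiring using (_^_)
  open import Algebra.Properties.CommutativeSemiring.Exp (CommutativeRing.commutativeSemiring +-*-commutativeRing) using (^-distrib-*)
  open import Algebra.Properties.Semiring.Exp (CommutativeRing.semiring +-*-commutativeRing) using (^-assocʳ)
  open import Algebra.Properties.Semiring.Sum (CommutativeRing.semiring +-*-commutativeRing)

  -- Ordered arithmetic over the rationals

  ring : AlmostCommutativeRing 0ℓ 0ℓ
  ring = fromCommutativeRing +-*-commutativeRing λ x → dec⇒maybe (0ℚ ≟ x)

  infixl 6 _⊕_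
  infixl 7 _⊗_

  _⊕_ : ∀ {p q} → 0ℚ ≤ p → 0ℚ ≤ q → 0ℚ ≤ p + q
  0≤p ⊕ 0≤q = +-mono-≤ 0≤p 0≤q

  _⊗_ : ∀ {p q} → 0ℚ ≤ p → 0ℚ ≤ q → 0ℚ ≤ p * q
  _⊗_ {p} {q} 0≤p 0≤q =
    nonNegative⁻¹ (p * q) {{nonNeg*nonNeg⇒nonNeg p {{nonNegative 0≤p}} q {{nonNegative 0≤q}}}}

  lit : ∀ p {_ : True (0ℚ ≤? p)} → 0ℚ ≤ p
  lit p {t} = toWitness t

  gap : ∀ {p q} → p ≤ q → 0ℚ ≤ q - p
  gap {p} {q} p≤q = subst (_≤ q - p) (+-inverseʳ p) (+-monoˡ-≤ (- p) p≤q)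

  -- The form of nearly all polynomial estimates below: the slack `x` is a sum of products of
  -- factors known to be nonnegative (`gap` of a hypothesis, `lit` of a constant, `sq`), and the
  -- ring solver checks the identity.
  by-gap : ∀ {p q x} → 0ℚ ≤ x → q ≡ p + x → p ≤ q
  by-gap {p} 0≤x refl = subst (_≤ p + _) (+-identityʳ p) (+-monoʳ-≤ p 0≤x)

  sq : ∀ p → 0ℚ ≤ p * p
  sq p with ≤-total 0ℚ p
  ... | inj₁ 0≤p = 0≤p ⊗ 0≤p
  ... | inj₂ p≤0 = subst (0ℚ ≤_) (lemma p) (gap p≤0 ⊗ gap p≤0)
    where
    lemma : ∀ p → (0ℚ - p) * (0ℚ - p) ≡ p * p
    lemma = solve-∀ ring

  pos⊗ : ∀ {p q} → 0ℚ < p → 0ℚ < q → 0ℚ < p * q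
  pos⊗ {p} {q} 0<p 0<q =
    positive⁻¹ (p * q) {{pos*pos⇒pos p {{positive 0<p}} q {{positive 0<q}}}}

  cancelˡ-≤ : ∀ {p q r} → 0ℚ < r → r * p ≤ r * q → p ≤ q
  cancelˡ-≤ {r = r} 0<r = *-cancelˡ-≤-pos r {{positive 0<r}}

  opaque
    -- Total reciprocal; the junk value is inv 0 = 0.
    inv : ℚ → ℚ
    inv p with p ≟ 0ℚ
    ... | yes _  = 0ℚ
    ... | no p≢0 = (1/ p) {{ℚ.≢-nonZero p≢0}}

    inv-cancelʳ : ∀ {p} → 0ℚ < p → p * inv p ≡ 1ℚ
    inv-cancelʳ {p} 0<p with p ≟ 0ℚ
    ... | yes p≡0 = contradiction (sym p≡0) (<⇒≢ 0<p)
    ... | no p≢0  = *-inverseʳ p {{ℚ.≢-nonZero p≢0}}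

  inv-≥0 : ∀ {p} → 0ℚ < p → 0ℚ ≤ inv p
  inv-≥0 {p} 0<p = cancelˡ-≤ 0<p (subst₂ _≤_ (sym (*-zeroʳ p)) (sym (inv-cancelʳ 0<p)) (lit 1ℚ))

  inv-antimono : ∀ {p q} → 0ℚ < p → p ≤ q → inv q ≤ inv p
  inv-antimono {p} {q} 0<p p≤q = cancelˡ-≤ 0<p (cancelˡ-≤ 0<q (subst₂ _≤_ lhs rhs p≤q))
    where
    0<q = <-≤-trans 0<p p≤q
    move : ∀ p q i → p * (q * i) ≡ q * (p * i)
    move = solve-∀ ring
    lhs : p ≡ q * (p * inv q)
    lhs = trans (sym (trans (cong (p *_) (inv-cancelʳ 0<q)) (*-identityʳ p))) (move p q (inv q))
    rhs : q ≡ q * (p * inv p)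
    rhs = sym (trans (cong (q *_) (inv-cancelʳ 0<p)) (*-identityʳ q))

  -- Expectations over independent uniform choices

  ι : ℕ → ℚ
  ι n = + n / 1

  toℚᵘ-ι : ∀ n → toℚᵘ (ι n) ℚᵘ.≃ mkℚᵘ (+ n) 0
  toℚᵘ-ι n = toℚᵘ-fromℚᵘ (mkℚᵘ (+ n) 0)

  ι-+ : ∀ m n → ι (m ℕ.+ n) ≡ ι m + ι n
  ι-+ m n = toℚᵘ-injective (begin
    toℚᵘ (ι (m ℕ.+ n))                 ≈⟨ toℚᵘ-ι (m ℕ.+ n) ⟩
    mkℚᵘ (+ (m ℕ.+ n)) 0               ≈⟨ ℚᵘ.*≡* (cong (ℤ._* + 1) (sym (cong₂ ℤ._+_ (ℤ.*-identityʳ (+ m)) (ℤ.*-identityʳ (+ n))))) ⟩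
    mkℚᵘ (+ m) 0 ℚᵘ.+ mkℚᵘ (+ n) 0     ≈⟨ ℚᵘ.+-cong (ℚᵘ.≃-sym (toℚᵘ-ι m)) (ℚᵘ.≃-sym (toℚᵘ-ι n)) ⟩
    toℚᵘ (ι m) ℚᵘ.+ toℚᵘ (ι n)         ≈⟨ ℚᵘ.≃-sym (toℚᵘ-homo-+ (ι m) (ι n)) ⟩
    toℚᵘ (ι m + ι n)                   ∎)
    where open ℚᵘ.≃-Reasoning

  ι-* : ∀ m n → ι (m ℕ.* n) ≡ ι m * ι n
  ι-* m n = toℚᵘ-injective (begin
    toℚᵘ (ι (m ℕ.* n))                 ≈⟨ toℚᵘ-ι (m ℕ.* n) ⟩
    mkℚᵘ (+ (m ℕ.* n)) 0               ≈⟨ ℚᵘ.*≡* (cong (ℤ._* + 1) (ℤ.pos-* m n)) ⟩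
    mkℚᵘ (+ m) 0 ℚᵘ.* mkℚᵘ (+ n) 0     ≈⟨ ℚᵘ.*-cong (ℚᵘ.≃-sym (toℚᵘ-ι m)) (ℚᵘ.≃-sym (toℚᵘ-ι n)) ⟩
    toℚᵘ (ι m) ℚᵘ.* toℚᵘ (ι n)         ≈⟨ ℚᵘ.≃-sym (toℚᵘ-homo-* (ι m) (ι n)) ⟩
    toℚᵘ (ι m * ι n)                   ∎)
    where open ℚᵘ.≃-Reasoning

  ι-mono-≤ : ∀ {m n} → m ℕ.≤ n → ι m ≤ ι n
  ι-mono-≤ {m} {n} m≤n = toℚᵘ-cancel-≤
    (ℚᵘ.≤-respˡ-≃ (ℚᵘ.≃-sym (toℚᵘ-ι m)) (ℚᵘ.≤-respʳ-≃ (ℚᵘ.≃-sym (toℚᵘ-ι n))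
      (ℚᵘ.*≤* (ℤ.*-monoʳ-≤-nonNeg (+ 1) (ℤ.+≤+ m≤n)))))

  ι-injective : ∀ {m n} → ι m ≡ ι n → m ≡ n
  ι-injective {m} {n} eq = ℤ.+-injective (trans (sym (ℤ.*-identityʳ (+ m))) (trans
    (ℚᵘ.drop-*≡* (ℚᵘ.≃-trans (ℚᵘ.≃-sym (toℚᵘ-ι m)) (ℚᵘ.≃-trans (ℚᵘ.≃-reflexive (cong toℚᵘ eq)) (toℚᵘ-ι n))))
    (ℤ.*-identityʳ (+ n))))

  ι-≥0 : ∀ n → 0ℚ ≤ ι n
  ι-≥0 n = ι-mono-≤ {0} {n} ℕ.z≤n

  ι-≥1 : ∀ n .{{_ : NonZero n}} → 1ℚ ≤ ι n
  ι-≥1 n = ι-mono-≤ {1} {n} (ℕ.>-nonZero⁻¹ n)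

  ι-pos : ∀ n .{{_ : NonZero n}} → 0ℚ < ι n
  ι-pos n = <-≤-trans (positive⁻¹ 1ℚ) (ι-≥1 n)

  -- Probability as a positive, normalised linear functional. `E-cong` is a field because pointwise
  -- equal functions need not be propositionally equal.
  record Expectation (A : Set) : Set where
    field
      E      : (A → ℚ) → ℚ
      E-cong : ∀ {F G} → (∀ x → F x ≡ G x) → E F ≡ E G
      E-+    : ∀ F G → E (λ x → F x + G x) ≡ E F + E G
      E-*    : ∀ c F → E (λ x → c * F x) ≡ c * E F
      E-1    : E (λ _ → 1ℚ) ≡ 1ℚ
      E-≥0   : ∀ {F} → (∀ x → 0ℚ ≤ F x) → 0ℚ ≤ E F

    E-const : ∀ c → E (λ _ → c) ≡ c
    E-const c = trans (E-cong (λ _ → sym (*-identityʳ c))) (trans (E-* c (λ _ → 1ℚ)) (trans (cong (c *_) E-1) (*-identityʳ c)))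

    E-linear : ∀ c F G → E (λ x → c * F x + G x) ≡ c * E F + E G
    E-linear c F G = trans (E-+ (λ x → c * F x) G) (cong (_+ E G) (E-* c F))

    E-mono : ∀ {F G} → (∀ x → F x ≤ G x) → E F ≤ E G
    E-mono {F} {G} F≤G = by-gap (E-≥0 (λ x → gap (F≤G x)))
      (trans (E-cong λ x → lemma (F x) (G x)) (E-+ F (λ x → G x - F x)))
      where
      lemma : ∀ p q → q ≡ p + (q - p)
      lemma = solve-∀ ring

    E-≤1 : ∀ {F} → (∀ x → F x ≤ 1ℚ) → E F ≤ 1ℚ
    E-≤1 F≤1 = ≤-trans (E-mono F≤1) (≤-reflexive E-1)

    E-square-shift : ∀ F c → E (λ x → (F x - c) * (F x - c)) ≡ E (λ x → F x * F x) + (c * c - + 2 / 1 * c * E F)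
    E-square-shift F c = begin
      E (λ x → (F x - c) * (F x - c))
        ≡⟨ E-cong (λ x → expand (F x) c) ⟩
      E (λ x → - (+ 2 / 1 * c) * F x + (1ℚ * (F x * F x) + c * c))
        ≡⟨ E-linear (- (+ 2 / 1 * c)) F (λ x → 1ℚ * (F x * F x) + c * c) ⟩
      - (+ 2 / 1 * c) * E F + E (λ x → 1ℚ * (F x * F x) + c * c)
        ≡⟨ cong (λ v → - (+ 2 / 1 * c) * E F + v) (E-linear 1ℚ (λ x → F x * F x) (λ _ → c * c)) ⟩
      - (+ 2 / 1 * c) * E F + (1ℚ * S + E (λ _ → c * c))
        ≡⟨ cong (λ v → - (+ 2 / 1 * c) * E F + (1ℚ * S + v)) (E-const (c * c)) ⟩
      - (+ 2 / 1 * c) * E F + (1ℚ * S + c * c)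
        ≡⟨ collapse c (E F) S ⟩
      S + (c * c - + 2 / 1 * c * E F) ∎
      where
      open ≡-Reasoning
      S = E (λ x → F x * F x)
      expand : ∀ y c → (y - c) * (y - c) ≡ - (+ 2 / 1 * c) * y + (1ℚ * (y * y) + c * c)
      expand = solve-∀ ring
      collapse : ∀ c m s → - (+ 2 / 1 * c) * m + (1ℚ * s + c * c) ≡ s + (c * c - + 2 / 1 * c * m)
      collapse = solve-∀ ring

    variance-≤ : ∀ F → E (λ x → (F x - E F) * (F x - E F)) ≤ E (λ x → F x * F x)
    variance-≤ F = by-gap (sq (E F)) (trans (lemma (E F) _) (cong (_+ E F * E F) (sym (E-square-shift F (E F)))))
      where
      lemma : ∀ m s → s ≡ (s + (m * m - + 2 / 1 * m * m)) + m * m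
      lemma = solve-∀ ring

    mean-square-≤ : ∀ F → E F * E F ≤ E (λ x → F x * F x)
    mean-square-≤ F = by-gap (E-≥0 λ x → sq (F x - E F))
      (trans (lemma (E F) _) (cong (_+_ (E F * E F)) (sym (E-square-shift F (E F)))))
      where
      lemma : ∀ m s → s ≡ m * m + (s + (m * m - + 2 / 1 * m * m))
      lemma = solve-∀ ring

    -- For z ≥ w > 0 and any m, m²w/z ≤ w(2m − z) + (z − m)²; take means.
    inverse-moment : ∀ {z : A → ℚ} {w m Q r y} →
      0ℚ < w → (∀ x → w ≤ z x) → E z ≡ m → E (λ x → (z x - m) * (z x - m)) ≤ Q →
      0ℚ < y → y * (w * m + Q) ≤ r * (m * m * w) → E (λ x → inv (z x)) ≤ r * inv y
    inverse-moment {z} {w} {m} {Q} {r} {y} 0<w w≤z Ez≡m var≤Q 0<y bound =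
      cancelˡ-≤ (pos⊗ (pos⊗ (pos⊗ 0<m 0<m) 0<w) 0<y) (begin
        (m * m * w) * y * I
          ≡⟨ swap (m * m * w) y I ⟩
        y * ((m * m * w) * I)
          ≤⟨ *-monoˡ-≤-nonNeg y {{ℚ.nonNegative (<⇒≤ 0<y)}} averaged ⟩
        y * (w * m + Q)
          ≤⟨ bound ⟩
        r * (m * m * w)
          ≡⟨ sym (trans (unswap (m * m * w) y r (inv y)) (trans (cong (λ i → r * (m * m * w) * i) (inv-cancelʳ 0<y)) (*-identityʳ _))) ⟩
        (m * m * w) * y * (r * inv y) ∎)
      where
      open ≤-Reasoning
      I = E (λ x → inv (z x))
      0<m : 0ℚ < m
      0<m = <-≤-trans 0<w (subst₂ _≤_ (E-const w) Ez≡m (E-mono w≤z))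
      swap : ∀ p y i → p * y * i ≡ y * (p * i)
      swap = solve-∀ ring
      unswap : ∀ p y r i → p * y * (r * i) ≡ r * p * (y * i)
      unswap = solve-∀ ring
      pointwise : ∀ {z i} → w ≤ z → 0ℚ ≤ i → z * i ≡ 1ℚ →
        (m * m * w) * i ≤ - w * z + (1ℚ * ((z - m) * (z - m)) + + 2 / 1 * w * m)
      pointwise {z} {i} w≤z 0≤i zi≡1 = subst ((m * m * w) * i ≤_) (trans (cong (_* t) zi≡1) (*-identityˡ t))
        (by-gap (gap w≤z ⊗ sq (z - m) ⊗ 0≤i) (lemma m w z i))
        where
        t = - w * z + (1ℚ * ((z - m) * (z - m)) + + 2 / 1 * w * m)
        lemma : ∀ m w z i → z * i * (- w * z + (1ℚ * ((z - m) * (z - m)) + + 2 / 1 * w * m))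
                ≡ (m * m * w) * i + (z - w) * ((z - m) * (z - m)) * i
        lemma = solve-∀ ring
      collect : ∀ {v} → v ≤ Q → - w * m + (1ℚ * v + + 2 / 1 * w * m) ≤ w * m + Q
      collect {v} v≤Q = by-gap (gap v≤Q) (solve (w ∷ m ∷ v ∷ Q ∷ []) ring)
      averaged : (m * m * w) * I ≤ w * m + Q
      averaged = begin
        (m * m * w) * I
          ≡⟨ E-* (m * m * w) (λ x → inv (z x)) ⟨
        E (λ x → (m * m * w) * inv (z x))
          ≤⟨ E-mono (λ x → let 0<z = <-≤-trans 0<w (w≤z x) in pointwise (w≤z x) (inv-≥0 0<z) (inv-cancelʳ 0<z)) ⟩
        E (λ x → - w * z x + (1ℚ * ((z x - m) * (z x - m)) + + 2 / 1 * w * m))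
          ≡⟨ E-linear (- w) z (λ x → 1ℚ * ((z x - m) * (z x - m)) + + 2 / 1 * w * m) ⟩
        - w * E z + E (λ x → 1ℚ * ((z x - m) * (z x - m)) + + 2 / 1 * w * m)
          ≡⟨ cong₂ (λ p q → - w * p + q) Ez≡m (E-linear 1ℚ (λ x → (z x - m) * (z x - m)) (λ _ → + 2 / 1 * w * m)) ⟩
        - w * m + (1ℚ * E (λ x → (z x - m) * (z x - m)) + E (λ _ → + 2 / 1 * w * m))
          ≡⟨ cong (λ p → - w * m + (1ℚ * E (λ x → (z x - m) * (z x - m)) + p)) (E-const (+ 2 / 1 * w * m)) ⟩
        - w * m + (1ℚ * E (λ x → (z x - m) * (z x - m)) + + 2 / 1 * w * m)
          ≤⟨ collect var≤Q ⟩
        w * m + Q ∎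

  open Expectation

  sum-≥0 : ∀ {n} (f : Fin n → ℚ) → (∀ i → 0ℚ ≤ f i) → 0ℚ ≤ sum f
  sum-≥0 {zero}  f 0≤f = ≤-refl
  sum-≥0 {suc n} f 0≤f = 0≤f zero ⊕ sum-≥0 (f ∘ suc) (0≤f ∘ suc)

  sum-mono : ∀ {n} {f g : Fin n → ℚ} → (∀ i → f i ≤ g i) → sum f ≤ sum g
  sum-mono {zero}  f≤g = ≤-refl
  sum-mono {suc n} f≤g = +-mono-≤ (f≤g zero) (sum-mono (f≤g ∘ suc))

  sum-const : ∀ n c → sum {n} (λ _ → c) ≡ ι n * c
  sum-const zero    c = sym (*-zeroˡ c)
  sum-const (suc n) c = trans (cong (_+_ (c)) (sum-const n c)) (sym (trans (cong (_* c) (ι-+ 1 n)) (lemma (ι n) c)))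
    where
    lemma : ∀ m c → (1ℚ + m) * c ≡ c + m * c
    lemma = solve-∀ ring

  uniform : ∀ n .{{_ : NonZero n}} → Expectation (Fin n)
  uniform n = record
    { E      = λ F → inv (ι n) * sum F
    ; E-cong = λ F≗G → cong (inv (ι n) *_) (sum-cong-≗ F≗G)
    ; E-+    = λ F G → trans (cong (inv (ι n) *_) (∑-distrib-+ F G)) (*-distribˡ-+ (inv (ι n)) _ _)
    ; E-*    = λ c F → trans (cong (inv (ι n) *_) (sym (*-distribˡ-sum c F))) (lemma (inv (ι n)) c (sum F))
    ; E-1    = trans (cong (inv (ι n) *_) (trans (sum-const n 1ℚ) (*-identityʳ (ι n)))) (trans (*-comm (inv (ι n)) (ι n)) (inv-cancelʳ (ι-pos n)))
    ; E-≥0   = λ 0≤F → inv-≥0 (ι-pos n) ⊗ sum-≥0 _ 0≤F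
    }
    where
    lemma : ∀ i c s → i * (c * s) ≡ c * (i * s)
    lemma = solve-∀ ring

  -- Independence is built in: the coordinates are integrated one after the other, so moments of
  -- sums follow by induction on their number.
  _^ᴱ_ : ∀ {A} → Expectation A → ∀ k → Expectation (Fin k → A)
  e ^ᴱ zero = record
    { E      = λ F → F (λ ())
    ; E-cong = λ F≗G → F≗G (λ ())
    ; E-+    = λ _ _ → refl
    ; E-*    = λ _ _ → refl
    ; E-1    = refl
    ; E-≥0   = λ 0≤F → 0≤F (λ ())
    }
  e ^ᴱ suc k = record
    { E      = λ F → E e λ x → E (e ^ᴱ k) λ f → F (x Vector.∷ f)
    ; E-cong = λ F≗G → E-cong e λ x → E-cong (e ^ᴱ k) λ f → F≗G (x Vector.∷ f)
    ; E-+    = λ F G → trans (E-cong e λ x → E-+ (e ^ᴱ k) (λ f → F (x Vector.∷ f)) (λ f → G (x Vector.∷ f))) (E-+ e _ _)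
    ; E-*    = λ c F → trans (E-cong e λ x → E-* (e ^ᴱ k) c (λ f → F (x Vector.∷ f))) (E-* e c _)
    ; E-1    = trans (E-cong e λ _ → E-1 (e ^ᴱ k)) (E-1 e)
    ; E-≥0   = λ 0≤F → E-≥0 e λ x → E-≥0 (e ^ᴱ k) λ f → 0≤F (x Vector.∷ f)
    }

  -- Moments of sums of independent centred variables

  module _ {A : Set} (e : Expectation A) where

    ∑ᴿ : ∀ {k} → (Fin k → A → ℚ) → (Fin k → A) → ℚ
    ∑ᴿ ξ f = sum (λ u → ξ u (f u))

    E-∑ᴿ : ∀ {k} (ξ : Fin k → A → ℚ) → E (e ^ᴱ k) (∑ᴿ ξ) ≡ sum (λ u → E e (ξ u))
    E-∑ᴿ {zero}  ξ = refl
    E-∑ᴿ {suc k} ξ = begin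
      E e (λ x → E (e ^ᴱ k) (λ f → ξ zero x + ∑ᴿ (ξ ∘ suc) f))
        ≡⟨ E-cong e (λ x → trans (E-+ (e ^ᴱ k) _ _) (cong₂ _+_ (E-const (e ^ᴱ k) (ξ zero x)) (E-∑ᴿ (ξ ∘ suc)))) ⟩
      E e (λ x → ξ zero x + sum (λ u → E e (ξ (suc u))))
        ≡⟨ E-+ e _ _ ⟩
      E e (ξ zero) + E e (λ _ → sum (λ u → E e (ξ (suc u))))
        ≡⟨ cong (_+_ (E e (ξ zero))) (E-const e _) ⟩
      E e (ξ zero) + sum (λ u → E e (ξ (suc u))) ∎
      where open ≡-Reasoning

    Centred : ∀ {k} → (Fin k → A → ℚ) → Set
    Centred ξ = ∀ u → E e (ξ u) ≡ 0ℚ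

    E-∑ᴿ-centred : ∀ {k} (ξ : Fin k → A → ℚ) → Centred ξ → E (e ^ᴱ k) (∑ᴿ ξ) ≡ 0ℚ
    E-∑ᴿ-centred {k} ξ ctr = trans (E-∑ᴿ ξ) (trans (sum-cong-≗ ctr) (trans (sum-const k 0ℚ) (*-zeroʳ (ι k))))

    E-∑ᴿ² : ∀ {k} (ξ : Fin k → A → ℚ) → Centred ξ →
            E (e ^ᴱ k) (λ f → ∑ᴿ ξ f * ∑ᴿ ξ f) ≡ sum (λ u → E e (λ x → ξ u x * ξ u x))
    E-∑ᴿ² {zero}  ξ ctr = refl
    E-∑ᴿ² {suc k} ξ ctr = begin
      E e (λ x → E eᵏ (λ f → (ξ zero x + S f) * (ξ zero x + S f)))
        ≡⟨ E-cong e inner ⟩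
      E e (λ x → ξ zero x * ξ zero x + V)
        ≡⟨ E-+ e _ _ ⟩
      E e (λ x → ξ zero x * ξ zero x) + E e (λ _ → V)
        ≡⟨ cong (_+_ (E e (λ x → ξ zero x * ξ zero x))) (E-const e V) ⟩
      E e (λ x → ξ zero x * ξ zero x) + V ∎
      where
      open ≡-Reasoning
      eᵏ = e ^ᴱ k
      S  = ∑ᴿ (ξ ∘ suc)
      V  = sum (λ u → E e (λ x → ξ (suc u) x * ξ (suc u) x))
      expand : ∀ x s → (x + s) * (x + s) ≡ (+ 2 / 1 * x) * s + (1ℚ * (s * s) + x * x)
      expand = solve-∀ ring
      collapse : ∀ x v → (+ 2 / 1 * x) * 0ℚ + (1ℚ * v + x * x) ≡ x * x + v
      collapse = solve-∀ ring
      inner : ∀ x → E eᵏ (λ f → (ξ zero x + S f) * (ξ zero x + S f)) ≡ ξ zero x * ξ zero x + V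
      inner x = begin
        E eᵏ (λ f → (y + S f) * (y + S f))
          ≡⟨ E-cong eᵏ (λ f → expand y (S f)) ⟩
        E eᵏ (λ f → (+ 2 / 1 * y) * S f + (1ℚ * (S f * S f) + y * y))
          ≡⟨ E-linear eᵏ (+ 2 / 1 * y) S (λ f → 1ℚ * (S f * S f) + y * y) ⟩
        (+ 2 / 1 * y) * E eᵏ S + E eᵏ (λ f → 1ℚ * (S f * S f) + y * y)
          ≡⟨ cong₂ (λ m v → (+ 2 / 1 * y) * m + v) (E-∑ᴿ-centred (ξ ∘ suc) (ctr ∘ suc))
               (trans (E-linear eᵏ 1ℚ (λ f → S f * S f) (λ _ → y * y)) (cong₂ (λ m v → 1ℚ * m + v) (E-∑ᴿ² (ξ ∘ suc) (ctr ∘ suc)) (E-const eᵏ _))) ⟩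
        (+ 2 / 1 * y) * 0ℚ + (1ℚ * V + y * y)
          ≡⟨ collapse y V ⟩
        y * y + V ∎
        where y = ξ zero x

    -- Splitting off the first coordinate x from the rest S leaves x⁴ + 6x²S² + S⁴ in mean: the
    -- terms in x³S and xS³ vanish by centring, whatever the third moment of S is. The induction
    -- closes because 4 + 6k + 4k² ≤ 4(k + 1)². The growth is quadratic in `k`, as for a Gaussian.
    E-∑ᴿ⁴ : ∀ {k} (ξ : Fin k → A → ℚ) → Centred ξ →
            (∀ u → E e (λ x → ξ u x * ξ u x) ≤ 1ℚ) →
            (∀ u → E e (λ x → (ξ u x * ξ u x) * (ξ u x * ξ u x)) ≤ + 4 / 1) →
            E (e ^ᴱ k) (λ f → (∑ᴿ ξ f * ∑ᴿ ξ f) * (∑ᴿ ξ f * ∑ᴿ ξ f)) ≤ + 4 / 1 * (ι k * ι k)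
    E-∑ᴿ⁴ {zero}  ξ ctr v≤1 m≤4 = ≤-refl
    E-∑ᴿ⁴ {suc k} ξ ctr v≤1 m≤4 = begin
      E e (λ x → E eᵏ (λ f → let s = ξ zero x + S f in (s * s) * (s * s)))
        ≡⟨ E-cong e inner ⟩
      E e (λ x → (+ 4 / 1 * M₃) * ξ zero x + ((+ 6 / 1 * V) * (ξ zero x * ξ zero x)
            + (1ℚ * ((ξ zero x * ξ zero x) * (ξ zero x * ξ zero x)) + M₄)))
        ≡⟨ outer ⟩
      (+ 4 / 1 * M₃) * 0ℚ + ((+ 6 / 1 * V) * v₀ + (1ℚ * m₀ + M₄))
        ≤⟨ bound {M₃} V≥0 V≤k (v≤1 zero) (m≤4 zero) (E-∑ᴿ⁴ (ξ ∘ suc) (ctr ∘ suc) (v≤1 ∘ suc) (m≤4 ∘ suc)) (ι-≥0 k) ⟩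
      + 4 / 1 * ((1ℚ + ι k) * (1ℚ + ι k))
        ≡⟨ cong (λ m → + 4 / 1 * (m * m)) (sym (ι-+ 1 k)) ⟩
      + 4 / 1 * (ι (suc k) * ι (suc k)) ∎
      where
      open ≤-Reasoning
      eᵏ = e ^ᴱ k
      S  = ∑ᴿ (ξ ∘ suc)
      V  = sum (λ u → E e (λ x → ξ (suc u) x * ξ (suc u) x))
      M₃ = E eᵏ (λ f → (S f * S f) * S f)
      M₄ = E eᵏ (λ f → (S f * S f) * (S f * S f))
      v₀ = E e (λ x → ξ zero x * ξ zero x)
      m₀ = E e (λ x → (ξ zero x * ξ zero x) * (ξ zero x * ξ zero x))
      V≥0 : 0ℚ ≤ V
      V≥0 = sum-≥0 _ λ u → E-≥0 e λ x → sq (ξ (suc u) x)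
      V≤k : V ≤ ι k
      V≤k = ≤-trans (sum-mono (v≤1 ∘ suc)) (≤-reflexive (trans (sum-const k 1ℚ) (*-identityʳ (ι k))))
      expand : ∀ x s → ((x + s) * (x + s)) * ((x + s) * (x + s)) ≡
        (+ 4 / 1 * (x * x * x)) * s + ((+ 6 / 1 * (x * x)) * (s * s)
          + ((+ 4 / 1 * x) * ((s * s) * s) + (1ℚ * ((s * s) * (s * s)) + (x * x) * (x * x))))
      expand = solve-∀ ring
      collapse : ∀ x v t w → (+ 4 / 1 * (x * x * x)) * 0ℚ + ((+ 6 / 1 * (x * x)) * v
          + ((+ 4 / 1 * x) * t + (1ℚ * w + (x * x) * (x * x)))) ≡
        (+ 4 / 1 * t) * x + ((+ 6 / 1 * v) * (x * x) + (1ℚ * ((x * x) * (x * x)) + w))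
      collapse = solve-∀ ring
      bound : ∀ {t v v₀ m₀ w k} → 0ℚ ≤ v → v ≤ k → v₀ ≤ 1ℚ → m₀ ≤ + 4 / 1 → w ≤ + 4 / 1 * (k * k) → 0ℚ ≤ k →
        (+ 4 / 1 * t) * 0ℚ + ((+ 6 / 1 * v) * v₀ + (1ℚ * m₀ + w)) ≤ + 4 / 1 * ((1ℚ + k) * (1ℚ + k))
      bound {t} {v} {v₀} {m₀} {w} {k} 0≤v v≤k v₀≤1 m₀≤4 w≤ 0≤k = by-gap
        (lit (+ 6 / 1) ⊗ 0≤v ⊗ gap v₀≤1 ⊕ lit (+ 6 / 1) ⊗ gap v≤k ⊕ gap m₀≤4 ⊕ gap w≤ ⊕ lit (+ 2 / 1) ⊗ 0≤k)
        (solve (t ∷ v ∷ v₀ ∷ m₀ ∷ w ∷ k ∷ []) ring)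
      inner : ∀ x → E eᵏ (λ f → let s = ξ zero x + S f in (s * s) * (s * s)) ≡
        (+ 4 / 1 * M₃) * ξ zero x + ((+ 6 / 1 * V) * (ξ zero x * ξ zero x)
            + (1ℚ * ((ξ zero x * ξ zero x) * (ξ zero x * ξ zero x)) + M₄))
      inner x = begin-equality
        E eᵏ (λ f → let s = y + S f in (s * s) * (s * s))
          ≡⟨ E-cong eᵏ (λ f → expand y (S f)) ⟩
        E eᵏ (λ f → c₁ * S f + F₁ f)
          ≡⟨ E-linear eᵏ c₁ S F₁ ⟩
        c₁ * E eᵏ S + E eᵏ F₁
          ≡⟨ cong₂ (λ m v → c₁ * m + v) (E-∑ᴿ-centred (ξ ∘ suc) (ctr ∘ suc)) (E-linear eᵏ c₂ (λ f → S f * S f) F₂) ⟩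
        c₁ * 0ℚ + (c₂ * E eᵏ (λ f → S f * S f) + E eᵏ F₂)
          ≡⟨ cong₂ (λ m v → c₁ * 0ℚ + (c₂ * m + v)) (E-∑ᴿ² (ξ ∘ suc) (ctr ∘ suc)) (E-linear eᵏ c₃ (λ f → S f * S f * S f) F₃) ⟩
        c₁ * 0ℚ + (c₂ * V + (c₃ * M₃ + E eᵏ F₃))
          ≡⟨ cong (λ v → c₁ * 0ℚ + (c₂ * V + (c₃ * M₃ + v))) (E-linear eᵏ 1ℚ (λ f → (S f * S f) * (S f * S f)) (λ _ → (y * y) * (y * y))) ⟩
        c₁ * 0ℚ + (c₂ * V + (c₃ * M₃ + (1ℚ * M₄ + E eᵏ (λ _ → (y * y) * (y * y)))))
          ≡⟨ cong (λ v → c₁ * 0ℚ + (c₂ * V + (c₃ * M₃ + (1ℚ * M₄ + v)))) (E-const eᵏ ((y * y) * (y * y))) ⟩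
        c₁ * 0ℚ + (c₂ * V + (c₃ * M₃ + (1ℚ * M₄ + (y * y) * (y * y))))
          ≡⟨ collapse y V M₃ M₄ ⟩
        (+ 4 / 1 * M₃) * y + ((+ 6 / 1 * V) * (y * y) + (1ℚ * ((y * y) * (y * y)) + M₄)) ∎
        where
        y  = ξ zero x
        c₁ = + 4 / 1 * (y * y * y)
        c₂ = + 6 / 1 * (y * y)
        c₃ = + 4 / 1 * y
        F₁ F₂ F₃ : (Fin k → A) → ℚ
        F₃ f = 1ℚ * ((S f * S f) * (S f * S f)) + (y * y) * (y * y)
        F₂ f = c₃ * (S f * S f * S f) + F₃ f
        F₁ f = c₂ * (S f * S f) + F₂ f
      outer : E e (λ x → (+ 4 / 1 * M₃) * ξ zero x + ((+ 6 / 1 * V) * (ξ zero x * ξ zero x)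
            + (1ℚ * ((ξ zero x * ξ zero x) * (ξ zero x * ξ zero x)) + M₄)))
        ≡ (+ 4 / 1 * M₃) * 0ℚ + ((+ 6 / 1 * V) * v₀ + (1ℚ * m₀ + M₄))
      outer = begin-equality
        E e (λ x → c₁ * ξ zero x + F₁ x)
          ≡⟨ E-linear e c₁ (ξ zero) F₁ ⟩
        c₁ * E e (ξ zero) + E e F₁
          ≡⟨ cong₂ (λ m v → c₁ * m + v) (ctr zero) (E-linear e c₂ (λ x → ξ zero x * ξ zero x) F₂) ⟩
        c₁ * 0ℚ + (c₂ * v₀ + E e F₂)
          ≡⟨ cong (λ v → c₁ * 0ℚ + (c₂ * v₀ + v)) (E-linear e 1ℚ (λ x → (ξ zero x * ξ zero x) * (ξ zero x * ξ zero x)) (λ _ → M₄)) ⟩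
        c₁ * 0ℚ + (c₂ * v₀ + (1ℚ * m₀ + E e (λ _ → M₄)))
          ≡⟨ cong (λ v → c₁ * 0ℚ + (c₂ * v₀ + (1ℚ * m₀ + v))) (E-const e M₄) ⟩
        c₁ * 0ℚ + (c₂ * v₀ + (1ℚ * m₀ + M₄)) ∎
        where
        c₁ = + 4 / 1 * M₃
        c₂ = + 6 / 1 * V
        F₁ F₂ : A → ℚ
        F₂ x = 1ℚ * ((ξ zero x * ξ zero x) * (ξ zero x * ξ zero x)) + M₄
        F₁ x = c₂ * (ξ zero x * ξ zero x) + F₂ x

  -- Observables of one round

  𝟙 : {P : Set} → Dec P → ℚ
  𝟙 P? = if does P? then 1ℚ else 0ℚ

  mix : ℚ → ℚ → ℚ → (State → ℚ) → ℚ
  mix α β κ w = α * w alpha + β * w beta + κ * w undecided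

  module _ {n : ℕ} .{{_ : NonZero n}} where
    ν : ℚ
    ν = inv (ι n)

    𝔸 : (Fin n → ℚ) → ℚ
    𝔸 = E (uniform n)

    pulls : Expectation (Fin n → Fin n)
    pulls = uniform n ^ᴱ n

    𝔼 : ((Fin n → Fin n) → ℚ) → ℚ
    𝔼 = E pulls

    α β κ : Config n → ℚ
    α x = 𝔸 (λ u → 𝟙 (x u ≟ₛ alpha))
    β x = 𝔸 (λ u → 𝟙 (x u ≟ₛ beta))
    κ x = 𝔸 (λ u → 𝟙 (x u ≟ₛ undecided))

    M : Config n → (State → ℚ) → ℚ
    M x = mix (α x) (β x) (κ x)

    -- Turns an average over the nodes into a polynomial in the three fractions, within reach of the
    -- ring solver.
    𝔸-M : ∀ w x → 𝔸 (λ u → w (x u)) ≡ M x w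
    𝔸-M w x = begin
      𝔸 (λ u → w (x u))
        ≡⟨ E-cong U (λ u → pointwise (x u)) ⟩
      𝔸 (λ u → w₁ * 𝟙 (x u ≟ₛ alpha) + (w₂ * 𝟙 (x u ≟ₛ beta) + w₃ * 𝟙 (x u ≟ₛ undecided)))
        ≡⟨ E-linear U w₁ _ (λ u → w₂ * 𝟙 (x u ≟ₛ beta) + w₃ * 𝟙 (x u ≟ₛ undecided)) ⟩
      w₁ * α x + 𝔸 (λ u → w₂ * 𝟙 (x u ≟ₛ beta) + w₃ * 𝟙 (x u ≟ₛ undecided))
        ≡⟨ cong (_+_ (w₁ * α x)) (trans (E-linear U w₂ _ (λ u → w₃ * 𝟙 (x u ≟ₛ undecided))) (cong (_+_ (w₂ * β x)) (E-* U w₃ _))) ⟩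
      w₁ * α x + (w₂ * β x + w₃ * κ x)
        ≡⟨ swap w₁ w₂ w₃ (α x) (β x) (κ x) ⟩
      M x w ∎
      where
      open ≡-Reasoning
      U  = uniform n
      w₁ = w alpha
      w₂ = w beta
      w₃ = w undecided
      at₁ : ∀ a b c → a ≡ a * 1ℚ + (b * 0ℚ + c * 0ℚ)
      at₁ = solve-∀ ring
      at₂ : ∀ a b c → b ≡ a * 0ℚ + (b * 1ℚ + c * 0ℚ)
      at₂ = solve-∀ ring
      at₃ : ∀ a b c → c ≡ a * 0ℚ + (b * 0ℚ + c * 1ℚ)
      at₃ = solve-∀ ring
      pointwise : ∀ σ → w σ ≡ w₁ * 𝟙 (σ ≟ₛ alpha) + (w₂ * 𝟙 (σ ≟ₛ beta) + w₃ * 𝟙 (σ ≟ₛ undecided))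
      pointwise alpha     = at₁ w₁ w₂ w₃
      pointwise beta      = at₂ w₁ w₂ w₃
      pointwise undecided = at₃ w₁ w₂ w₃
      swap : ∀ a b c p q r → a * p + (b * q + c * r) ≡ p * a + q * b + r * c
      swap = solve-∀ ring

    𝟙-≥0 : ∀ {P : Set} (P? : Dec P) → 0ℚ ≤ 𝟙 P?
    𝟙-≥0 P? with does P?
    ... | true  = lit 1ℚ
    ... | false = ≤-refl

    α-≥0 : ∀ x → 0ℚ ≤ α x
    α-≥0 x = E-≥0 (uniform n) λ u → 𝟙-≥0 (x u ≟ₛ alpha)
    β-≥0 : ∀ x → 0ℚ ≤ β x
    β-≥0 x = E-≥0 (uniform n) λ u → 𝟙-≥0 (x u ≟ₛ beta)
    κ-≥0 : ∀ x → 0ℚ ≤ κ x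
    κ-≥0 x = E-≥0 (uniform n) λ u → 𝟙-≥0 (x u ≟ₛ undecided)

    κ≡ : ∀ x → κ x ≡ 1ℚ - α x - β x
    κ≡ x = trans (lemma (α x) (β x) (κ x)) (cong (λ m → m - α x - β x) (trans (sym (𝔸-M (λ _ → 1ℚ) x)) (E-1 (uniform n))))
      where
      lemma : ∀ a b k → k ≡ (a * 1ℚ + b * 1ℚ + k * 1ℚ) - a - b
      lemma = solve-∀ ring

    M-mono : ∀ x {w w′} → (∀ σ → w σ ≤ w′ σ) → M x w ≤ M x w′
    M-mono x {w} {w′} w≤w′ = subst₂ _≤_ (𝔸-M w x) (𝔸-M w′ x) (E-mono (uniform n) (w≤w′ ∘ x))

    M-≤1 : ∀ x {w} → (∀ σ → w σ ≤ 1ℚ) → M x w ≤ 1ℚ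
    M-≤1 x {w} w≤1 = subst (_≤ 1ℚ) (𝔸-M w x) (E-≤1 (uniform n) (w≤1 ∘ x))

    obs : (State → State → ℚ) → Config n → (Fin n → Fin n) → ℚ
    obs g x f = 𝔸 (λ u → g (x u) (x (f u)))

    mean : (State → State → ℚ) → Config n → ℚ
    mean g x = M x (λ σ → M x (g σ))

    dev : (g : State → State → ℚ) (x : Config n) → Fin n → Fin n → ℚ
    dev g x u v = g (x u) (x v) - M x (g (x u))

    dev-centred : ∀ g x → Centred (uniform n) (dev g x)
    dev-centred g x u = begin
      𝔸 (λ v → g (x u) (x v) - m)    ≡⟨ E-+ (uniform n) _ (λ _ → - m) ⟩
      𝔸 (λ v → g (x u) (x v)) + 𝔸 (λ _ → - m)  ≡⟨ cong₂ _+_ (𝔸-M (g (x u)) x) (E-const (uniform n) (- m)) ⟩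
      m - m                          ≡⟨ +-inverseʳ m ⟩
      0ℚ                             ∎
      where
      open ≡-Reasoning
      m = M x (g (x u))

    -- The contribution of node u depends on its own pull only, so the deviation from the mean is
    -- `ν` times a sum of independent centred terms.
    obs-dev : ∀ g x f → obs g x f - mean g x ≡ ν * ∑ᴿ (uniform n) (dev g x) f
    obs-dev g x f = begin
      obs g x f - mean g x
        ≡⟨ cong (λ m → obs g x f - m) (sym (𝔸-M (λ σ → M x (g σ)) x)) ⟩
      obs g x f - 𝔸 (λ u → M x (g (x u)))
        ≡⟨ lemma (obs g x f) _ ⟩
      (- 1ℚ) * 𝔸 (λ u → M x (g (x u))) + obs g x f
        ≡⟨ E-linear (uniform n) (- 1ℚ) _ (λ u → g (x u) (x (f u))) ⟨
      𝔸 (λ u → (- 1ℚ) * M x (g (x u)) + g (x u) (x (f u)))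
        ≡⟨ E-cong (uniform n) (λ u → sym (lemma (g (x u) (x (f u))) (M x (g (x u))))) ⟩
      𝔸 (λ u → dev g x u (f u)) ∎
      where
      open ≡-Reasoning
      lemma : ∀ o m → o - m ≡ (- 1ℚ) * m + o
      lemma = solve-∀ ring

    𝔼-dev : ∀ g x → 𝔼 (λ f → obs g x f - mean g x) ≡ 0ℚ
    𝔼-dev g x = begin
      𝔼 (λ f → obs g x f - mean g x)  ≡⟨ E-cong pulls (obs-dev g x) ⟩
      𝔼 (λ f → ν * ∑ᴿ U (dev g x) f)  ≡⟨ E-* pulls ν (∑ᴿ U (dev g x)) ⟩
      ν * 𝔼 (∑ᴿ U (dev g x))          ≡⟨ cong (ν *_) (E-∑ᴿ-centred U (dev g x) (dev-centred g x)) ⟩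
      ν * 0ℚ                          ≡⟨ *-zeroʳ ν ⟩
      0ℚ                              ∎
      where
      open ≡-Reasoning
      U = uniform n

    𝔼-obs : ∀ g x → 𝔼 (obs g x) ≡ mean g x
    𝔼-obs g x = begin
      𝔼 (obs g x)                                ≡⟨ E-cong pulls (λ f → lemma (obs g x f) m) ⟩
      𝔼 (λ f → (obs g x f - m) + m)              ≡⟨ E-+ pulls (λ f → obs g x f - m) (λ _ → m) ⟩
      𝔼 (λ f → obs g x f - m) + 𝔼 (λ _ → m)      ≡⟨ cong₂ _+_ (𝔼-dev g x) (E-const pulls m) ⟩
      0ℚ + m                                     ≡⟨ +-identityˡ m ⟩
      m                                          ∎
      where
      open ≡-Reasoning
      m = mean g x
      lemma : ∀ o m → o ≡ (o - m) + m
      lemma = solve-∀ ring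

    -- An equality rather than a bound, because the symmetry breaking in the bias phase needs the
    -- variance from below.
    𝔼-dev² : ∀ g x → 𝔼 (λ f → (obs g x f - mean g x) * (obs g x f - mean g x)) ≡
             ν * M x (λ σ → M x (λ τ → (g σ τ - M x (g σ)) * (g σ τ - M x (g σ))))
    𝔼-dev² g x = begin
      𝔼 (λ f → (obs g x f - mean g x) * (obs g x f - mean g x))
        ≡⟨ E-cong pulls (λ f → trans (cong (λ d → d * d) (obs-dev g x f)) (lemma ν (S f))) ⟩
      𝔼 (λ f → ν * ν * (S f * S f))
        ≡⟨ E-* pulls (ν * ν) (λ f → S f * S f) ⟩
      ν * ν * 𝔼 (λ f → S f * S f)
        ≡⟨ cong (ν * ν *_) (E-∑ᴿ² U (dev g x) (dev-centred g x)) ⟩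
      ν * ν * sum (λ u → 𝔸 (λ v → dev g x u v * dev g x u v))
        ≡⟨ *-assoc ν ν _ ⟩
      ν * 𝔸 (λ u → 𝔸 (λ v → dev g x u v * dev g x u v))
        ≡⟨ cong (ν *_) (E-cong U λ u → 𝔸-M (λ τ → (g (x u) τ - M x (g (x u))) * (g (x u) τ - M x (g (x u)))) x) ⟩
      ν * 𝔸 (λ u → M x (λ τ → (g (x u) τ - M x (g (x u))) * (g (x u) τ - M x (g (x u)))))
        ≡⟨ cong (ν *_) (𝔸-M (λ σ → M x (λ τ → (g σ τ - M x (g σ)) * (g σ τ - M x (g σ)))) x) ⟩
      ν * M x (λ σ → M x (λ τ → (g σ τ - M x (g σ)) * (g σ τ - M x (g σ)))) ∎
      where
      open ≡-Reasoning
      U = uniform n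
      S = ∑ᴿ U (dev g x)
      lemma : ∀ ν s → (ν * s) * (ν * s) ≡ ν * ν * (s * s)
      lemma = solve-∀ ring

    ν-≥0 : 0ℚ ≤ ν
    ν-≥0 = inv-≥0 (ι-pos n)

    M-variance-≤ : ∀ w x → M x (λ τ → (w τ - M x w) * (w τ - M x w)) ≤ M x (λ τ → w τ * w τ)
    M-variance-≤ w x = subst₂ _≤_
      (trans (cong (λ m → 𝔸 (λ u → (w (x u) - m) * (w (x u) - m))) (𝔸-M w x)) (𝔸-M (λ τ → (w τ - M x w) * (w τ - M x w)) x))
      (𝔸-M (λ τ → w τ * w τ) x)
      (variance-≤ (uniform n) (w ∘ x))

    -- For an indicator `g` the right side is `ν` times the mean frequency of the event. This is
    -- what makes rare events concentrate well, beyond the uniform bound `ν`.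
    𝔼-dev²-≤ : ∀ g x → 𝔼 (λ f → (obs g x f - mean g x) * (obs g x f - mean g x)) ≤
               ν * mean (λ σ τ → g σ τ * g σ τ) x
    𝔼-dev²-≤ g x = ≤-trans (≤-reflexive (𝔼-dev² g x))
      (*-monoˡ-≤-nonNeg ν {{ℚ.nonNegative ν-≥0}} (M-mono x λ σ → M-variance-≤ (g σ) x))

    Bounded : (State → State → ℚ) → Set
    Bounded g = ∀ σ τ → g σ τ * g σ τ ≤ 1ℚ

    𝔼-dev²-≤ν : ∀ g x → Bounded g → 𝔼 (λ f → (obs g x f - mean g x) * (obs g x f - mean g x)) ≤ ν
    𝔼-dev²-≤ν g x g²≤1 = ≤-trans (𝔼-dev²-≤ g x) (≤-trans
      (*-monoˡ-≤-nonNeg ν {{ℚ.nonNegative ν-≥0}} (M-≤1 x λ σ → M-≤1 x (g²≤1 σ)))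
      (≤-reflexive (*-identityʳ ν)))

    𝔼-dev⁴-≤ : ∀ g x → Bounded g →
      𝔼 (λ f → ((obs g x f - mean g x) * (obs g x f - mean g x)) * ((obs g x f - mean g x) * (obs g x f - mean g x)))
        ≤ + 4 / 1 * (ν * ν)
    𝔼-dev⁴-≤ g x g²≤1 = begin
      𝔼 (λ f → ((obs g x f - mean g x) * (obs g x f - mean g x)) * ((obs g x f - mean g x) * (obs g x f - mean g x)))
        ≡⟨ E-cong pulls (λ f → trans (cong (λ d → (d * d) * (d * d)) (obs-dev g x f)) (lemma ν (S f))) ⟩
      𝔼 (λ f → (ν * ν) * (ν * ν) * ((S f * S f) * (S f * S f)))
        ≡⟨ E-* pulls ((ν * ν) * (ν * ν)) (λ f → (S f * S f) * (S f * S f)) ⟩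
      (ν * ν) * (ν * ν) * 𝔼 (λ f → (S f * S f) * (S f * S f))
        ≤⟨ *-monoˡ-≤-nonNeg ((ν * ν) * (ν * ν)) {{ℚ.nonNegative (sq (ν * ν))}}
             (E-∑ᴿ⁴ U ξ (dev-centred g x) second fourth) ⟩
      (ν * ν) * (ν * ν) * (+ 4 / 1 * (ι n * ι n))
        ≡⟨ regroup ν (ι n) ⟩
      + 4 / 1 * (ν * ν) * ((ι n * ν) * (ι n * ν))
        ≡⟨ cong (λ i → + 4 / 1 * (ν * ν) * (i * i)) (inv-cancelʳ (ι-pos n)) ⟩
      + 4 / 1 * (ν * ν) * (1ℚ * 1ℚ)
        ≡⟨ *-identityʳ _ ⟩
      + 4 / 1 * (ν * ν) ∎
      where
      open ≤-Reasoning
      U = uniform n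
      ξ = dev g x
      S = ∑ᴿ U ξ
      lemma : ∀ ν s → ((ν * s) * (ν * s)) * ((ν * s) * (ν * s)) ≡ (ν * ν) * (ν * ν) * ((s * s) * (s * s))
      lemma = solve-∀ ring
      regroup : ∀ ν i → (ν * ν) * (ν * ν) * (+ 4 / 1 * (i * i)) ≡ + 4 / 1 * (ν * ν) * ((i * ν) * (i * ν))
      regroup = solve-∀ ring
      m²≤1 : ∀ u → M x (g (x u)) * M x (g (x u)) ≤ 1ℚ
      m²≤1 u = ≤-trans (≤-reflexive (cong (λ m → m * m) (sym (𝔸-M (g (x u)) x))))
        (≤-trans (mean-square-≤ U (g (x u) ∘ x)) (E-≤1 U λ v → g²≤1 (x u) (x v)))
      second : ∀ u → 𝔸 (λ v → ξ u v * ξ u v) ≤ 1ℚ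
      second u = ≤-trans (≤-reflexive (𝔸-M (λ τ → (g (x u) τ - M x (g (x u))) * (g (x u) τ - M x (g (x u)))) x))
        (≤-trans (M-variance-≤ (g (x u)) x) (M-≤1 x (g²≤1 (x u))))
      parallelogram : ∀ {p m} → p * p ≤ 1ℚ → m * m ≤ 1ℚ → (p - m) * (p - m) ≤ + 4 / 1
      parallelogram {p} {m} p²≤1 m²≤1 = by-gap
        (sq (p + m) ⊕ lit (+ 2 / 1) ⊗ gap p²≤1 ⊕ lit (+ 2 / 1) ⊗ gap m²≤1) (solve (p ∷ m ∷ []) ring)
      ξ²≤4 : ∀ u v → ξ u v * ξ u v ≤ + 4 / 1
      ξ²≤4 u v = parallelogram {g (x u) (x v)} {M x (g (x u))} (g²≤1 (x u) (x v)) (m²≤1 u)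
      fourth : ∀ u → 𝔸 (λ v → (ξ u v * ξ u v) * (ξ u v * ξ u v)) ≤ + 4 / 1
      fourth u = begin
        𝔸 (λ v → (ξ u v * ξ u v) * (ξ u v * ξ u v))
          ≤⟨ E-mono U (λ v → *-monoʳ-≤-nonNeg (ξ u v * ξ u v) {{ℚ.nonNegative (sq (ξ u v))}} (ξ²≤4 u v)) ⟩
        𝔸 (λ v → + 4 / 1 * (ξ u v * ξ u v))
          ≡⟨ E-* U (+ 4 / 1) (λ v → ξ u v * ξ u v) ⟩
        + 4 / 1 * 𝔸 (λ v → ξ u v * ξ u v)
          ≤⟨ *-monoˡ-≤-nonNeg (+ 4 / 1) (second u) ⟩
        + 4 / 1 * 1ℚ ≡⟨⟩
        + 4 / 1 ∎

  -- Drift towards a goal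

  ^-≥0 : ∀ {r} T → 0ℚ ≤ r → 0ℚ ≤ r ^ T
  ^-≥0 zero    0≤r = lit 1ℚ
  ^-≥0 (suc T) 0≤r = 0≤r ⊗ ^-≥0 T 0≤r

  module _ {n : ℕ} .{{_ : NonZero n}} where
    -- The probability of seeing no consensus at any of the times 0 to T, as a recursion on the
    -- first round; `𝔼-hit` relates it to the count in `Pr`. Consensus ends the recursion, in
    -- accordance with `ConvergesTo`, which asks for a visit at some time.
    miss : ℕ → Config n → ℚ
    miss T x with colorConsensus? x
    miss T       x | yes _ = 0ℚ
    miss zero    x | no _  = 1ℚ
    miss (suc T) x | no _  = 𝔼 (λ f → miss T (step f x))

    miss-≥0 : ∀ T x → 0ℚ ≤ miss T x
    miss-≥0 T x with colorConsensus? x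
    miss-≥0 T       x | yes _ = ≤-refl
    miss-≥0 zero    x | no _  = lit 1ℚ
    miss-≥0 (suc T) x | no _  = E-≥0 pulls λ f → miss-≥0 T (step f x)

    miss-≤1 : ∀ T x → miss T x ≤ 1ℚ
    miss-≤1 T x with colorConsensus? x
    miss-≤1 T       x | yes _ = lit 1ℚ
    miss-≤1 zero    x | no _  = ≤-refl
    miss-≤1 (suc T) x | no _  = E-≤1 pulls λ f → miss-≤1 T (step f x)

    miss-suc : ∀ T x → miss (suc T) x ≤ miss T x
    miss-suc T x with colorConsensus? x
    miss-suc T       x | yes _ = ≤-refl
    miss-suc zero    x | no _  = E-≤1 pulls λ f → miss-≤1 zero (step f x)
    miss-suc (suc T) x | no _  = E-mono pulls λ f → miss-suc T (step f x)

    miss-+ : ∀ k T x → miss (k ℕ.+ T) x ≤ miss T x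
    miss-+ zero    T x = ≤-refl
    miss-+ (suc k) T x = ≤-trans (miss-suc (k ℕ.+ T) x) (miss-+ k T x)

    miss-step : ∀ T x → miss (suc T) x ≤ 𝔼 (λ f → miss T (step f x))
    miss-step T x with colorConsensus? x
    ... | yes _ = E-≥0 pulls λ f → miss-≥0 T (step f x)
    ... | no _  = ≤-refl

    consensus⇒miss≡0 : ∀ T x → ColorConsensus x → miss T x ≡ 0ℚ
    consensus⇒miss≡0 T x h with colorConsensus? x
    consensus⇒miss≡0 T x h | yes _ = refl
    consensus⇒miss≡0 T x h | no ¬h with () ← ¬h h

    -- Pulls f with bad f ≥ 1 count as failures; by Markov they have probability at most 𝔼 bad.
    record Round (R G : Config n → Set) (Φ : Config n → ℚ) (r δ : ℚ) (x : Config n) : Set where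
      field
        bad pot : (Fin n → Fin n) → ℚ
        bad-≥0  : ∀ f → 0ℚ ≤ bad f
        pot-≥0  : ∀ f → 0ℚ ≤ pot f
        𝔼-bad   : 𝔼 bad ≤ δ
        𝔼-pot   : 𝔼 pot ≤ r * Φ x
        cases   : ∀ f → 1ℚ ≤ bad f ⊎ G (step f x) ⊎ (R (step f x) × Φ (step f x) ≤ pot f)

    -- Markov's inequality for a stopped supermartingale, by induction on `T`. Off the goal `Φ` is
    -- at least 1, so its decaying mean bounds the probability of still being off the goal; `δ` is
    -- paid for each round that may be bad, and `ε` for failing within the `T₂` rounds reserved for
    -- what follows the goal. If the goal comes early, the rounds left over are given away by
    -- `miss-+`.
    drift : ∀ {R G : Config n → Set} (G? : ∀ x → Dec (G x)) {Φ : Config n → ℚ} {r δ ε : ℚ} {T₂ : ℕ} →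
            0ℚ ≤ r → 0ℚ ≤ δ → 0ℚ ≤ ε →
            (∀ x → G x → miss T₂ x ≤ ε) →
            (∀ x → R x → 0ℚ ≤ Φ x) →
            (∀ x → R x → ¬ G x → 1ℚ ≤ Φ x) →
            (∀ x → R x → ¬ G x → Round R G Φ r δ x) →
            ∀ T x → R x → miss (T ℕ.+ T₂) x ≤ ε + (r ^ T * Φ x + ι T * δ)
    drift {R} {G} G? {Φ} {r} {δ} {ε} {T₂} 0≤r 0≤δ 0≤ε onG Φ≥0 Φ≥1 round = go
      where
      weaken : ∀ {m ε p q} → m ≤ ε → 0ℚ ≤ p → 0ℚ ≤ q → m ≤ ε + (p + q)
      weaken {m} {ε} {p} {q} m≤ε 0≤p 0≤q = by-gap (gap m≤ε ⊕ 0≤p ⊕ 0≤q) (solve (m ∷ ε ∷ p ∷ q ∷ []) ring)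
      weaken₀ : ∀ {ε φ δ} → 0ℚ ≤ ε → 1ℚ ≤ φ → 1ℚ ≤ ε + (1ℚ * φ + 0ℚ * δ)
      weaken₀ {ε} {φ} {δ} 0≤ε 1≤φ = by-gap (0≤ε ⊕ gap 1≤φ) (solve (ε ∷ φ ∷ δ ∷ []) ring)
      go : ∀ T x → R x → miss (T ℕ.+ T₂) x ≤ ε + (r ^ T * Φ x + ι T * δ)
      go T x Rx with G? x
      go T x Rx | yes Gx = weaken (≤-trans (miss-+ T T₂ x) (onG x Gx)) (^-≥0 T 0≤r ⊗ Φ≥0 x Rx) (ι-≥0 T ⊗ 0≤δ)
      go zero x Rx | no ¬Gx = ≤-trans (miss-≤1 T₂ x) (weaken₀ {δ = δ} 0≤ε (Φ≥1 x Rx ¬Gx))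
      go (suc T) x Rx | no ¬Gx = begin
        miss (suc T ℕ.+ T₂) x
          ≤⟨ miss-step (T ℕ.+ T₂) x ⟩
        𝔼 (λ f → miss (T ℕ.+ T₂) (step f x))
          ≤⟨ E-mono pulls each ⟩
        𝔼 (λ f → r ^ T * pot f + (1ℚ * bad f + (ε + ι T * δ)))
          ≡⟨ E-linear pulls (r ^ T) pot (λ f → 1ℚ * bad f + (ε + ι T * δ)) ⟩
        r ^ T * 𝔼 pot + 𝔼 (λ f → 1ℚ * bad f + (ε + ι T * δ))
          ≡⟨ cong (λ v → r ^ T * 𝔼 pot + v) (E-linear pulls 1ℚ bad (λ _ → ε + ι T * δ)) ⟩
        r ^ T * 𝔼 pot + (1ℚ * 𝔼 bad + 𝔼 (λ _ → ε + ι T * δ))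
          ≡⟨ cong (λ v → r ^ T * 𝔼 pot + (1ℚ * 𝔼 bad + v)) (E-const pulls (ε + ι T * δ)) ⟩
        r ^ T * 𝔼 pot + (1ℚ * 𝔼 bad + (ε + ι T * δ))
          ≤⟨ total {t = ι T} (^-≥0 T 0≤r) 𝔼-pot 𝔼-bad ⟩
        ε + (r * r ^ T * Φ x + (1ℚ + ι T) * δ)
          ≡⟨ cong (λ t → ε + (r * r ^ T * Φ x + t * δ)) (sym (ι-+ 1 T)) ⟩
        ε + (r ^ suc T * Φ x + ι (suc T) * δ) ∎
        where
        open ≤-Reasoning
        open Round (round x Rx ¬Gx)
        total : ∀ {ρ p φ b t} → 0ℚ ≤ ρ → p ≤ r * φ → b ≤ δ →
                ρ * p + (1ℚ * b + (ε + t * δ)) ≤ ε + (r * ρ * φ + (1ℚ + t) * δ)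
        total {ρ} {p} {φ} {b} {t} 0≤ρ p≤ b≤δ = by-gap (0≤ρ ⊗ gap p≤ ⊕ gap b≤δ)
          (solve (ρ ∷ p ∷ φ ∷ b ∷ t ∷ r ∷ δ ∷ ε ∷ []) ring)
        bad-case : ∀ {m c b e} → m ≤ 1ℚ → 1ℚ ≤ b → 0ℚ ≤ c → 0ℚ ≤ e → m ≤ c + (1ℚ * b + e)
        bad-case {m} {c} {b} {e} m≤1 1≤b 0≤c 0≤e = by-gap (gap m≤1 ⊕ gap 1≤b ⊕ 0≤c ⊕ 0≤e) (solve (m ∷ c ∷ b ∷ e ∷ []) ring)
        goal-case : ∀ {m ε c b e} → m ≤ ε → 0ℚ ≤ b → 0ℚ ≤ c → 0ℚ ≤ e → m ≤ c + (1ℚ * b + (ε + e))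
        goal-case {m} {ε} {c} {b} {e} m≤ 0≤b 0≤c 0≤e = by-gap (gap m≤ ⊕ 0≤b ⊕ 0≤c ⊕ 0≤e) (solve (m ∷ ε ∷ c ∷ b ∷ e ∷ []) ring)
        good-case : ∀ {m ε ρ φ p b e} → m ≤ ε + (ρ * φ + e) → 0ℚ ≤ ρ → φ ≤ p → 0ℚ ≤ b → m ≤ ρ * p + (1ℚ * b + (ε + e))
        good-case {m} {ε} {ρ} {φ} {p} {b} {e} m≤ 0≤ρ φ≤p 0≤b = by-gap (gap m≤ ⊕ 0≤ρ ⊗ gap φ≤p ⊕ 0≤b)
          (solve (m ∷ ε ∷ ρ ∷ φ ∷ p ∷ b ∷ e ∷ []) ring)
        each : ∀ f → miss (T ℕ.+ T₂) (step f x) ≤ r ^ T * pot f + (1ℚ * bad f + (ε + ι T * δ))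
        each f with cases f
        ... | inj₁ 1≤bad = bad-case (miss-≤1 (T ℕ.+ T₂) (step f x)) 1≤bad (^-≥0 T 0≤r ⊗ pot-≥0 f) (0≤ε ⊕ ι-≥0 T ⊗ 0≤δ)
        ... | inj₂ (inj₁ G′) = goal-case (≤-trans (miss-+ T T₂ (step f x)) (onG (step f x) G′)) (bad-≥0 f) (^-≥0 T 0≤r ⊗ pot-≥0 f) (ι-≥0 T ⊗ 0≤δ)
        ... | inj₂ (inj₂ (R′ , Φ≤)) = good-case {ε = ε} {e = ι T * δ} (go T (step f x) R′) (^-≥0 T 0≤r) Φ≤ (bad-≥0 f)

  -- The last phase

  -- Converts a deviation `d` of at least 1/c into a value of at least 1 for the scaled square that
  -- serves as `bad`.
  far : ∀ {c d} → 1ℚ ≤ c * d → 1ℚ ≤ c * c * (d * d)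
  far {c} {d} 1≤cd = by-gap (sq (c * d - 1ℚ) ⊕ lit (+ 2 / 1) ⊗ gap 1≤cd) (solve (c ∷ d ∷ []) ring)

  -- In the bias phase the bias has variance at least ν κ²γ ≥ ν (1/512)²(1/16) = ην per round;
  -- A = 64/η and r = 1 − η/(4A) make the potential of that phase contract.
  η A r : ℚ
  η = + 1 / 4194304
  A = + 268435456 / 1
  r = + 4503599627370495 / 4503599627370496

  -- One rate serves every phase: `r` is dictated by the bias phase, while the last phase contracts
  -- by 3/4, growth by 9/10, and mixing takes a single round.
  3/4≤r : + 3 / 4 ≤ r
  3/4≤r = toWitness {a? = + 3 / 4 ≤? r} _

  -- `obs (next w) x f` is definitionally `share w (step f x)`, and for `w = und` it is
  -- definitionally `κ (step f x)`. Means and variances after a round are therefore instances of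
  -- `𝔼-obs` and `𝔼-dev²`.
  next : (State → ℚ) → State → State → ℚ
  next w σ τ = w (update σ τ)

  col sgn und : State → ℚ
  col alpha     = 1ℚ
  col beta      = 1ℚ
  col undecided = 0ℚ
  sgn alpha     = 1ℚ
  sgn beta      = - 1ℚ
  sgn undecided = 0ℚ
  und σ = 𝟙 (σ ≟ₛ undecided)

  -- wα weighs what is left to convert when alpha wins: a beta node mostly turns undecided in one
  -- round, so undecided nodes must weigh less for the total to contract.
  wα wβ : State → ℚ
  wα alpha     = 0ℚ
  wα beta      = 1ℚ
  wα undecided = + 1 / 4
  wβ alpha     = 1ℚ
  wβ beta      = 0ℚ
  wβ undecided = + 1 / 4

  wα-≥0 : ∀ σ → 0ℚ ≤ wα σ
  wα-≥0 alpha     = ≤-refl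
  wα-≥0 beta      = lit 1ℚ
  wα-≥0 undecided = lit (+ 1 / 4)

  wβ-≥0 : ∀ σ → 0ℚ ≤ wβ σ
  wβ-≥0 alpha     = lit 1ℚ
  wβ-≥0 beta      = ≤-refl
  wβ-≥0 undecided = lit (+ 1 / 4)

  wα²≤1 : ∀ σ → wα σ * wα σ ≤ 1ℚ
  wα²≤1 alpha     = lit 1ℚ
  wα²≤1 beta      = ≤-refl
  wα²≤1 undecided = toWitness {a? = + 1 / 4 * (+ 1 / 4) ≤? 1ℚ} _

  wβ²≤1 : ∀ σ → wβ σ * wβ σ ≤ 1ℚ
  wβ²≤1 alpha     = ≤-refl
  wβ²≤1 beta      = lit 1ℚ
  wβ²≤1 undecided = toWitness {a? = + 1 / 4 * (+ 1 / 4) ≤? 1ℚ} _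

  module _ {n : ℕ} .{{_ : NonZero n}} where
    -- 262144 is 512²: Chebyshev for a deviation of 1/512 and a variance of at most `ν`.
    δ : ℚ
    δ = + 262144 / 1 * ν {n}

    δ-≥0 : 0ℚ ≤ δ
    δ-≥0 = lit (+ 262144 / 1) ⊗ ν-≥0 {n}

    share : (State → ℚ) → Config n → ℚ
    share w x = 𝔸 (λ u → w (x u))

    -- All deviations of interest are at least 1/512.
    chebyshev : ∀ g x → Bounded {n} g → 𝔼 (λ f → + 512 / 1 * (+ 512 / 1) * ((obs g x f - mean g x) * (obs g x f - mean g x))) ≤ δ
    chebyshev g x bg = ≤-trans (≤-reflexive (E-* pulls (+ 262144 / 1) (λ f → (obs g x f - mean g x) * (obs g x f - mean g x))))
      (*-monoˡ-≤-nonNeg (+ 262144 / 1) (𝔼-dev²-≤ν g x bg))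

    -- Abstract in the weight, so that a win of Alpha and a win of Beta share one argument.
    module FinalPhase (w : State → ℚ) (w≥0 : ∀ σ → 0ℚ ≤ w σ) (bounded : Bounded {n} (next w))
      (contraction : ∀ x → share w x ≤ + 1 / 32 → mean (next w) x ≤ + 3 / 4 * share w x)
      (granularity : ∀ x → ¬ ColorConsensus x → 1ℚ ≤ + 4 / 1 * ι n * share w x) where

      R : Config n → Set
      R x = share w x ≤ + 1 / 32

      -- For `wα` this is 4b + q, an integer, hence at least 1 as long as some node is not Alpha.
      Φ : Config n → ℚ
      Φ x = + 4 / 1 * ι n * share w x

      Φ-≥0 : ∀ x → 0ℚ ≤ Φ x
      Φ-≥0 x = lit (+ 4 / 1) ⊗ ι-≥0 n ⊗ E-≥0 (uniform n) (w≥0 ∘ x)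

      round : ∀ x → R x → Round R ColorConsensus Φ r δ x
      round x Rx = record
        { bad    = λ f → + 512 / 1 * (+ 512 / 1) * ((obs (next w) x f - mean (next w) x) * (obs (next w) x f - mean (next w) x))
        ; pot    = λ f → Φ (step f x)
        ; bad-≥0 = λ f → lit (+ 512 / 1 * (+ 512 / 1)) ⊗ sq (obs (next w) x f - mean (next w) x)
        ; pot-≥0 = λ f → Φ-≥0 (step f x)
        ; 𝔼-bad  = chebyshev (next w) x bounded
        ; 𝔼-pot  = ≤-trans (≤-reflexive (trans (E-* pulls (+ 4 / 1 * ι n) (obs (next w) x)) (cong (+ 4 / 1 * ι n *_) (𝔼-obs (next w) x))))
                     (shrink 3/4≤r (ι-≥0 n) (E-≥0 (uniform n) (w≥0 ∘ x)) (contraction x Rx))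
        ; cases  = cases
        }
        where
        shrink : ∀ {i m s ρ} → + 3 / 4 ≤ ρ → 0ℚ ≤ i → 0ℚ ≤ s → m ≤ + 3 / 4 * s → + 4 / 1 * i * m ≤ ρ * (+ 4 / 1 * i * s)
        shrink {i} {m} {s} {ρ} ≤ρ 0≤i 0≤s m≤ = by-gap (lit (+ 4 / 1) ⊗ 0≤i ⊗ gap m≤ ⊕ lit (+ 4 / 1) ⊗ gap ≤ρ ⊗ 0≤i ⊗ 0≤s)
          (solve (i ∷ m ∷ s ∷ ρ ∷ []) ring)
        -- The mean after the round is at most 3/128, so leaving the region takes a deviation of
        -- 1/128.
        escape : ∀ {s m t} → + 1 / 32 ≤ t → m ≤ + 3 / 4 * s → s ≤ + 1 / 32 → 1ℚ ≤ + 512 / 1 * (t - m)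
        escape {s} {m} {t} ≤t m≤ s≤ = by-gap
          (lit (+ 512 / 1) ⊗ gap ≤t ⊕ lit (+ 512 / 1) ⊗ gap m≤ ⊕ lit (+ 384 / 1) ⊗ gap s≤ ⊕ lit (+ 3 / 1)) (solve (s ∷ m ∷ t ∷ []) ring)
        cases : ∀ f → _
        cases f with ≤-total (share w (step f x)) (+ 1 / 32)
        ... | inj₁ R′  = inj₂ (inj₂ (R′ , ≤-refl))
        ... | inj₂ ≤w′ = inj₁ (far {+ 512 / 1} {obs (next w) x f - mean (next w) x} (escape {share w x} ≤w′ (contraction x Rx) Rx))

      reach : ∀ T x → R x → miss (T ℕ.+ 0) x ≤ 0ℚ + (r ^ T * Φ x + ι T * δ)
      reach = drift colorConsensus? (lit r) δ-≥0 ≤-refl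
        (λ x h → ≤-reflexive (consensus⇒miss≡0 0 x h)) (λ x _ → Φ-≥0 x) (λ x _ → granularity x) (λ x Rx _ → round x Rx)

    share-α : ∀ x → share wα x ≡ β x + + 1 / 4 * κ x
    share-α x = trans (𝔸-M wα x) (lemma (α x) (β x) (κ x))
      where
      lemma : ∀ a b k → a * 0ℚ + b * 1ℚ + k * (+ 1 / 4) ≡ b + + 1 / 4 * k
      lemma = solve-∀ ring

    share-β : ∀ x → share wβ x ≡ α x + + 1 / 4 * κ x
    share-β x = trans (𝔸-M wβ x) (lemma (α x) (β x) (κ x))
      where
      lemma : ∀ a b k → a * 1ℚ + b * 0ℚ + k * (+ 1 / 4) ≡ a + + 1 / 4 * k
      lemma = solve-∀ ring

    α≡ : ∀ x → α x ≡ 1ℚ - β x - κ x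
    α≡ x = trans (lemma (α x) (β x)) (cong (λ k → 1ℚ - β x - k) (sym (κ≡ x)))
      where
      lemma : ∀ a b → a ≡ 1ℚ - b - (1ℚ - a - b)
      lemma = solve-∀ ring

    β≡ : ∀ x → β x ≡ 1ℚ - α x - κ x
    β≡ x = trans (lemma (α x) (β x)) (cong (λ k → 1ℚ - α x - k) (sym (κ≡ x)))
      where
      lemma : ∀ a b → b ≡ 1ℚ - a - (1ℚ - a - b)
      lemma = solve-∀ ring

    -- To first order `b` contributes b/2 and `k` nothing: clashes turn minority and majority nodes
    -- undecided, each with frequency ab and weight 1/4, whereas an undecided node mostly joins the
    -- majority. The bound 1/32 lets the room up to 3/4 absorb the quadratic terms.
    contract : ∀ {a b k} → a ≡ 1ℚ - b - k → 0ℚ ≤ b → 0ℚ ≤ k → b + + 1 / 4 * k ≤ + 1 / 32 →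
      + 1 / 2 * (a * b) + b * b + + 2 / 1 * (b * k) + + 1 / 4 * (k * k) ≤ + 3 / 4 * (b + + 1 / 4 * k)
    contract {a} {b} {k} refl 0≤b 0≤k ≤ = by-gap
      (0≤b ⊗ (lit (+ 8 / 1) ⊗ gap ≤ ⊕ lit (+ 15 / 2) ⊗ 0≤b ⊕ lit (+ 1 / 2) ⊗ 0≤k)
        ⊕ lit (+ 1 / 4) ⊗ 0≤k ⊗ (lit (+ 4 / 1) ⊗ gap ≤ ⊕ lit (+ 4 / 1) ⊗ 0≤b ⊕ lit (+ 5 / 8)))
      (solve (b ∷ k ∷ []) ring)

    mean-α : ∀ x → mean (next wα) x ≡ + 1 / 2 * (α x * β x) + β x * β x + + 2 / 1 * (β x * κ x) + + 1 / 4 * (κ x * κ x)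
    mean-α x = lemma (α x) (β x) (κ x)
      where
      lemma : ∀ a b k → a * (a * 0ℚ + b * (+ 1 / 4) + k * 0ℚ) + b * (a * (+ 1 / 4) + b * 1ℚ + k * 1ℚ) + k * (a * 0ℚ + b * 1ℚ + k * (+ 1 / 4))
        ≡ + 1 / 2 * (a * b) + b * b + + 2 / 1 * (b * k) + + 1 / 4 * (k * k)
      lemma = solve-∀ ring

    mean-β : ∀ x → mean (next wβ) x ≡ + 1 / 2 * (β x * α x) + α x * α x + + 2 / 1 * (α x * κ x) + + 1 / 4 * (κ x * κ x)
    mean-β x = lemma (α x) (β x) (κ x)
      where
      lemma : ∀ a b k → a * (a * 1ℚ + b * (+ 1 / 4) + k * 1ℚ) + b * (a * (+ 1 / 4) + b * 0ℚ + k * 0ℚ) + k * (a * 1ℚ + b * 0ℚ + k * (+ 1 / 4))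
        ≡ + 1 / 2 * (b * a) + a * a + + 2 / 1 * (a * k) + + 1 / 4 * (k * k)
      lemma = solve-∀ ring

    contraction-α : ∀ x → share wα x ≤ + 1 / 32 → mean (next wα) x ≤ + 3 / 4 * share wα x
    contraction-α x ≤ = subst₂ _≤_ (sym (mean-α x)) (cong (+ 3 / 4 *_) (sym (share-α x)))
      (contract (α≡ x) (β-≥0 x) (κ-≥0 x) (subst (_≤ + 1 / 32) (share-α x) ≤))

    contraction-β : ∀ x → share wβ x ≤ + 1 / 32 → mean (next wβ) x ≤ + 3 / 4 * share wβ x
    contraction-β x ≤ = subst₂ _≤_ (sym (mean-β x)) (cong (+ 3 / 4 *_) (sym (share-β x)))
      (contract (β≡ x) (α-≥0 x) (κ-≥0 x) (subst (_≤ + 1 / 32) (share-β x) ≤))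

    bounded-next : ∀ w → (∀ σ → w σ * w σ ≤ 1ℚ) → Bounded {n} (next w)
    bounded-next w w²≤1 σ τ = w²≤1 (update σ τ)

  -- The bias phase

  private
    ≰⇒≥ : ∀ {p q} → ¬ p ≤ q → q ≤ p
    ≰⇒≥ = <⇒≤ ∘ ≰⇒>

  -- Since 2ab ≤ (1 - k)²/2, the mean is at most a convex function of `k`, whose maximum on
  -- [0, 15/16] is 451/512, at k = 15/16; this leaves the 1/512 reserved for the deviation.
  undecided-mean-≤ : ∀ {a b k} → a ≡ 1ℚ - b - k → 0ℚ ≤ k → k ≤ + 15 / 16 →
    k * k + + 2 / 1 * (a * b) ≤ + 15 / 16 - + 1 / 512
  undecided-mean-≤ {b = b} {k} refl 0≤k k≤ = by-gap
    (lit (+ 1 / 2) ⊗ sq (1ℚ - b - k - b) ⊕ lit (+ 3 / 2) ⊗ 0≤k ⊗ gap k≤ ⊕ lit (+ 13 / 32) ⊗ gap k≤ ⊕ lit (+ 28 / 512))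
    (solve (b ∷ k ∷ []) ring)

  -- Many undecided nodes contribute k² by pulling each other. With few of them, neither colour
  -- being close to victory forces `a` and `b` to be at least 1/64, and the clashes 2ab supply new
  -- undecided nodes.
  undecided-mean-≥ : ∀ {a b k} → a ≡ 1ℚ - b - k → 0ℚ ≤ a → 0ℚ ≤ b → 0ℚ ≤ k →
    + 1 / 32 ≤ b + + 1 / 4 * k → + 1 / 32 ≤ a + + 1 / 4 * k → + 1 / 256 ≤ k * k + + 2 / 1 * (a * b)
  undecided-mean-≥ {a} {b} {k} a≡ 0≤a 0≤b 0≤k ≤ψα ≤ψβ with ≤-total k (+ 1 / 16)
  ... | inj₂ k≥ = by-gap (sq (k - + 1 / 16) ⊕ lit (+ 1 / 8) ⊗ gap k≥ ⊕ lit (+ 2 / 1) ⊗ (0≤a ⊗ 0≤b)) (solve (a ∷ b ∷ k ∷ []) ring)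
  ... | inj₁ k≤ = go a≡ a≥ b≥
    where
    quarter : ∀ {b} → + 1 / 32 ≤ b + + 1 / 4 * k → + 1 / 64 ≤ b
    quarter {b} h = by-gap (gap h ⊕ lit (+ 1 / 4) ⊗ gap k≤) (solve (b ∷ k ∷ []) ring)
    a≥ : + 1 / 64 ≤ a
    a≥ = quarter ≤ψβ
    b≥ : + 1 / 64 ≤ b
    b≥ = quarter ≤ψα
    go : ∀ {a} → a ≡ 1ℚ - b - k → + 1 / 64 ≤ a → + 1 / 64 ≤ b → + 1 / 256 ≤ k * k + + 2 / 1 * (a * b)
    go refl a≥ b≥ = by-gap
      (lit (+ 2 / 1) ⊗ (gap a≥ ⊗ gap b≥) ⊕ lit (+ 1 / 32) ⊗ gap k≤ ⊕ sq k ⊕ lit (+ 102 / 4096))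
      (solve (b ∷ k ∷ []) ring)

  module _ {n : ℕ} .{{_ : NonZero n}} where
    Winning : Config n → Set
    Winning x = share wα x ≤ + 1 / 32 ⊎ share wβ x ≤ + 1 / 32

    winning? : ∀ x → Dec (Winning x)
    winning? x = (share wα x ≤? + 1 / 32) ⊎-dec (share wβ x ≤? + 1 / 32)

    Crowded Mixed : Config n → Set
    Crowded x = κ x ≤ + 15 / 16
    Mixed x   = + 1 / 512 ≤ κ x × κ x ≤ + 15 / 16

    mean-und : ∀ x → mean (next und) x ≡ κ x * κ x + + 2 / 1 * (α x * β x)
    mean-und x = lemma (α x) (β x) (κ x)
      where
      lemma : ∀ a b k → a * (a * 0ℚ + b * 1ℚ + k * 0ℚ) + b * (a * 1ℚ + b * 0ℚ + k * 0ℚ) + k * (a * 0ℚ + b * 0ℚ + k * 1ℚ)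
        ≡ k * k + + 2 / 1 * (a * b)
      lemma = solve-∀ ring

    bounded-und : Bounded {n} (next und)
    bounded-und = bounded-next und λ where
      alpha     → lit 1ℚ
      beta      → lit 1ℚ
      undecided → ≤-refl

    undecided-dev : Config n → (Fin n → Fin n) → ℚ
    undecided-dev x f = obs (next und) x f - mean (next und) x

    -- The mean lies inside the interval of `Mixed` with a margin of 1/512 on either side. Assuming
    -- `Crowded` alone lets the same statement establish `Mixed` in the mixing round and preserve it
    -- during the bias phase.
    stays-mixed : ∀ x → Crowded x → ¬ Winning x → ∀ f →
      1ℚ ≤ + 512 / 1 * (+ 512 / 1) * (undecided-dev x f * undecided-dev x f) ⊎ Mixed (step f x)
    stays-mixed x κ≤ ¬win f = decide (≤-total κ′ (+ 1 / 512)) (≤-total κ′ (+ 15 / 16))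
      where
      κ′ k̄ d : ℚ
      κ′ = κ (step f x)
      k̄  = mean (next und) x
      d  = undecided-dev x f
      k̄≤ : k̄ ≤ + 15 / 16 - + 1 / 512
      k̄≤ = subst (_≤ + 15 / 16 - + 1 / 512) (sym (mean-und x)) (undecided-mean-≤ (α≡ x) (κ-≥0 x) κ≤)
      ≤k̄ : + 1 / 256 ≤ k̄
      ≤k̄ = subst (+ 1 / 256 ≤_) (sym (mean-und x)) (undecided-mean-≥ (α≡ x) (α-≥0 x) (β-≥0 x) (κ-≥0 x)
        (≰⇒≥ (¬win ∘ inj₁ ∘ subst (_≤ + 1 / 32) (sym (share-α x)))) (≰⇒≥ (¬win ∘ inj₂ ∘ subst (_≤ + 1 / 32) (sym (share-β x)))))
      low : ∀ {t m} → t ≤ + 1 / 512 → + 1 / 256 ≤ m → 1ℚ ≤ + 512 / 1 * (m - t)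
      low {t} {m} t≤ ≤m = by-gap (lit (+ 512 / 1) ⊗ gap t≤ ⊕ lit (+ 512 / 1) ⊗ gap ≤m) (solve (t ∷ m ∷ []) ring)
      high : ∀ {t m} → + 15 / 16 ≤ t → m ≤ + 15 / 16 - + 1 / 512 → 1ℚ ≤ + 512 / 1 * (t - m)
      high {t} {m} ≤t m≤ = by-gap (lit (+ 512 / 1) ⊗ gap ≤t ⊕ lit (+ 512 / 1) ⊗ gap m≤) (solve (t ∷ m ∷ []) ring)
      flip : ∀ c t m → c * c * ((m - t) * (m - t)) ≡ c * c * ((t - m) * (t - m))
      flip = solve-∀ ring
      decide : κ′ ≤ + 1 / 512 ⊎ + 1 / 512 ≤ κ′ → κ′ ≤ + 15 / 16 ⊎ + 15 / 16 ≤ κ′ →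
               1ℚ ≤ + 512 / 1 * (+ 512 / 1) * (d * d) ⊎ Mixed (step f x)
      decide (inj₂ ≥κ′) (inj₁ κ′≤) = inj₂ (≥κ′ , κ′≤)
      decide (inj₁ κ′≤) _          = inj₁ (subst (1ℚ ≤_) (flip (+ 512 / 1) κ′ k̄) (far {+ 512 / 1} {k̄ - κ′} (low κ′≤ ≤k̄)))
      decide (inj₂ _)   (inj₂ ≥κ′) = inj₁ (far {+ 512 / 1} {d} (high ≥κ′ k̄≤))

    mix-round : ∀ x → Crowded x → ¬ (Mixed x ⊎ Winning x) → Round Crowded (λ y → Mixed y ⊎ Winning y) (λ _ → 1ℚ) r δ x
    mix-round x κ≤ ¬G = record
      { bad    = λ f → + 512 / 1 * (+ 512 / 1) * (undecided-dev x f * undecided-dev x f)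
      -- A round is either bad or reaches the goal; the potential is never compared in `cases`, and
      -- zero contracts at any rate.
      ; pot    = λ _ → 0ℚ
      ; bad-≥0 = λ f → lit (+ 512 / 1 * (+ 512 / 1)) ⊗ sq (undecided-dev x f)
      ; pot-≥0 = λ _ → ≤-refl
      ; 𝔼-bad  = chebyshev (next und) x bounded-und
      ; 𝔼-pot  = ≤-trans (≤-reflexive (E-const pulls 0ℚ)) (lit r ⊗ lit 1ℚ)
      ; cases  = λ f → Sum.map₂ (inj₁ ∘ inj₁) (stays-mixed x κ≤ (¬G ∘ inj₂) f)
      }

    ς : Config n → ℚ
    ς x = α x - β x

    share-sgn : ∀ x → share sgn x ≡ ς x
    share-sgn x = trans (𝔸-M sgn x) (lemma (α x) (β x) (κ x))
      where
      lemma : ∀ a b k → a * 1ℚ + b * (- 1ℚ) + k * 0ℚ ≡ a - b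
      lemma = solve-∀ ring

    μ : Config n → ℚ
    μ x = mean (next sgn) x

    μ≡ : ∀ x → μ x ≡ ς x * (1ℚ + κ x)
    μ≡ x = lemma (α≡ x)
      where
      lemma : ∀ {a b k} → a ≡ 1ℚ - b - k →
        a * (a * 1ℚ + b * 0ℚ + k * 1ℚ) + b * (a * 0ℚ + b * (- 1ℚ) + k * (- 1ℚ)) + k * (a * 1ℚ + b * (- 1ℚ) + k * 0ℚ)
          ≡ (a - b) * (1ℚ + k)
      lemma {b = b} {k} refl = solve (b ∷ k ∷ []) ring

    bounded-sgn : Bounded {n} (next sgn)
    bounded-sgn = bounded-next sgn λ where
      alpha     → ≤-refl
      beta      → ≤-refl
      undecided → lit 1ℚ

    W : Config n → (Fin n → Fin n) → ℚ
    W x f = obs (next sgn) x f - μ x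

    V : Config n → ℚ
    V x = 𝔼 (λ f → W x f * W x f)

    V-≤ : ∀ x → V x ≤ ν {n}
    V-≤ x = 𝔼-dev²-≤ν (next sgn) x bounded-sgn

    -- Only the undecided nodes are needed to make the bias fluctuate.
    V-≥ : ∀ x → Mixed x → ν {n} * η ≤ V x
    V-≥ x (≤κ , κ≤) = ≤-trans (*-monoˡ-≤-nonNeg (ν {n}) {{ℚ.nonNegative (ν-≥0 {n})}} (≤-trans
        (undecided-variance (α≡ x) (α-≥0 x) (β-≥0 x) ≤κ κ≤)
        (last-≤ (α-≥0 x) (β-≥0 x) (variance-≥0 alpha) (variance-≥0 beta))))
      (≤-reflexive (sym (𝔼-dev² (next sgn) x)))
      where
      dev² : State → State → ℚ
      dev² σ τ = (next sgn σ τ - M x (next sgn σ)) * (next sgn σ τ - M x (next sgn σ))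
      variance-≥0 : ∀ σ → 0ℚ ≤ M x (dev² σ)
      variance-≥0 σ = ≤-trans (E-≥0 (uniform n) λ u → sq (next sgn σ (x u) - M x (next sgn σ))) (≤-reflexive (𝔸-M (dev² σ) x))
      last-≤ : ∀ {a b p q s} → 0ℚ ≤ a → 0ℚ ≤ b → 0ℚ ≤ p → 0ℚ ≤ q → s ≤ a * p + b * q + s
      last-≤ {a} {b} {p} {q} {s} 0≤a 0≤b 0≤p 0≤q = by-gap (0≤a ⊗ 0≤p ⊕ 0≤b ⊗ 0≤q) (solve (a ∷ b ∷ p ∷ q ∷ s ∷ []) ring)
      -- The sign pulled by one node has variance γ - ς² = κγ + 4αβ, because γ = 1 - κ and γ² - ς² =
      -- 4αβ. So κ times it is at least κ²γ.
      undecided-variance : ∀ {a b k} → a ≡ 1ℚ - b - k → 0ℚ ≤ a → 0ℚ ≤ b → + 1 / 512 ≤ k → k ≤ + 15 / 16 →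
        + 1 / 4194304 ≤ k * (let s = a * 1ℚ + b * (- 1ℚ) + k * 0ℚ in
          a * ((1ℚ - s) * (1ℚ - s)) + b * ((- 1ℚ - s) * (- 1ℚ - s)) + k * ((0ℚ - s) * (0ℚ - s)))
      undecided-variance {b = b} {k} refl 0≤a 0≤b ≤k k≤ = by-gap
        (lit (+ 4 / 1) ⊗ 0≤k ⊗ (0≤a ⊗ 0≤b) ⊕ sq k ⊗ gap k≤ ⊕ lit (+ 1 / 16) ⊗ (0≤k ⊕ lit (+ 1 / 512)) ⊗ gap ≤k)
        (solve (b ∷ k ∷ []) ring)
        where
        0≤k : 0ℚ ≤ k
        0≤k = ≤-trans (lit (+ 1 / 512)) ≤k

    -- The offset is of the order of the variance of one round of `ς`, times a large constant. It
    -- keeps the reciprocal of order n at a tie and makes the fluctuations of ς² near a tie small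
    -- against `z`.
    z : Config n → ℚ
    z x = A * ν {n} + ς x * ς x

    0<ν : 0ℚ < ν {n}
    0<ν = ≤∧≢⇒< (ν-≥0 {n}) λ 0≡ν → contradiction (trans (sym (*-zeroʳ (ι n))) (trans (cong (ι n *_) 0≡ν) (inv-cancelʳ (ι-pos n)))) λ ()
      where
      ≤∧≢⇒< : ∀ {p q} → p ≤ q → p ≢ q → p < q
      ≤∧≢⇒< {p} {q} p≤q p≢q with p <? q
      ... | yes p<q = p<q
      ... | no p≮q  = contradiction (≤-antisym p≤q (≮⇒≥ p≮q)) p≢q

    0<A : 0ℚ < A
    0<A = toWitness {a? = 0ℚ <? A} _

    0<Aν : 0ℚ < A * ν {n}
    0<Aν = pos⊗ 0<A 0<ν

    ≤z : ∀ x → A * ν {n} ≤ z x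
    ≤z x = by-gap (sq (ς x)) refl

    m : Config n → ℚ
    m x = A * ν {n} + μ x * μ x + V x

    𝔼-W : ∀ x → 𝔼 (W x) ≡ 0ℚ
    𝔼-W x = 𝔼-dev (next sgn) x

    ς-step : ∀ x f → ς (step f x) ≡ W x f + μ x
    ς-step x f = trans (sym (share-sgn (step f x))) (lemma (share sgn (step f x)) (μ x))
      where
      lemma : ∀ s m → s ≡ (s - m) + m
      lemma = solve-∀ ring

    z-step : ∀ x f → z (step f x) ≡ A * ν {n} + (W x f + μ x) * (W x f + μ x)
    z-step x f = cong (λ s → A * ν {n} + s * s) (ς-step x f)

    𝔼-z : ∀ x → 𝔼 (λ f → z (step f x)) ≡ m x
    𝔼-z x = begin
      𝔼 (λ f → z (step f x))
        ≡⟨ E-cong pulls (λ f → trans (z-step x f) (expand B (W x f) (μ x))) ⟩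
      𝔼 (λ f → + 2 / 1 * μ x * W x f + (1ℚ * (W x f * W x f) + (B + μ x * μ x)))
        ≡⟨ E-linear pulls (+ 2 / 1 * μ x) (W x) (λ f → 1ℚ * (W x f * W x f) + (B + μ x * μ x)) ⟩
      + 2 / 1 * μ x * 𝔼 (W x) + 𝔼 (λ f → 1ℚ * (W x f * W x f) + (B + μ x * μ x))
        ≡⟨ cong₂ (λ w v → + 2 / 1 * μ x * w + v) (𝔼-W x) (E-linear pulls 1ℚ (λ f → W x f * W x f) (λ _ → B + μ x * μ x)) ⟩
      + 2 / 1 * μ x * 0ℚ + (1ℚ * V x + 𝔼 (λ _ → B + μ x * μ x))
        ≡⟨ cong (λ v → + 2 / 1 * μ x * 0ℚ + (1ℚ * V x + v)) (E-const pulls (B + μ x * μ x)) ⟩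
      + 2 / 1 * μ x * 0ℚ + (1ℚ * V x + (B + μ x * μ x))
        ≡⟨ collapse B (μ x) (V x) ⟩
      m x ∎
      where
      open ≡-Reasoning
      B = A * ν {n}
      expand : ∀ b w m → b + (w + m) * (w + m) ≡ + 2 / 1 * m * w + (1ℚ * (w * w) + (b + m * m))
      expand = solve-∀ ring
      collapse : ∀ b m v → + 2 / 1 * m * 0ℚ + (1ℚ * v + (b + m * m)) ≡ b + m * m + v
      collapse = solve-∀ ring

    -- The deviation of the next `z` is 2μW + (W² - V). By (p + q)² ≤ 2p² + 2q² the linear part
    -- costs 8μ²V, and the quadratic part costs twice the fourth moment of W.
    𝔼-z-variance : ∀ x → 𝔼 (λ f → (z (step f x) - m x) * (z (step f x) - m x)) ≤
      + 8 / 1 * (μ x * μ x) * V x + + 8 / 1 * (ν {n} * ν {n})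
    𝔼-z-variance x = begin
      𝔼 (λ f → (z (step f x) - m x) * (z (step f x) - m x))
        ≡⟨ E-cong pulls (λ f → cong (λ y → (y - m x) * (y - m x)) (z-step x f)) ⟩
      𝔼 (λ f → (B + (W x f + μ x) * (W x f + μ x) - m x) * (B + (W x f + μ x) * (W x f + μ x) - m x))
        ≤⟨ E-mono pulls (λ f → split B (W x f) (μ x) (V x)) ⟩
      𝔼 (λ f → + 8 / 1 * (μ x * μ x) * (W x f * W x f) + + 2 / 1 * ((W x f * W x f - V x) * (W x f * W x f - V x)))
        ≡⟨ E-linear pulls (+ 8 / 1 * (μ x * μ x)) (λ f → W x f * W x f) (λ f → + 2 / 1 * ((W x f * W x f - V x) * (W x f * W x f - V x))) ⟩
      + 8 / 1 * (μ x * μ x) * V x + 𝔼 (λ f → + 2 / 1 * ((W x f * W x f - V x) * (W x f * W x f - V x)))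
        ≡⟨ cong (λ v → + 8 / 1 * (μ x * μ x) * V x + v) (E-* pulls (+ 2 / 1) (λ f → (W x f * W x f - V x) * (W x f * W x f - V x))) ⟩
      + 8 / 1 * (μ x * μ x) * V x + + 2 / 1 * 𝔼 (λ f → (W x f * W x f - V x) * (W x f * W x f - V x))
        ≤⟨ +-monoʳ-≤ (+ 8 / 1 * (μ x * μ x) * V x) (double {q = ν {n} * ν {n}} (≤-trans (variance-≤ pulls (λ f → W x f * W x f)) (𝔼-dev⁴-≤ (next sgn) x bounded-sgn))) ⟩
      + 8 / 1 * (μ x * μ x) * V x + + 8 / 1 * (ν {n} * ν {n}) ∎
      where
      open ≤-Reasoning
      B = A * ν {n}
      split : ∀ b w m v → (b + (w + m) * (w + m) - (b + m * m + v)) * (b + (w + m) * (w + m) - (b + m * m + v)) ≤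
        + 8 / 1 * (m * m) * (w * w) + + 2 / 1 * ((w * w - v) * (w * w - v))
      split b w m v = by-gap (sq (+ 2 / 1 * m * w - (w * w - v))) (solve (b ∷ w ∷ m ∷ v ∷ []) ring)
      double : ∀ {p q} → p ≤ + 4 / 1 * q → + 2 / 1 * p ≤ + 8 / 1 * q
      double {p} {q} h = by-gap (lit (+ 2 / 1) ⊗ gap h) (solve (p ∷ q ∷ []) ring)

    -- With t = ς² + ν, the mean m of the next z exceeds z by g ≥ ηt, and the error term of
    -- inverse-moment costs at most 8(μ² + ν)/A ≤ ηt/2 because A = 64/η.
    inverse-bias-drift : ∀ {m g t v ν p} → 0ℚ ≤ ν → 0ℚ ≤ m → 0ℚ ≤ m - g → 0ℚ ≤ p →
      + 1 / 4194304 * t ≤ g → + 8 / 1 * (p + ν) ≤ + 32 / 1 * t → m ≤ + 536870912 / 1 * t → v ≤ ν →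
      (m - g) * (+ 268435456 / 1 * ν * m + (+ 8 / 1 * p * v + + 8 / 1 * (ν * ν)))
        ≤ + 4503599627370495 / 4503599627370496 * (m * m * (+ 268435456 / 1 * ν))
    inverse-bias-drift {m} {g} {t} {v} {ν} {p} 0≤ν 0≤m 0≤z 0≤p ≤g p≤ m≤ v≤ν = by-gap
      (0≤ν ⊗ (0≤z ⊗ (lit (+ 134217728 / 1) ⊗ gap ≤g ⊕ gap p≤)
          ⊕ lit (+ 134217728 / 1) ⊗ 0≤m ⊗ gap ≤g
          ⊕ lit (+ 134217728 / 1) ⊗ sq g
          ⊕ lit (+ 1 / 16777216) ⊗ 0≤m ⊗ gap m≤)
        ⊕ 0≤z ⊗ lit (+ 8 / 1) ⊗ 0≤p ⊗ gap v≤ν)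
      (solve (m ∷ g ∷ t ∷ v ∷ ν ∷ p ∷ []) ring)

    -- The two sources of gain side by side: (1 + κ)² - 1 ≥ 2κ ≥ 1/256 acts on ς², and the variance
    -- provides the term in ν when ς is negligible.
    bias-growth : ∀ {s k v ν} → 0ℚ ≤ ν → + 1 / 512 ≤ k → ν * (+ 1 / 4194304) ≤ v →
      + 1 / 4194304 * (s * s + ν) ≤ ((s * (1ℚ + k)) * (s * (1ℚ + k)) + v) - s * s
    bias-growth {s} {k} {v} {ν} 0≤ν ≤k ≤v = by-gap
      (sq (s * k) ⊕ lit (+ 2 / 1) ⊗ sq s ⊗ gap ≤k ⊕ lit (+ 16383 / 4194304) ⊗ sq s ⊕ gap ≤v)
      (solve (s ∷ k ∷ v ∷ ν ∷ []) ring)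

    drift-≤ : ∀ {s k ν} → 0ℚ ≤ ν → 0ℚ ≤ k → k ≤ 1ℚ →
      + 8 / 1 * ((s * (1ℚ + k)) * (s * (1ℚ + k)) + ν) ≤ + 32 / 1 * (s * s + ν)
    drift-≤ {s} {k} {ν} 0≤ν 0≤k k≤1 = by-gap
      (lit (+ 8 / 1) ⊗ sq s ⊗ gap k≤1 ⊗ (lit (+ 3 / 1) ⊕ 0≤k) ⊕ lit (+ 24 / 1) ⊗ 0≤ν)
      (solve (s ∷ k ∷ ν ∷ []) ring)

    next-≤ : ∀ {s k ν v} → 0ℚ ≤ ν → 0ℚ ≤ k → k ≤ 1ℚ → v ≤ ν →
      + 268435456 / 1 * ν + (s * (1ℚ + k)) * (s * (1ℚ + k)) + v ≤ + 536870912 / 1 * (s * s + ν)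
    next-≤ {s} {k} {ν} {v} 0≤ν 0≤k k≤1 v≤ν = by-gap
      (sq s ⊗ gap k≤1 ⊗ (lit (+ 3 / 1) ⊕ 0≤k) ⊕ lit (+ 536870908 / 1) ⊗ sq s ⊕ gap v≤ν ⊕ lit (+ 268435455 / 1) ⊗ 0≤ν)
      (solve (s ∷ k ∷ ν ∷ v ∷ []) ring)

    𝔼-inv-z : ∀ x → Mixed x → 𝔼 (λ f → inv (z (step f x))) ≤ r * inv (z x)
    𝔼-inv-z x mixed@(≤κ , κ≤) = inverse-moment pulls {r = r} 0<Aν (λ f → ≤z (step f x)) (𝔼-z x) (𝔼-z-variance x)
      (<-≤-trans 0<Aν (≤z x))
      (subst (λ y → y * (A * ν {n} * m x + (+ 8 / 1 * (μ x * μ x) * V x + + 8 / 1 * (ν {n} * ν {n}))) ≤ r * (m x * m x * (A * ν {n})))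
        m-g≡z
        (inverse-bias-drift {m x} {g} {ς x * ς x + ν {n}} (ν-≥0 {n}) 0≤m (subst (0ℚ ≤_) (sym m-g≡z) 0≤z) (sq (μ x)) growth
          (subst (λ p → + 8 / 1 * (p * p + ν {n}) ≤ + 32 / 1 * (ς x * ς x + ν {n})) (sym (μ≡ x)) (drift-≤ {ς x} (ν-≥0 {n}) (κ-≥0 x) κ≤1))
          (subst (λ p → A * ν {n} + p * p + V x ≤ + 536870912 / 1 * (ς x * ς x + ν {n})) (sym (μ≡ x)) (next-≤ {ς x} (ν-≥0 {n}) (κ-≥0 x) κ≤1 (V-≤ x)))
          (V-≤ x)))
      where
      g : ℚ
      g = (μ x * μ x + V x) - ς x * ς x
      κ≤1 : κ x ≤ 1ℚ
      κ≤1 = ≤-trans κ≤ (toWitness {a? = + 15 / 16 ≤? 1ℚ} _)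
      0≤z : 0ℚ ≤ z x
      0≤z = <⇒≤ (<-≤-trans 0<Aν (≤z x))
      0≤m : 0ℚ ≤ m x
      0≤m = <⇒≤ 0<Aν ⊕ sq (μ x) ⊕ E-≥0 pulls (λ f → sq (W x f))
      m-g≡z : m x - g ≡ z x
      m-g≡z = lemma (A * ν {n}) (μ x) (V x) (ς x)
        where
        lemma : ∀ b u v s → (b + u * u + v) - ((u * u + v) - s * s) ≡ b + s * s
        lemma = solve-∀ ring
      growth : + 1 / 4194304 * (ς x * ς x + ν {n}) ≤ g
      growth = subst (λ p → + 1 / 4194304 * (ς x * ς x + ν {n}) ≤ (p * p + V x) - ς x * ς x) (sym (μ≡ x))
        (bias-growth {ς x} (ν-≥0 {n}) ≤κ (V-≥ x mixed))

    -- `A` + 1, an upper bound for `z`, since ν and ς² are at most 1; it scales the potential of the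
    -- bias phase to at least 1.
    C : ℚ
    C = + 268435457 / 1

    bias-round : ∀ x → Mixed x → ¬ Winning x → Round Mixed Winning (λ y → C * inv (z y)) r δ x
    bias-round x mixed@(≤κ , κ≤) ¬win = record
      { bad    = λ f → + 512 / 1 * (+ 512 / 1) * (undecided-dev x f * undecided-dev x f)
      ; pot    = λ f → C * inv (z (step f x))
      ; bad-≥0 = λ f → lit (+ 512 / 1 * (+ 512 / 1)) ⊗ sq (undecided-dev x f)
      ; pot-≥0 = λ f → lit C ⊗ inv-≥0 (<-≤-trans 0<Aν (≤z (step f x)))
      ; 𝔼-bad  = chebyshev (next und) x bounded-und
      ; 𝔼-pot  = ≤-trans (≤-reflexive (E-* pulls C (λ f → inv (z (step f x))))) (≤-trans
          (*-monoˡ-≤-nonNeg C (𝔼-inv-z x mixed)) (≤-reflexive (swap C r (inv (z x)))))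
      ; cases  = λ f → Sum.map₂ (λ mixed′ → inj₂ (mixed′ , ≤-refl)) (stays-mixed x κ≤ ¬win f)
      }
      where
      swap : ∀ c r i → c * (r * i) ≡ r * (c * i)
      swap = solve-∀ ring

    ν≤1 : ν {n} ≤ 1ℚ
    ν≤1 = cancelˡ-≤ (ι-pos n) (subst₂ _≤_ (sym (inv-cancelʳ (ι-pos n))) (sym (*-identityʳ (ι n))) (ι-≥1 n))

    bias-potential-≥1 : ∀ x → 1ℚ ≤ C * inv (z x)
    bias-potential-≥1 x = subst (_≤ C * inv (z x)) (inv-cancelʳ 0<z)
      (*-monoʳ-≤-nonNeg (inv (z x)) {{ℚ.nonNegative (inv-≥0 0<z)}} (bound (≡1 (α≡ x)) (α-≥0 x) (β-≥0 x) (κ-≥0 x) ν≤1))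
      where
      0<z : 0ℚ < z x
      0<z = <-≤-trans 0<Aν (≤z x)
      ≡1 : ∀ {a b k} → a ≡ 1ℚ - b - k → k ≡ 1ℚ - a - b
      ≡1 {b = b} {k} refl = solve (b ∷ k ∷ []) ring
      bound : ∀ {a b k ν} → k ≡ 1ℚ - a - b → 0ℚ ≤ a → 0ℚ ≤ b → 0ℚ ≤ k → ν ≤ 1ℚ →
        + 268435456 / 1 * ν + (a - b) * (a - b) ≤ + 268435457 / 1
      bound {a} {b} {ν = ν} refl 0≤a 0≤b 0≤k ν≤1 = by-gap
        (lit (+ 268435456 / 1) ⊗ gap ν≤1 ⊕ 0≤k ⊗ (lit (+ 1 / 1) ⊕ 0≤a ⊕ 0≤b) ⊕ lit (+ 4 / 1) ⊗ (0≤a ⊗ 0≤b))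
        (solve (a ∷ b ∷ ν ∷ []) ring)

  -- The growth phase

  dies born : State → State → ℚ
  dies alpha beta      = 1ℚ
  dies beta  alpha     = 1ℚ
  dies _     _         = 0ℚ
  born undecided alpha = 1ℚ
  born undecided beta  = 1ℚ
  born _         _     = 0ℚ

  -- The premise of `inverse-moment` for the lower bound 15γ/16, mean (15/16 + κ)γ and variance νκγ.
  -- Even if a single node is coloured, so that the standard deviation is comparable to the mean, ν
  -- ≤ γ limits the variance to κγ², which the near doubling of the mean outweighs.
  growth-bound : ∀ {γ k ν} → 0ℚ ≤ γ → ν ≤ γ → + 15 / 16 ≤ k → k ≤ 1ℚ →
    γ * (+ 15 / 16 * γ * (+ 15 / 16 * γ + k * γ) + ν * (k * γ))
      ≤ + 9 / 10 * ((+ 15 / 16 * γ + k * γ) * (+ 15 / 16 * γ + k * γ) * (+ 15 / 16 * γ))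
  growth-bound {γ} {k} {ν} 0≤γ ν≤γ ≤k k≤1 = by-gap
    (0≤γ ⊗ 0≤γ ⊗ 0≤γ ⊗ (lit (+ 427 / 2048) ⊕ lit (+ 285 / 128) ⊗ gap ≤k ⊕ lit (+ 27 / 32) ⊗ sq (k - + 15 / 16))
      ⊕ 0≤γ ⊗ 0≤γ ⊗ (0≤γ ⊗ gap k≤1 ⊕ 0≤k ⊗ gap ν≤γ))
    (solve (γ ∷ k ∷ ν ∷ []) ring)
    where
    0≤k : 0ℚ ≤ k
    0≤k = ≤-trans (lit (+ 15 / 16)) ≤k

  module _ {n : ℕ} .{{_ : NonZero n}} where
    γ : Config n → ℚ
    γ x = α x + β x

    Alive : Config n → Set
    Alive x = 0ℚ < γ x

    γ≡ : ∀ x → κ x ≡ 1ℚ - γ x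
    γ≡ x = trans (κ≡ x) (lemma (α x) (β x))
      where
      lemma : ∀ a b → 1ℚ - a - b ≡ 1ℚ - (a + b)
      lemma = solve-∀ ring

    share-col : ∀ x → share col x ≡ γ x
    share-col x = trans (𝔸-M col x) (lemma (α x) (β x) (κ x))
      where
      lemma : ∀ a b k → a * 1ℚ + b * 1ℚ + k * 0ℚ ≡ a + b
      lemma = solve-∀ ring

    -- Gains and losses need different treatment. The gain fluctuates with variance of order νγ, too
    -- much for Chebyshev at scale γ when γ is small, but it is nonnegative and so fits
    -- `inverse-moment`. The loss is rare enough for Chebyshev.
    γ-step : ∀ x f → γ (step f x) ≡ γ x - obs dies x f + obs born x f
    γ-step x f = begin
      γ (step f x)
        ≡⟨ share-col (step f x) ⟨
      share col (step f x)
        ≡⟨ E-cong (uniform n) (λ u → balance (x u) (x (f u))) ⟩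
      𝔸 (λ u → - 1ℚ * dies (x u) (x (f u)) + (born (x u) (x (f u)) + col (x u)))
        ≡⟨ E-linear (uniform n) (- 1ℚ) (λ u → dies (x u) (x (f u))) (λ u → born (x u) (x (f u)) + col (x u)) ⟩
      - 1ℚ * obs dies x f + 𝔸 (λ u → born (x u) (x (f u)) + col (x u))
        ≡⟨ cong (λ v → - 1ℚ * obs dies x f + v) (E-+ (uniform n) (λ u → born (x u) (x (f u))) (λ u → col (x u))) ⟩
      - 1ℚ * obs dies x f + (obs born x f + share col x)
        ≡⟨ cong (λ v → - 1ℚ * obs dies x f + (obs born x f + v)) (share-col x) ⟩
      - 1ℚ * obs dies x f + (obs born x f + γ x)
        ≡⟨ lemma (obs dies x f) (obs born x f) (γ x) ⟩
      γ x - obs dies x f + obs born x f ∎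
      where
      open ≡-Reasoning
      lemma : ∀ d b g → - 1ℚ * d + (b + g) ≡ g - d + b
      lemma = solve-∀ ring
      balance : ∀ σ τ → col (update σ τ) ≡ - 1ℚ * dies σ τ + (born σ τ + col σ)
      balance alpha     alpha     = refl
      balance alpha     beta      = refl
      balance alpha     undecided = refl
      balance beta      alpha     = refl
      balance beta      beta      = refl
      balance beta      undecided = refl
      balance undecided alpha     = refl
      balance undecided beta      = refl
      balance undecided undecided = refl

    mean-dies : ∀ x → mean dies x ≡ + 2 / 1 * (α x * β x)
    mean-dies x = lemma (α x) (β x) (κ x)
      where
      lemma : ∀ a b k → a * (a * 0ℚ + b * 1ℚ + k * 0ℚ) + b * (a * 1ℚ + b * 0ℚ + k * 0ℚ) + k * (a * 0ℚ + b * 0ℚ + k * 0ℚ) ≡ + 2 / 1 * (a * b)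
      lemma = solve-∀ ring

    mean-born : ∀ x → mean born x ≡ κ x * γ x
    mean-born x = lemma (α x) (β x) (κ x)
      where
      lemma : ∀ a b k → a * (a * 0ℚ + b * 0ℚ + k * 0ℚ) + b * (a * 0ℚ + b * 0ℚ + k * 0ℚ) + k * (a * 1ℚ + b * 1ℚ + k * 0ℚ) ≡ k * (a + b)
      lemma = solve-∀ ring

    dies-variance : ∀ x → 𝔼 (λ f → (obs dies x f - mean dies x) * (obs dies x f - mean dies x)) ≤ ν {n} * (+ 2 / 1 * (α x * β x))
    dies-variance x = ≤-trans (𝔼-dev²-≤ dies x) (≤-reflexive (cong (ν {n} *_) (mean-dies x)))

    born-variance : ∀ x → 𝔼 (λ f → (obs born x f - mean born x) * (obs born x f - mean born x)) ≤ ν {n} * (κ x * γ x)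
    born-variance x = ≤-trans (𝔼-dev²-≤ born x) (≤-reflexive (cong (ν {n} *_) (mean-born x)))

    obs-≥0 : ∀ {g} → (∀ σ τ → 0ℚ ≤ g σ τ) → ∀ x f → 0ℚ ≤ obs g x f
    obs-≥0 g≥0 x f = E-≥0 (uniform n) λ u → g≥0 (x u) (x (f u))

    born-≥0 : ∀ σ τ → 0ℚ ≤ born σ τ
    born-≥0 alpha     _         = ≤-refl
    born-≥0 beta      _         = ≤-refl
    born-≥0 undecided alpha     = lit 1ℚ
    born-≥0 undecided beta      = lit 1ℚ
    born-≥0 undecided undecided = ≤-refl

    module _ (granularity : ∀ x → Alive x → ν {n} ≤ γ x) (x : Config n) (alive : Alive x) (¬crowded : ¬ Crowded x) where

      private
        i : ℚ
        i = inv (γ x)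
        γi≡1 : γ x * i ≡ 1ℚ
        γi≡1 = inv-cancelʳ alive
        0≤i : 0ℚ ≤ i
        0≤i = inv-≥0 alive
        0≤γ : 0ℚ ≤ γ x
        0≤γ = <⇒≤ alive
        ≤κ : + 15 / 16 ≤ κ x
        ≤κ = <⇒≤ (≰⇒> ¬crowded)
        γ≤ : γ x ≤ + 1 / 16
        γ≤ = lemma (γ≡ x) ≤κ
          where
          lemma : ∀ {g k} → k ≡ 1ℚ - g → + 15 / 16 ≤ k → g ≤ + 1 / 16
          lemma {g} refl h = by-gap (gap h) (solve (g ∷ []) ring)
        κ≤1 : κ x ≤ 1ℚ
        κ≤1 = lemma (γ≡ x) 0≤γ
          where
          lemma : ∀ {g k} → k ≡ 1ℚ - g → 0ℚ ≤ g → k ≤ 1ℚ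
          lemma {g} refl h = by-gap h (solve (g ∷ []) ring)

      loss : (Fin n → Fin n) → ℚ
      loss f = obs dies x f - mean dies x

      -- A lower bound for the next γ unless more than γ/16 dies.
      survivors : (Fin n → Fin n) → ℚ
      survivors f = + 15 / 16 * γ x + obs born x f

      0<15/16γ : 0ℚ < + 15 / 16 * γ x
      0<15/16γ = pos⊗ (positive⁻¹ (+ 15 / 16)) alive

      ≤survivors : ∀ f → + 15 / 16 * γ x ≤ survivors f
      ≤survivors f = by-gap (obs-≥0 born-≥0 x f) refl

      -- The variance of the loss is at most 2ναβ ≤ νγ²/2, so a deviation of γ/32 has probability at
      -- most 512ν, whatever γ is.
      𝔼-loss : 𝔼 (λ f → + 32 / 1 * i * (+ 32 / 1 * i) * (loss f * loss f)) ≤ δ {n}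
      𝔼-loss = begin
        𝔼 (λ f → + 32 / 1 * i * (+ 32 / 1 * i) * (loss f * loss f))
          ≡⟨ E-* pulls (+ 32 / 1 * i * (+ 32 / 1 * i)) (λ f → loss f * loss f) ⟩
        + 32 / 1 * i * (+ 32 / 1 * i) * 𝔼 (λ f → loss f * loss f)
          ≤⟨ *-monoˡ-≤-nonNeg (+ 32 / 1 * i * (+ 32 / 1 * i)) {{ℚ.nonNegative (sq (+ 32 / 1 * i))}} (dies-variance x) ⟩
        + 32 / 1 * i * (+ 32 / 1 * i) * (ν {n} * (+ 2 / 1 * (α x * β x)))
          ≤⟨ am-gm i (α x) (β x) (ν-≥0 {n}) ⟩
        + 512 / 1 * ν {n} * ((γ x * i) * (γ x * i))
          ≡⟨ cong (λ e → + 512 / 1 * ν {n} * (e * e)) γi≡1 ⟩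
        + 512 / 1 * ν {n} * (1ℚ * 1ℚ)
          ≤⟨ enlarge (ν-≥0 {n}) ⟩
        δ {n} ∎
        where
        open ≤-Reasoning
        am-gm : ∀ i a b {ν} → 0ℚ ≤ ν → + 32 / 1 * i * (+ 32 / 1 * i) * (ν * (+ 2 / 1 * (a * b))) ≤ + 512 / 1 * ν * (((a + b) * i) * ((a + b) * i))
        am-gm i a b {ν} 0≤ν = by-gap (lit (+ 512 / 1) ⊗ 0≤ν ⊗ (sq i ⊗ sq (a - b))) (solve (i ∷ a ∷ b ∷ ν ∷ []) ring)
        enlarge : ∀ {ν} → 0ℚ ≤ ν → + 512 / 1 * ν * (1ℚ * 1ℚ) ≤ + 262144 / 1 * ν
        enlarge {ν} 0≤ν = by-gap (lit (+ 261632 / 1) ⊗ 0≤ν) (solve (ν ∷ []) ring)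

      𝔼-survivors : 𝔼 survivors ≡ + 15 / 16 * γ x + κ x * γ x
      𝔼-survivors = trans (E-+ pulls (λ _ → + 15 / 16 * γ x) (obs born x))
        (cong₂ _+_ (E-const pulls (+ 15 / 16 * γ x)) (trans (𝔼-obs born x) (mean-born x)))

      survivors-variance : 𝔼 (λ f → (survivors f - (+ 15 / 16 * γ x + κ x * γ x)) * (survivors f - (+ 15 / 16 * γ x + κ x * γ x))) ≤ ν {n} * (κ x * γ x)
      survivors-variance = ≤-trans (≤-reflexive (E-cong pulls λ f → trans
          (cancel (+ 15 / 16 * γ x) (obs born x f) (κ x * γ x))
          (cong (λ m → (obs born x f - m) * (obs born x f - m)) (sym (mean-born x)))))
        (born-variance x)
        where
        cancel : ∀ c o m → (c + o - (c + m)) * (c + o - (c + m)) ≡ (o - m) * (o - m)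
        cancel = solve-∀ ring

      𝔼-inv-survivors : 𝔼 (λ f → inv (survivors f)) ≤ r * inv (γ x)
      𝔼-inv-survivors = ≤-trans
        (inverse-moment pulls {r = + 9 / 10} 0<15/16γ ≤survivors 𝔼-survivors survivors-variance alive
          (growth-bound 0≤γ (granularity x alive) ≤κ κ≤1))
        (*-monoʳ-≤-nonNeg (inv (γ x)) {{ℚ.nonNegative 0≤i}} (toWitness {a? = + 9 / 10 ≤? r} _))

      growth-round : Round Alive Crowded (λ y → inv (γ y)) r (δ {n}) x
      growth-round = record
        { bad    = λ f → + 32 / 1 * i * (+ 32 / 1 * i) * (loss f * loss f)
        ; pot    = λ f → inv (survivors f)
        ; bad-≥0 = λ f → sq (+ 32 / 1 * i) ⊗ sq (loss f)
        ; pot-≥0 = λ f → inv-≥0 (<-≤-trans 0<15/16γ (≤survivors f))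
        ; 𝔼-bad  = 𝔼-loss
        ; 𝔼-pot  = 𝔼-inv-survivors
        ; cases  = λ f → decide f (≤-total (+ 1 / 16 * γ x) (obs dies x f))
        }
        where
        -- The mean loss 2ab is at most γ²/2 ≤ γ/32 because γ ≤ 1/16; a loss of γ/16 thus deviates
        -- by at least γ/32.
        many : ∀ {a b d m i} → m ≡ + 2 / 1 * (a * b) → a + b ≤ + 1 / 16 → 0ℚ ≤ a + b → 0ℚ ≤ i → + 1 / 16 * (a + b) ≤ d →
          (a + b) * i ≤ + 32 / 1 * i * (d - m)
        many {a} {b} {d} {i = i} refl g≤ 0≤g 0≤i ≤d = by-gap
          (lit (+ 32 / 1) ⊗ 0≤i ⊗ gap ≤d ⊕ lit (+ 16 / 1) ⊗ 0≤i ⊗ (0≤g ⊗ gap g≤) ⊕ lit (+ 16 / 1) ⊗ 0≤i ⊗ sq (a - b))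
          (solve (a ∷ b ∷ d ∷ i ∷ []) ring)
        few : ∀ {g d b} → d ≤ + 1 / 16 * g → + 15 / 16 * g + b ≤ g - d + b
        few {g} {d} {b} d≤ = by-gap (gap d≤) (solve (g ∷ d ∷ b ∷ []) ring)
        decide : ∀ f → + 1 / 16 * γ x ≤ obs dies x f ⊎ obs dies x f ≤ + 1 / 16 * γ x →
          1ℚ ≤ + 32 / 1 * i * (+ 32 / 1 * i) * (loss f * loss f) ⊎ Crowded (step f x) ⊎ (Alive (step f x) × inv (γ (step f x)) ≤ inv (survivors f))
        decide f (inj₁ ≤d) = inj₁ (far {+ 32 / 1 * i} {loss f} (subst (_≤ + 32 / 1 * i * loss f) γi≡1
          (many {α x} {β x} (mean-dies x) γ≤ 0≤γ 0≤i ≤d)))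
        decide f (inj₂ d≤) = inj₂ (inj₂ (<-≤-trans 0<s s≤ , inv-antimono 0<s s≤))
          where
          0<s : 0ℚ < survivors f
          0<s = <-≤-trans 0<15/16γ (≤survivors f)
          s≤ : survivors f ≤ γ (step f x)
          s≤ = subst (survivors f ≤_) (sym (γ-step x f)) (few {γ x} d≤)

      growth-potential-≥1 : 1ℚ ≤ inv (γ x)
      growth-potential-≥1 = subst (_≤ i) γi≡1 (shrink 0≤i (≤-trans γ≤ (toWitness {a? = + 1 / 16 ≤? 1ℚ} _)))
        where
        shrink : ∀ {g i} → 0ℚ ≤ i → g ≤ 1ℚ → g * i ≤ i
        shrink {g} {i} 0≤i g≤1 = by-gap (0≤i ⊗ gap g≤1) (solve (g ∷ i ∷ []) ring)

  -- Counting outcomes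

  𝟙-cong : ∀ {P Q : Set} (P? : Dec P) (Q? : Dec Q) → (P → Q) → (Q → P) → 𝟙 P? ≡ 𝟙 Q?
  𝟙-cong (yes p) (yes q) f g = refl
  𝟙-cong (yes p) (no ¬q) f g = contradiction (f p) ¬q
  𝟙-cong (no ¬p) (yes q) f g = contradiction (g q) ¬p
  𝟙-cong (no ¬p) (no ¬q) f g = refl

  𝟙-mono : ∀ {P Q : Set} (P? : Dec P) (Q? : Dec Q) → (P → Q) → 𝟙 P? ≤ 𝟙 Q?
  𝟙-mono (yes p) (yes q) f = ≤-refl
  𝟙-mono (yes p) (no ¬q) f = contradiction (f p) ¬q
  𝟙-mono (no ¬p) (yes q) f = lit 1ℚ
  𝟙-mono (no ¬p) (no ¬q) f = ≤-refl

  𝟙-true : ∀ {P : Set} (P? : Dec P) → P → 𝟙 P? ≡ 1ℚ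
  𝟙-true (yes _) p = refl
  𝟙-true (no ¬p) p = contradiction p ¬p

  sum-𝟙 : ∀ {m} {A : Set} {P : Pred A 0ℓ} (P? : Decidable P) (f : Fin m → A) →
          sum (λ u → 𝟙 (P? (f u))) ≡ ι (length (filter P? (tabulate f)))
  sum-𝟙 {zero}  P? f = refl
  sum-𝟙 {suc m} P? f with does (P? (f zero))
  ... | true  = trans (cong (_+_ 1ℚ) (sum-𝟙 P? (f ∘ suc))) (sym (ι-+ 1 (length (filter P? (tabulate (f ∘ suc))))))
  ... | false = trans (+-identityˡ _) (sum-𝟙 P? (f ∘ suc))

  sum-count : ∀ {m} {P : Pred (Fin m) 0ℓ} (P? : Decidable P) → sum (λ u → 𝟙 (P? u)) ≡ ι (count P?)
  sum-count P? = sum-𝟙 P? id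

  inv-unique : ∀ {p q} → 0ℚ < p → p * q ≡ 1ℚ → q ≡ inv p
  inv-unique {p} {q} 0<p pq≡1 = begin
    q               ≡⟨ *-identityʳ q ⟨
    q * 1ℚ          ≡⟨ cong (q *_) (inv-cancelʳ 0<p) ⟨
    q * (p * inv p) ≡⟨ lemma q p (inv p) ⟩
    (p * q) * inv p ≡⟨ cong (_* inv p) pq≡1 ⟩
    1ℚ * inv p      ≡⟨ *-identityˡ (inv p) ⟩
    inv p           ∎
    where
    open ≡-Reasoning
    lemma : ∀ q p i → q * (p * i) ≡ (p * q) * i
    lemma = solve-∀ ring

  /≡ι*inv : ∀ k N .{{_ : NonZero N}} → + k / N ≡ inv (ι N) * ι k
  /≡ι*inv k N@(suc N-1) = begin
    + k / N                       ≡⟨ *-identityˡ (+ k / N) ⟨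
    1ℚ * (+ k / N)                ≡⟨ cong (_* (+ k / N)) (trans (*-comm (inv (ι N)) (ι N)) (inv-cancelʳ (ι-pos N))) ⟨
    inv (ι N) * ι N * (+ k / N)   ≡⟨ *-assoc (inv (ι N)) (ι N) (+ k / N) ⟩
    inv (ι N) * (ι N * (+ k / N)) ≡⟨ cong (inv (ι N) *_) (toℚᵘ-injective cleared) ⟩
    inv (ι N) * ι k               ∎
    where
    open ≡-Reasoning
    cleared : toℚᵘ (ι N * (+ k / N)) ℚᵘ.≃ toℚᵘ (ι k)
    cleared = ℚᵘ.≃-trans (toℚᵘ-homo-* (ι N) (+ k / N)) (ℚᵘ.≃-trans
      (ℚᵘ.*-cong (toℚᵘ-ι N) (toℚᵘ-fromℚᵘ (mkℚᵘ (+ k) N-1)))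
      (ℚᵘ.≃-trans (ℚᵘ.*≡* (trans (ℤ.*-identityʳ (+ N ℤ.* + k)) (trans (ℤ.*-comm (+ N) (+ k)) (cong (λ d → + k ℤ.* + suc d) (sym (ℕ.+-identityʳ N-1))))))
        (ℚᵘ.≃-sym (toℚᵘ-ι k))))

  Pr≡ : ∀ n T .{{_ : NonZero n}} .{{_ : NonZero ((n ℕ.^ n) ℕ.^ T)}} {P : Pred (Choices n T) 0ℓ} (P? : Decidable P) →
        Pr n T P? ≡ E (uniform ((n ℕ.^ n) ℕ.^ T)) (λ i → 𝟙 (P? (λ t → finToFun (finToFun i t))))
  Pr≡ n T P? = trans (/≡ι*inv (count (λ i → P? (λ t → finToFun (finToFun i t)))) ((n ℕ.^ n) ℕ.^ T))
    (cong (inv (ι ((n ℕ.^ n) ℕ.^ T)) *_) (sym (sum-count (λ i → P? (λ t → finToFun (finToFun i t))))))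

  sum-++ : ∀ k {l} (g : Fin (k ℕ.+ l) → ℚ) → sum g ≡ sum (λ i → g (i ↑ˡ l)) + sum (λ j → g (k ↑ʳ j))
  sum-++ zero    g = sym (+-identityˡ (sum g))
  sum-++ (suc k) g = trans (cong (_+_ (g zero)) (sum-++ k (g ∘ suc))) (sym (+-assoc (g zero) _ _))

  sum-combine : ∀ m {l} (g : Fin (m ℕ.* l) → ℚ) → sum g ≡ sum (λ i → sum (λ j → g (combine {m} {l} i j)))
  sum-combine zero    g = refl
  sum-combine (suc m) {l} g = trans (sum-++ l g) (cong (_+_ (sum (λ j → g (j ↑ˡ (m ℕ.* l))))) (sum-combine m (λ k → g (l ↑ʳ k))))

  uniform-* : ∀ m l .{{_ : NonZero m}} .{{_ : NonZero l}} .{{_ : NonZero (m ℕ.* l)}} (g : Fin (m ℕ.* l) → ℚ) →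
              E (uniform (m ℕ.* l)) g ≡ E (uniform m) (λ i → E (uniform l) (λ j → g (combine {m} {l} i j)))
  uniform-* m l g = begin
    inv (ι (m ℕ.* l)) * sum g
      ≡⟨ cong₂ _*_ (sym inv-product) (sum-combine m g) ⟩
    inv (ι m) * inv (ι l) * sum (λ i → sum (λ j → g (combine {m} {l} i j)))
      ≡⟨ *-assoc (inv (ι m)) (inv (ι l)) _ ⟩
    inv (ι m) * (inv (ι l) * sum (λ i → sum (λ j → g (combine {m} {l} i j))))
      ≡⟨ cong (inv (ι m) *_) (*-distribˡ-sum (inv (ι l)) (λ i → sum (λ j → g (combine {m} {l} i j)))) ⟩
    inv (ι m) * sum (λ i → inv (ι l) * sum (λ j → g (combine {m} {l} i j))) ∎
    where
    open ≡-Reasoning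
    lemma : ∀ p q i j → p * q * (i * j) ≡ (p * i) * (q * j)
    lemma = solve-∀ ring
    inv-product : inv (ι m) * inv (ι l) ≡ inv (ι (m ℕ.* l))
    inv-product = inv-unique (ι-pos (m ℕ.* l)) (trans (cong (_* (inv (ι m) * inv (ι l))) (ι-* m l))
      (trans (lemma (ι m) (ι l) (inv (ι m)) (inv (ι l))) (cong₂ _*_ (inv-cancelʳ (ι-pos m)) (inv-cancelʳ (ι-pos l)))))

  -- `finToFun` reads off the base-`m` digits of a number, and a uniform number has independent
  -- uniform digits. `F` must respect pointwise equality, as the decoded function agrees with the
  -- cons form only pointwise.
  uniform-^ : ∀ m k .{{_ : NonZero m}} .{{_ : NonZero (m ℕ.^ k)}} (F : (Fin k → Fin m) → ℚ) →
              (∀ {f g} → f ≗ g → F f ≡ F g) →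
              E (uniform (m ℕ.^ k)) (λ i → F (finToFun i)) ≡ E (uniform m ^ᴱ k) F
  uniform-^ m zero    F F-cong = begin
    inv (ι 1) * (F (finToFun {m} {0} zero) + 0ℚ)  ≡⟨ cong₂ _*_ (sym (inv-unique {1ℚ} {1ℚ} (positive⁻¹ 1ℚ) refl)) (+-identityʳ (F (finToFun {m} {0} zero))) ⟩
    1ℚ * F (finToFun {m} {0} zero)                ≡⟨ *-identityˡ _ ⟩
    F (finToFun {m} {0} zero)                     ≡⟨ F-cong (λ ()) ⟩
    F (λ ())                                      ∎
    where open ≡-Reasoning
  uniform-^ m (suc k) F F-cong = begin
    E (uniform (m ℕ.* m ℕ.^ k)) (λ i → F (finToFun i))
      ≡⟨ uniform-* m (m ℕ.^ k) (λ i → F (finToFun i)) ⟩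
    E (uniform m) (λ i → E (uniform (m ℕ.^ k)) (λ j → F (finToFun (combine {m} {m ℕ.^ k} i j))))
      ≡⟨ E-cong (uniform m) (λ i → E-cong (uniform (m ℕ.^ k)) (λ j → F-cong (split i j))) ⟩
    E (uniform m) (λ i → E (uniform (m ℕ.^ k)) (λ j → F (i Vector.∷ finToFun j)))
      ≡⟨ E-cong (uniform m) (λ i → uniform-^ m k (λ f → F (i Vector.∷ f)) (λ f≗g → F-cong (λ { zero → refl ; (suc t) → f≗g t }))) ⟩
    E (uniform m) (λ i → E (uniform m ^ᴱ k) (λ f → F (i Vector.∷ f))) ∎
    where
    open ≡-Reasoning
    instance
      mᵏ≢0 : NonZero (m ℕ.^ k)
      mᵏ≢0 = ℕ.m^n≢0 m k
    split : ∀ i (j : Fin (m ℕ.^ k)) → finToFun {m} {suc k} (combine i j) ≗ (i Vector.∷ finToFun j)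
    split i j zero    = cong proj₁ (remQuot-combine {m} {m ℕ.^ k} i j)
    split i j (suc t) = cong (λ p → finToFun (proj₂ p) t) (remQuot-combine {m} {m ℕ.^ k} i j)

  count-cong : ∀ {m} {P Q : Pred (Fin m) 0ℓ} (P? : Decidable P) (Q? : Decidable Q) → (∀ u → P u → Q u) → (∀ u → Q u → P u) → count P? ≡ count Q?
  count-cong P? Q? f g = ι-injective (trans (sym (sum-count P?)) (trans (sum-cong-≗ (λ u → 𝟙-cong (P? u) (Q? u) (f u) (g u))) (sum-count Q?)))

  s-cong : ∀ {n} {x y : Config n} → x ≗ y → s x ≡ s y
  s-cong {x = x} {y} x≗y = cong₂ (λ p q → + p ℤ.- + q) (colour alpha) (colour beta)
    where
    colour : ∀ σ → count (λ u → x u ≟ₛ σ) ≡ count (λ u → y u ≟ₛ σ)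
    colour σ = count-cong (λ u → x u ≟ₛ σ) (λ u → y u ≟ₛ σ) (λ u → trans (sym (x≗y u))) (λ u → trans (x≗y u))

  consensus-cong : ∀ {n} {x y : Config n} → x ≗ y → ColorConsensus x → ColorConsensus y
  consensus-cong x≗y h = trans (cong ℤ.∣_∣ (sym (s-cong x≗y))) h

  step-cong : ∀ {n} {x y : Config n} {f g} → x ≗ y → f ≗ g → step f x ≗ step g y
  step-cong {y = y} {f} x≗y f≗g u = cong₂ update (x≗y u) (trans (x≗y (f u)) (cong y (f≗g u)))

  -- The failure recursion as a probability

  module _ {n : ℕ} .{{_ : NonZero n}} where

    miss-cong : ∀ T {x y : Config n} → x ≗ y → miss T x ≡ miss T y
    miss-cong T {x} {y} x≗y with colorConsensus? x | colorConsensus? y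
    miss-cong T       x≗y | yes _ | yes _ = refl
    miss-cong T       x≗y | yes h | no ¬h = contradiction (consensus-cong x≗y h) ¬h
    miss-cong T       x≗y | no ¬h | yes h = contradiction (consensus-cong (sym ∘ x≗y) h) ¬h
    miss-cong zero    x≗y | no _  | no _  = refl
    miss-cong (suc T) x≗y | no _  | no _  = E-cong pulls λ f → miss-cong T (step-cong x≗y (λ _ → refl))

    X-cong : ∀ T (x : Config n) {ω ω′ : Choices n T} → (∀ t → ω t ≡ ω′ t) → ∀ t → X x ω t ≡ X x ω′ t
    X-cong T       x ω≡ zero    = refl
    X-cong (suc T) x {ω} {ω′} ω≡ (suc t) rewrite ω≡ zero = X-cong T (step (ω′ zero) x) (ω≡ ∘ suc) t

    private
      instance
        nⁿ≢0 : NonZero (n ℕ.^ n)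
        nⁿ≢0 = ℕ.m^n≢0 n n
      N : ℕ
      N = n ℕ.^ n

    hit : ∀ T → Config n → Choices n T → ℚ
    hit T x ω = 𝟙 (convergesTo? {T = T} colorConsensus? x ω)

    unpack : ∀ {T} → (Fin T → Fin N) → Choices n T
    unpack ω t = finToFun (ω t)

    pulls≡ : ∀ (F : (Fin n → Fin n) → ℚ) → (∀ {f g} → f ≗ g → F f ≡ F g) →
             E (uniform N) (λ i → F (finToFun i)) ≡ 𝔼 F
    pulls≡ F F-cong = uniform-^ n n F F-cong

    𝔼-hit-now : ∀ T x → ColorConsensus x → E (uniform N ^ᴱ T) (λ ω → hit T x (unpack ω)) ≡ 1ℚ - 0ℚ
    𝔼-hit-now T x h = trans (E-cong (uniform N ^ᴱ T) (λ ω → 𝟙-true (convergesTo? {T = T} colorConsensus? x (unpack ω)) (zero , h))) (E-1 (uniform N ^ᴱ T))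

    -- Outcomes are encoded on two levels, rounds and then the nodes of a round. Here the rounds are
    -- already independent numbers and `pulls≡` decodes each of them; `1-Pr≡miss` applies
    -- `uniform-^` to the outer level.
    𝔼-hit : ∀ T x → E (uniform N ^ᴱ T) (λ ω → hit T x (unpack ω)) ≡ 1ℚ - miss T x
    𝔼-hit T x with colorConsensus? x in eq
    𝔼-hit T x | yes h = 𝔼-hit-now T x h
    𝔼-hit zero x | no ¬h = 𝟙-cong (convergesTo? {T = zero} colorConsensus? x (λ ())) (no id) (λ { (zero , h) → ¬h h }) λ ()
    𝔼-hit (suc T) x | no ¬h = begin
      E (uniform N) (λ i → E (uniform N ^ᴱ T) (λ ω → hit (suc T) x (unpack (i Vector.∷ ω))))
        ≡⟨ E-cong (uniform N) (λ i → E-cong (uniform N ^ᴱ T) (λ ω → later i ω)) ⟩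
      E (uniform N) (λ i → E (uniform N ^ᴱ T) (λ ω → hit T (step (finToFun i) x) (unpack ω)))
        ≡⟨ E-cong (uniform N) (λ i → 𝔼-hit T (step (finToFun i) x)) ⟩
      E (uniform N) (λ i → 1ℚ - miss T (step (finToFun i) x))
        ≡⟨ pulls≡ (λ f → 1ℚ - miss T (step f x)) (λ f≗g → cong (_-_ 1ℚ) (miss-cong T (step-cong {x = x} (λ _ → refl) f≗g))) ⟩
      𝔼 (λ f → 1ℚ - miss T (step f x))
        ≡⟨ E-cong pulls (λ f → lemma (miss T (step f x))) ⟩
      𝔼 (λ f → - 1ℚ * miss T (step f x) + 1ℚ)
        ≡⟨ E-linear pulls (- 1ℚ) (λ f → miss T (step f x)) (λ _ → 1ℚ) ⟩
      - 1ℚ * 𝔼 (λ f → miss T (step f x)) + 𝔼 (λ _ → 1ℚ)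
        ≡⟨ cong (λ e → - 1ℚ * 𝔼 (λ f → miss T (step f x)) + e) (E-1 pulls) ⟩
      - 1ℚ * 𝔼 (λ f → miss T (step f x)) + 1ℚ
        ≡⟨ lemma (𝔼 (λ f → miss T (step f x))) ⟨
      1ℚ - 𝔼 (λ f → miss T (step f x)) ∎
      where
      open ≡-Reasoning
      lemma : ∀ m → 1ℚ - m ≡ - 1ℚ * m + 1ℚ
      lemma = solve-∀ ring
      later : ∀ i ω → hit (suc T) x (unpack (i Vector.∷ ω)) ≡ hit T (step (finToFun i) x) (unpack ω)
      later i ω = 𝟙-cong (convergesTo? {T = suc T} colorConsensus? x (unpack (i Vector.∷ ω))) (convergesTo? {T = T} colorConsensus? (step (finToFun i) x) (unpack ω))
        (λ { (zero , h) → contradiction h ¬h ; (suc t , h) → t , h }) (λ (t , h) → suc t , h)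

    module _ (T : ℕ) where
      private
        instance
          total≢0 : NonZero (N ℕ.^ T)
          total≢0 = ℕ.m^n≢0 N T

      1-Pr≡miss : ∀ x → 1ℚ - Pr n T (convergesTo? colorConsensus? x) ≡ miss T x
      1-Pr≡miss x = trans (cong (_-_ 1ℚ) (trans (Pr≡ n T (convergesTo? colorConsensus? x))
          (trans (uniform-^ N T (λ ω → hit T x (unpack ω)) (λ ω≡ → hit-cong ω≡)) (𝔼-hit T x))))
        (lemma (miss T x))
        where
        lemma : ∀ m → 1ℚ - (1ℚ - m) ≡ m
        lemma = solve-∀ ring
        hit-cong : ∀ {ω ω′ : Fin T → Fin N} → ω ≗ ω′ → hit T x (unpack ω) ≡ hit T x (unpack ω′)
        hit-cong {ω} {ω′} ω≗ω′ = 𝟙-cong (convergesTo? {T = T} colorConsensus? x (unpack ω)) (convergesTo? {T = T} colorConsensus? x (unpack ω′))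
          (λ (t , h) → t , subst ColorConsensus (X-cong T x (cong finToFun ∘ ω≗ω′) t) h)
          (λ (t , h) → t , subst ColorConsensus (sym (X-cong T x (cong finToFun ∘ ω≗ω′) t)) h)

      Pr-mono : ∀ {P Q : Pred (Choices n T) 0ℓ} (P? : Decidable P) (Q? : Decidable Q) → (∀ ω → P ω → Q ω) → Pr n T P? ≤ Pr n T Q?
      Pr-mono P? Q? P⊆Q = subst₂ _≤_ (sym (Pr≡ n T P?)) (sym (Pr≡ n T Q?))
        (E-mono (uniform (N ℕ.^ T)) λ i → 𝟙-mono (P? (λ t → finToFun (finToFun i t))) (Q? (λ t → finToFun (finToFun i t))) (P⊆Q _))

      Pr-≤1 : ∀ {P : Pred (Choices n T) 0ℓ} (P? : Decidable P) → Pr n T P? ≤ 1ℚ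
      Pr-≤1 P? = subst (_≤ 1ℚ) (sym (Pr≡ n T P?)) (E-≤1 (uniform (N ℕ.^ T)) λ i → 𝟙-mono (P? (λ t → finToFun (finToFun i t))) (yes tt) (λ _ → tt))

      Pr-certain : ∀ {P : Pred (Choices n T) 0ℓ} (P? : Decidable P) → (∀ ω → P ω) → Pr n T P? ≡ 1ℚ
      Pr-certain P? all = trans (Pr≡ n T P?) (trans
        (E-cong (uniform (N ℕ.^ T)) λ i → 𝟙-true (P? (λ t → finToFun (finToFun i t))) (all _)) (E-1 (uniform (N ℕ.^ T))))

  -- Logarithms, powers and configurations of a single colour

  2^⌊log₂n⌋≤n : ∀ n .{{_ : NonZero n}} → 2 ℕ.^ ⌊log₂ n ⌋ ℕ.≤ n
  2^⌊log₂n⌋≤n n = <-rec (λ n → 1 ℕ.≤ n → 2 ℕ.^ ⌊log₂ n ⌋ ℕ.≤ n) go n (ℕ.>-nonZero⁻¹ n)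
    where
    go : ∀ n → (∀ {m} → m ℕ.< n → 1 ℕ.≤ m → 2 ℕ.^ ⌊log₂ m ⌋ ℕ.≤ m) → 1 ℕ.≤ n → 2 ℕ.^ ⌊log₂ n ⌋ ℕ.≤ n
    go (suc zero)      ih _ = ℕ.≤-refl
    go n@(suc (suc k)) ih _ = begin
      2 ℕ.^ ⌊log₂ n ⌋                ≡⟨ cong (2 ℕ.^_) (ℕ.m+[n∸m]≡n 1≤log) ⟨
      2 ℕ.* 2 ℕ.^ (⌊log₂ n ⌋ ℕ.∸ 1)  ≡⟨ cong (λ l → 2 ℕ.* 2 ℕ.^ l) (⌊log₂⌊n/2⌋⌋≡⌊log₂n⌋∸1 n) ⟨
      2 ℕ.* 2 ℕ.^ ⌊log₂ ⌊ n /2⌋ ⌋    ≤⟨ ℕ.*-monoʳ-≤ 2 (ih (ℕ.⌊n/2⌋<n (suc k)) (s≤s z≤n)) ⟩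
      2 ℕ.* ⌊ n /2⌋                  ≡⟨ cong (⌊ n /2⌋ ℕ.+_) (ℕ.+-identityʳ ⌊ n /2⌋) ⟩
      ⌊ n /2⌋ ℕ.+ ⌊ n /2⌋            ≤⟨ ℕ.+-monoʳ-≤ ⌊ n /2⌋ (ℕ.⌊n/2⌋≤⌈n/2⌉ n) ⟩
      ⌊ n /2⌋ ℕ.+ ℕ.⌈ n /2⌉          ≡⟨ ℕ.⌊n/2⌋+⌈n/2⌉≡n n ⟩
      n                              ∎
      where
      open ℕ.≤-Reasoning
      1≤log : 1 ℕ.≤ ⌊log₂ n ⌋
      1≤log = ⌊log₂⌋-mono-≤ {2} {n} (s≤s (s≤s z≤n))

  n≤2*2^⌊log₂n⌋ : ∀ n → n ℕ.≤ 2 ℕ.* 2 ℕ.^ ⌊log₂ n ⌋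
  n≤2*2^⌊log₂n⌋ n = ℕ.≮⇒≥ λ 2*2^L<n → ℕ.<-irrefl refl
    (subst (ℕ._≤ ⌊log₂ n ⌋) (⌊log₂[2^n]⌋≡n (suc ⌊log₂ n ⌋)) (⌊log₂⌋-mono-≤ (ℕ.<⇒≤ 2*2^L<n)))

  1+l≤2^l : ∀ l → suc l ℕ.≤ 2 ℕ.^ l
  1+l≤2^l zero    = ℕ.≤-refl
  1+l≤2^l (suc l) = begin
    suc (suc l)                    ≤⟨ s≤s (1+l≤2^l l) ⟩
    1 ℕ.+ 2 ℕ.^ l                  ≤⟨ ℕ.+-monoˡ-≤ (2 ℕ.^ l) (ℕ.≤-trans (s≤s z≤n) (1+l≤2^l l)) ⟩
    2 ℕ.^ l ℕ.+ 2 ℕ.^ l            ≡⟨ cong (2 ℕ.^ l ℕ.+_) (ℕ.+-identityʳ (2 ℕ.^ l)) ⟨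
    2 ℕ.* 2 ℕ.^ l                  ∎
    where open ℕ.≤-Reasoning

  ι-^ : ∀ m k → ι (m ℕ.^ k) ≡ ι m ^ k
  ι-^ m zero    = refl
  ι-^ m (suc k) = trans (ι-* m (m ℕ.^ k)) (cong (ι m *_) (ι-^ m k))

  l²≤4*2^l : ∀ l → ι l * ι l ≤ + 4 / 1 * ι (2 ℕ.^ l)
  l²≤4*2^l zero    = lit (+ 4 / 1)
  l²≤4*2^l (suc l) = subst₂ _≤_ (cong (λ m → m * m) (sym (ι-+ 1 l))) (cong (+ 4 / 1 *_) (sym (ι-* 2 (2 ℕ.^ l))))
    (bound {ι l} (l²≤4*2^l l) (subst (_≤ ι (2 ℕ.^ l)) (ι-+ 1 l) (ι-mono-≤ (1+l≤2^l l))) (ι-≥0 (2 ℕ.^ l)))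
    where
    bound : ∀ {m p} → m * m ≤ + 4 / 1 * p → 1ℚ + m ≤ p → 0ℚ ≤ p → (1ℚ + m) * (1ℚ + m) ≤ + 4 / 1 * (+ 2 / 1 * p)
    bound {m} {p} m²≤ m≤ 0≤p = by-gap (gap m²≤ ⊕ lit (+ 2 / 1) ⊗ gap m≤ ⊕ lit (+ 2 / 1) ⊗ 0≤p ⊕ lit (+ 1 / 1)) (solve (m ∷ p ∷ []) ring)

  ^-mono-≤ : ∀ {p q} k → 0ℚ ≤ p → p ≤ q → p ^ k ≤ q ^ k
  ^-mono-≤ zero    0≤p p≤q = ≤-refl
  ^-mono-≤ {p} {q} (suc k) 0≤p p≤q = by-gap (gap p≤q ⊗ ^-≥0 k 0≤p ⊕ (≤-trans 0≤p p≤q) ⊗ gap (^-mono-≤ k 0≤p p≤q)) (lemma p q (p ^ k) (q ^ k))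
    where
    lemma : ∀ p q s t → q * t ≡ p * s + ((q - p) * s + q * (t - s))
    lemma = solve-∀ ring

  -- A rational substitute for (1 - e)ᵏ ≤ exp(-ke): it bounds the power from above by 1/(1 + ke).
  bernoulli : ∀ {e} k → 0ℚ ≤ e → 0ℚ ≤ 1ℚ - e → (1ℚ - e) ^ k * (1ℚ + ι k * e) ≤ 1ℚ
  bernoulli {e} zero 0≤e 0≤r = ≤-reflexive (lemma e)
    where
    lemma : ∀ e → 1ℚ * (1ℚ + 0ℚ * e) ≡ 1ℚ
    lemma = solve-∀ ring
  bernoulli {e} (suc k) 0≤e 0≤r = ≤-trans
    (subst (λ t → (1ℚ - e) * (1ℚ - e) ^ k * (1ℚ + t * e) ≤ (1ℚ - e) ^ k * (1ℚ + ι k * e)) (sym (ι-+ 1 k))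
      (by-gap (^-≥0 k 0≤r ⊗ ((ι-≥0 k ⊕ lit 1ℚ) ⊗ sq e)) (lemma ((1ℚ - e) ^ k) (ι k) e)))
    (bernoulli k 0≤e 0≤r)
    where
    lemma : ∀ p k e → p * (1ℚ + k * e) ≡ (1ℚ - e) * p * (1ℚ + (1ℚ + k) * e) + p * ((k + 1ℚ) * (e * e))
    lemma = solve-∀ ring

  power-≤¼ : ∀ {r e} k → r ≡ 1ℚ - e → 0ℚ ≤ e → 0ℚ ≤ r → ι k * e ≡ + 3 / 1 → r ^ k ≤ + 1 / 4
  power-≤¼ {e = e} k refl 0≤e 0≤r ke≡3 = quarter (subst (λ t → (1ℚ - e) ^ k * (1ℚ + t) ≤ 1ℚ) ke≡3 (bernoulli k 0≤e 0≤r))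
    where
    quarter : ∀ {p} → p * (1ℚ + + 3 / 1) ≤ 1ℚ → p ≤ + 1 / 4
    quarter {p} h = by-gap (lit (+ 1 / 4) ⊗ gap h) (solve (p ∷ []) ring)

  opaque
    -- 3 · 2⁵², where 2⁻⁵² = 1 − r; opaque because r ^ K₀ must never be unfolded.
    K₀ : ℕ
    K₀ = 13510798882111488

    K₀/2⁵²≡3 : ι K₀ * (+ 1 / 4503599627370496) ≡ + 3 / 1
    K₀/2⁵²≡3 = refl

  r^K₀≤¼ : r ^ K₀ ≤ + 1 / 4
  r^K₀≤¼ = power-≤¼ K₀ refl (lit (+ 1 / 4503599627370496)) (lit r) K₀/2⁵²≡3

  halves : ∀ l → (+ 1 / 2) ^ l * ι (2 ℕ.^ l) ≡ 1ℚ
  halves zero    = refl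
  halves (suc l) = trans (cong (+ 1 / 2 * (+ 1 / 2) ^ l *_) (ι-* 2 (2 ℕ.^ l)))
    (trans (lemma ((+ 1 / 2) ^ l) (ι (2 ℕ.^ l))) (halves l))
    where
    lemma : ∀ h p → + 1 / 2 * h * (+ 2 / 1 * p) ≡ h * p
    lemma = solve-∀ ring

  -- Each block of `K₀` rounds gains a factor 1/4, that is 1/2 twice. With l = ⌊log₂ n⌋ one factor
  -- 2⁻ˡ brings a potential of order n down to a constant, the other one down to order 1/n.
  r^[K₀l]n≤4ν : ∀ {n ν} l → 0ℚ ≤ n → 0ℚ ≤ ν → n * ν ≡ 1ℚ → n ≤ + 2 / 1 * ι (2 ℕ.^ l) → r ^ (K₀ ℕ.* l) * n ≤ + 4 / 1 * ν
  r^[K₀l]n≤4ν {n} {ν} l 0≤n 0≤ν nν≡1 n≤ = begin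
    r ^ (K₀ ℕ.* l) * n            ≡⟨ cong (_* n) (^-assocʳ r K₀ l) ⟨
    (r ^ K₀) ^ l * n              ≤⟨ *-monoʳ-≤-nonNeg n {{ℚ.nonNegative 0≤n}} (^-mono-≤ l (^-≥0 K₀ (lit r)) r^K₀≤¼) ⟩
    (+ 1 / 4) ^ l * n             ≡⟨ cong (_* n) (^-distrib-* (+ 1 / 2) (+ 1 / 2) l) ⟩
    h * h * n                     ≤⟨ less {h} 0≤h hn≤2 ⟩
    + 2 / 1 * h                   ≡⟨ cong (+ 2 / 1 *_) (trans (cong (h *_) nν≡1) (*-identityʳ h)) ⟨
    + 2 / 1 * (h * (n * ν))       ≤⟨ less′ {h} 0≤ν hn≤2 ⟩
    + 4 / 1 * ν                   ∎
    where
    open ≤-Reasoning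
    h p : ℚ
    h = (+ 1 / 2) ^ l
    p = ι (2 ℕ.^ l)
    0≤h : 0ℚ ≤ h
    0≤h = ^-≥0 l (lit (+ 1 / 2))
    scale : ∀ {h n p} → 0ℚ ≤ h → n ≤ + 2 / 1 * p → h * n ≤ + 2 / 1 * (h * p)
    scale {h} {n} {p} 0≤h n≤ = by-gap (0≤h ⊗ gap n≤) (solve (h ∷ n ∷ p ∷ []) ring)
    hn≤2 : h * n ≤ + 2 / 1 * 1ℚ
    hn≤2 = subst (λ t → h * n ≤ + 2 / 1 * t) (halves l) (scale {p = p} 0≤h n≤)
    less : ∀ {h n} → 0ℚ ≤ h → h * n ≤ + 2 / 1 * 1ℚ → h * h * n ≤ + 2 / 1 * h
    less {h} {n} 0≤h hn≤2 = by-gap (0≤h ⊗ gap hn≤2) (solve (h ∷ n ∷ []) ring)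
    less′ : ∀ {h n ν} → 0ℚ ≤ ν → h * n ≤ + 2 / 1 * 1ℚ → + 2 / 1 * (h * (n * ν)) ≤ + 4 / 1 * ν
    less′ {h} {n} {ν} 0≤ν hn≤2 = by-gap (lit (+ 2 / 1) ⊗ 0≤ν ⊗ gap hn≤2) (solve (h ∷ n ∷ ν ∷ []) ring)

  module _ {n : ℕ} .{{_ : NonZero n}} where
    α≡νa : ∀ x → α {n} x ≡ ν {n} * ι (a x)
    α≡νa x = cong (ν {n} *_) (sum-count (λ u → x u ≟ₛ alpha))

    β≡νb : ∀ x → β {n} x ≡ ν {n} * ι (b x)
    β≡νb x = cong (ν {n} *_) (sum-count (λ u → x u ≟ₛ beta))

    κ≡νq : ∀ x → κ {n} x ≡ ν {n} * ι (q x)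
    κ≡νq x = cong (ν {n} *_) (sum-count (λ u → x u ≟ₛ undecided))

    nν≡1 : ι n * ν {n} ≡ 1ℚ
    nν≡1 = inv-cancelʳ (ι-pos n)

    n*ν* : ∀ p → ι n * (ν {n} * p) ≡ p
    n*ν* p = trans (sym (*-assoc (ι n) (ν {n}) p)) (trans (cong (_* p) nν≡1) (*-identityˡ p))

    a+b+q≡n : ∀ (x : Config n) → a x ℕ.+ b x ℕ.+ q x ≡ n
    a+b+q≡n x = ι-injective (begin
      ι (a x ℕ.+ b x ℕ.+ q x)                                     ≡⟨ ι-+ (a x ℕ.+ b x) (q x) ⟩
      ι (a x ℕ.+ b x) + ι (q x)                                   ≡⟨ cong (_+ ι (q x)) (ι-+ (a x) (b x)) ⟩
      ι (a x) + ι (b x) + ι (q x)                                 ≡⟨ n*ν* _ ⟨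
      ι n * (ν {n} * (ι (a x) + ι (b x) + ι (q x)))               ≡⟨ cong (ι n *_) (distribute (ν {n}) (ι (a x)) (ι (b x)) (ι (q x))) ⟩
      ι n * (ν {n} * ι (a x) + ν {n} * ι (b x) + ν {n} * ι (q x)) ≡⟨ cong (ι n *_) (cong₂ _+_ (cong₂ _+_ (sym (α≡νa x)) (sym (β≡νb x))) (sym (κ≡νq x))) ⟩
      ι n * (α x + β x + κ x)                                     ≡⟨ cong (λ k → ι n * (α x + β x + k)) (κ≡ x) ⟩
      ι n * (α x + β x + (1ℚ - α x - β x))                        ≡⟨ total (ι n) (α x) (β x) ⟩
      ι n                                                         ∎)
      where
      open ≡-Reasoning
      distribute : ∀ v a b c → v * (a + b + c) ≡ v * a + v * b + v * c
      distribute = solve-∀ ring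
      total : ∀ n a b → n * (a + b + (1ℚ - a - b)) ≡ n
      total = solve-∀ ring

    γ≡ν[a+b] : ∀ x → γ {n} x ≡ ν {n} * ι (a x ℕ.+ b x)
    γ≡ν[a+b] x = trans (cong₂ _+_ (α≡νa x) (β≡νb x))
      (trans (sym (*-distribˡ-+ (ν {n}) (ι (a x)) (ι (b x)))) (cong (ν {n} *_) (sym (ι-+ (a x) (b x)))))

    ν*-≥ : ∀ k → 1 ℕ.≤ k → ν {n} ≤ ν {n} * ι k
    ν*-≥ k 1≤k = subst (_≤ ν {n} * ι k) (*-identityʳ (ν {n})) (*-monoˡ-≤-nonNeg (ν {n}) {{ℚ.nonNegative (ν-≥0 {n})}} (ι-mono-≤ 1≤k))

    alive-granularity : ∀ x → Alive x → ν {n} ≤ γ {n} x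
    alive-granularity x alive = go (a x ℕ.+ b x) (γ≡ν[a+b] x)
      where
      go : ∀ k → γ x ≡ ν {n} * ι k → ν {n} ≤ γ x
      go zero    γ≡0 = contradiction (sym (trans γ≡0 (*-zeroʳ (ν {n})))) (<⇒≢ alive)
      go (suc k) γ≡  = subst (ν {n} ≤_) (sym γ≡) (ν*-≥ (suc k) (s≤s z≤n))

    coloured⇒alive : ∀ x → q x ℕ.< n → Alive {n} x
    coloured⇒alive x q<n = go (a x ℕ.+ b x) (a+b+q≡n x) (γ≡ν[a+b] x)
      where
      go : ∀ k → k ℕ.+ q x ≡ n → γ x ≡ ν {n} * ι k → Alive x
      go zero    q≡n _  = contradiction q<n (ℕ.<-irrefl q≡n)
      go (suc k) _   γ≡ = subst (0ℚ <_) (sym γ≡) (<-≤-trans 0<ν (ν*-≥ (suc k) (s≤s z≤n)))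

    s≡ : ∀ (x : Config n) → ℤ.∣ s x ∣ ≡ ℤ.∣ a x ℤ.⊖ b x ∣
    s≡ x = cong ℤ.∣_∣ (ℤ.[+m]-[+n]≡m⊖n (a x) (b x))

    only-α : ∀ (x : Config n) → b x ≡ 0 → q x ≡ 0 → ColorConsensus x
    only-α x b≡0 q≡0 = begin
      ℤ.∣ s x ∣                     ≡⟨ s≡ x ⟩
      ℤ.∣ a x ℤ.⊖ b x ∣             ≡⟨ cong (λ m → ℤ.∣ a x ℤ.⊖ m ∣) b≡0 ⟩
      a x                           ≡⟨ trans (ℕ.+-identityʳ (a x ℕ.+ 0)) (ℕ.+-identityʳ (a x)) ⟨
      a x ℕ.+ 0 ℕ.+ 0               ≡⟨ cong₂ (λ l m → a x ℕ.+ l ℕ.+ m) b≡0 q≡0 ⟨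
      a x ℕ.+ b x ℕ.+ q x           ≡⟨ a+b+q≡n x ⟩
      n                             ∎
      where open ≡-Reasoning

    only-β : ∀ (x : Config n) → a x ≡ 0 → q x ≡ 0 → ColorConsensus x
    only-β x a≡0 q≡0 = begin
      ℤ.∣ s x ∣                     ≡⟨ s≡ x ⟩
      ℤ.∣ a x ℤ.⊖ b x ∣             ≡⟨ ℤ.∣m⊖n∣≡∣n⊖m∣ (a x) (b x) ⟩
      ℤ.∣ b x ℤ.⊖ a x ∣             ≡⟨ cong (λ m → ℤ.∣ b x ℤ.⊖ m ∣) a≡0 ⟩
      b x                           ≡⟨ ℕ.+-identityʳ (b x) ⟨
      b x ℕ.+ 0                     ≡⟨ cong₂ (λ l m → l ℕ.+ b x ℕ.+ m) a≡0 q≡0 ⟨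
      a x ℕ.+ b x ℕ.+ q x           ≡⟨ a+b+q≡n x ⟩
      n                             ∎
      where open ≡-Reasoning

    minority-≥1 : ∀ l m → ¬ (l ≡ 0 × m ≡ 0) → 1ℚ ≤ + 4 / 1 * ι l + ι m
    minority-≥1 zero    zero    ¬0 = contradiction (refl , refl) ¬0
    minority-≥1 zero    (suc m) ¬0 = subst (1ℚ ≤_) (sym (+-identityˡ (ι (suc m)))) (ι-≥1 (suc m))
    minority-≥1 (suc l) m       ¬0 = bound (ι-≥1 (suc l)) (ι-≥0 m)
      where
      bound : ∀ {l m} → 1ℚ ≤ l → 0ℚ ≤ m → 1ℚ ≤ + 4 / 1 * l + m
      bound {l} {m} 1≤l 0≤m = by-gap (lit (+ 4 / 1) ⊗ gap 1≤l ⊕ 0≤m ⊕ lit (+ 3 / 1)) (solve (l ∷ m ∷ []) ring)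

    weighted : ∀ l m → + 4 / 1 * ι n * (ν {n} * ι l + + 1 / 4 * (ν {n} * ι m)) ≡ + 4 / 1 * ι l + ι m
    weighted l m = trans (regroup (ι n) (ν {n}) (ι l) (ι m)) (cong₂ (λ p q → + 4 / 1 * p + q) (n*ν* (ι l)) (n*ν* (ι m)))
      where
      regroup : ∀ n v l m → + 4 / 1 * n * (v * l + + 1 / 4 * (v * m)) ≡ + 4 / 1 * (n * (v * l)) + n * (v * m)
      regroup = solve-∀ ring

    granularity-α : ∀ x → ¬ ColorConsensus x → 1ℚ ≤ + 4 / 1 * ι n * share {n} wα x
    granularity-α x ¬h = subst (1ℚ ≤_)
      (sym (trans (cong (+ 4 / 1 * ι n *_) (trans (share-α x) (cong₂ (λ l m → l + + 1 / 4 * m) (β≡νb x) (κ≡νq x)))) (weighted (b x) (q x))))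
      (minority-≥1 (b x) (q x) λ (b≡0 , q≡0) → ¬h (only-α x b≡0 q≡0))

    granularity-β : ∀ x → ¬ ColorConsensus x → 1ℚ ≤ + 4 / 1 * ι n * share {n} wβ x
    granularity-β x ¬h = subst (1ℚ ≤_)
      (sym (trans (cong (+ 4 / 1 * ι n *_) (trans (share-β x) (cong₂ (λ l m → l + + 1 / 4 * m) (α≡νa x) (κ≡νq x)))) (weighted (a x) (q x))))
      (minority-≥1 (a x) (q x) λ (a≡0 , q≡0) → ¬h (only-β x a≡0 q≡0))

    count≡n⇒all : ∀ {P : Pred (Fin n) 0ℓ} (P? : Decidable P) → count P? ≡ n → ∀ u → P u
    count≡n⇒all P? count≡n u with P? u
    ... | yes p = p
    ... | no ¬p = contradiction (subst (ℕ._< n) count≡n (subst (count P? ℕ.<_) (length-tabulate id)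
      (filter-notAll P? (allFin n) (lose (∈-allFin u) ¬p)))) (ℕ.<-irrefl refl)

    count≤n : ∀ {P : Pred (Fin n) 0ℓ} (P? : Decidable P) → count P? ℕ.≤ n
    count≤n P? = subst (count P? ℕ.≤_) (length-tabulate id) (length-filter P? (allFin n))

    -- The difference of two counts is at most the larger of them, which is at most n; a bias of n
    -- therefore makes one count equal to n.
    consensus⇒uniform : ∀ (x : Config n) → ColorConsensus x → ∃[ σ ] σ ≢ undecided × (∀ u → x u ≡ σ)
    consensus⇒uniform x h = Sum.[ (λ a⊔b≡a → alpha , (λ ()) , count≡n⇒all (λ u → x u ≟ₛ alpha) (full (λ u → x u ≟ₛ alpha) a⊔b≡a))
                                , (λ a⊔b≡b → beta , (λ ()) , count≡n⇒all (λ u → x u ≟ₛ beta) (full (λ u → x u ≟ₛ beta) a⊔b≡b)) ]′ (ℕ.⊔-sel (a x) (b x))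
      where
      n≤a⊔b : n ℕ.≤ a x ℕ.⊔ b x
      n≤a⊔b = subst (ℕ._≤ a x ℕ.⊔ b x) (trans (sym (s≡ x)) h) (ℤ.∣m⊝n∣≤m⊔n (a x) (b x))
      full : ∀ {P : Pred (Fin n) 0ℓ} (P? : Decidable P) → a x ℕ.⊔ b x ≡ count P? → count P? ≡ n
      full P? eq = ℕ.≤-antisym (count≤n P?) (subst (n ℕ.≤_) eq n≤a⊔b)

  -- Validity: a round never introduces a colour that was absent

  update-origin : ∀ σ τ {ρ} → update σ τ ≡ ρ → ρ ≢ undecided → σ ≡ ρ ⊎ τ ≡ ρ
  update-origin alpha     alpha     eq ρ≢u = inj₁ eq
  update-origin alpha     beta      eq ρ≢u = contradiction (sym eq) ρ≢u
  update-origin alpha     undecided eq ρ≢u = inj₁ eq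
  update-origin beta      alpha     eq ρ≢u = contradiction (sym eq) ρ≢u
  update-origin beta      beta      eq ρ≢u = inj₁ eq
  update-origin beta      undecided eq ρ≢u = inj₁ eq
  update-origin undecided τ         eq ρ≢u = inj₂ eq

  colour-origin : ∀ {n T} (x : Config n) (ω : Choices n T) t u {ρ} → X x ω t u ≡ ρ → ρ ≢ undecided → ∃[ u₀ ] x u₀ ≡ ρ
  colour-origin x ω zero u eq ρ≢u = u , eq
  colour-origin {T = suc T} x ω (suc t) u eq ρ≢u with colour-origin (step (ω zero) x) (ω ∘ suc) t u eq ρ≢u
  ... | v , eq′ = Sum.[ (v ,_) , (ω zero v ,_) ]′ (update-origin (x v) (x (ω zero v)) eq′ ρ≢u)

  someNode : ∀ n .{{_ : NonZero n}} → Fin n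
  someNode (suc _) = zero

  consensus⇒valid : ∀ {n T} .{{_ : NonZero n}} (x : Config n) (ω : Choices n T) →
                    ConvergesTo ColorConsensus x ω → ConvergesTo (ValidMonochromatic x) x ω
  consensus⇒valid {n} x ω (t , h) with consensus⇒uniform (X x ω t) h
  ... | σ , σ≢u , all = t , σ , all , λ _ → colour-origin x ω t (someNode n) (all (someNode n)) σ≢u

  -- Chaining the four phases, from the last one backwards

  module _ {n : ℕ} .{{_ : NonZero n}} where
    -- The same for all phases: each potential is at most `C * ι n` at the start of its phase.
    phaseError : ℕ → ℚ
    phaseError T = r ^ T * (C {n} * ι n) + ι T * δ {n}

    0≤r : 0ℚ ≤ r
    0≤r = lit r

    0≤C : 0ℚ ≤ C {n}
    0≤C = lit (C {n})

    phaseError-≥0 : ∀ T → 0ℚ ≤ phaseError T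
    phaseError-≥0 T = ^-≥0 T 0≤r ⊗ (0≤C ⊗ ι-≥0 n) ⊕ ι-≥0 T ⊗ δ-≥0

    potential-≤ : ∀ T ε {φ} → φ ≤ C {n} * ι n → ε + (r ^ T * φ + ι T * δ {n}) ≤ ε + phaseError T
    potential-≤ T ε φ≤ = +-monoʳ-≤ ε (+-monoˡ-≤ (ι T * δ {n}) (*-monoˡ-≤-nonNeg (r ^ T) {{ℚ.nonNegative (^-≥0 T 0≤r)}} φ≤))

    inv-≤n : ∀ {p} → ν {n} ≤ p → inv p ≤ ι n
    inv-≤n {p} ν≤p = subst (inv p ≤_) (sym (inv-unique 0<ν (trans (*-comm (ν {n}) (ι n)) (nν≡1 {n})))) (inv-antimono 0<ν ν≤p)

    C-≥1 : ∀ {p q} → 0ℚ ≤ q → p ≤ q → p ≤ C {n} * q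
    C-≥1 {p} {q} 0≤q p≤q = go 0≤q p≤q
      where
      go : ∀ {p q} → 0ℚ ≤ q → p ≤ q → p ≤ + 268435457 / 1 * q
      go {p} {q} 0≤q p≤q = by-gap (gap p≤q ⊕ lit (+ 268435456 / 1) ⊗ 0≤q) (solve (p ∷ q ∷ []) ring)

    final-potential-≤ : ∀ {s} → s ≤ + 1 / 32 → + 4 / 1 * ι n * s ≤ C {n} * ι n
    final-potential-≤ {s} s≤ = C-≥1 (ι-≥0 n) (go (ι-≥0 n) s≤)
      where
      go : ∀ {i s} → 0ℚ ≤ i → s ≤ + 1 / 32 → + 4 / 1 * i * s ≤ i
      go {i} {s} 0≤i s≤ = by-gap (lit (+ 4 / 1) ⊗ 0≤i ⊗ gap s≤ ⊕ lit (+ 7 / 8) ⊗ 0≤i) (solve (i ∷ s ∷ []) ring)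

    module _ (T : ℕ) where

      -- The trailing zero matches the unfolding of `4 ℕ.* T` into T + (T + (T + (T + 0))), the form
      -- in which `after-alive` states the total.
      after-winning : ∀ x → Winning x → miss (T ℕ.+ 0) x ≤ 0ℚ + phaseError T
      after-winning x (inj₁ w) = ≤-trans
        (FinalPhase.reach {n} wα wα-≥0 (bounded-next wα wα²≤1) contraction-α granularity-α T x w)
        (potential-≤ T 0ℚ (final-potential-≤ w))
      after-winning x (inj₂ w) = ≤-trans
        (FinalPhase.reach {n} wβ wβ-≥0 (bounded-next wβ wβ²≤1) contraction-β granularity-β T x w)
        (potential-≤ T 0ℚ (final-potential-≤ w))

      ε₁ ε₂ ε₃ ε₄ : ℚ
      ε₁ = 0ℚ + phaseError T
      ε₂ = ε₁ + phaseError T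
      ε₃ = ε₂ + phaseError T
      ε₄ = ε₃ + phaseError T

      0≤ε₁ : 0ℚ ≤ ε₁
      0≤ε₁ = ≤-refl {0ℚ} ⊕ phaseError-≥0 T
      0≤ε₂ : 0ℚ ≤ ε₂
      0≤ε₂ = 0≤ε₁ ⊕ phaseError-≥0 T
      0≤ε₃ : 0ℚ ≤ ε₃
      0≤ε₃ = 0≤ε₂ ⊕ phaseError-≥0 T

      after-mixed : ∀ x → Mixed x → miss (T ℕ.+ (T ℕ.+ 0)) x ≤ ε₂
      after-mixed x mixed = ≤-trans
        (drift winning? 0≤r δ-≥0 0≤ε₁ after-winning
          (λ y _ → 0≤C ⊗ inv-≥0 (<-≤-trans 0<Aν (≤z y))) (λ y _ _ → bias-potential-≥1 y) bias-round T x mixed)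
        (potential-≤ T ε₁ (*-monoˡ-≤-nonNeg (C {n}) (inv-≤n (≤-trans (νA (ν-≥0 {n})) (≤z x)))))
        where
        νA : ∀ {v} → 0ℚ ≤ v → v ≤ + 268435456 / 1 * v
        νA {v} 0≤v = by-gap (lit (+ 268435455 / 1) ⊗ 0≤v) (solve (v ∷ []) ring)

      after-crowded : ∀ x → Crowded x → miss (T ℕ.+ (T ℕ.+ (T ℕ.+ 0))) x ≤ ε₃
      after-crowded x crowded = ≤-trans
        (drift {G = λ y → Mixed y ⊎ Winning y} (λ y → ((+ 1 / 512 ≤? κ y) ×-dec (κ y ≤? + 15 / 16)) ⊎-dec winning? y)
          0≤r δ-≥0 0≤ε₂
          -- If a colour is already winning after mixing, the bias phase is skipped and its `T`
          -- rounds are given away.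
          (λ y → Sum.[ after-mixed y , (λ w → ≤-trans (miss-+ T (T ℕ.+ 0) y) (≤-trans (after-winning y w) ε₁≤ε₂)) ]′)
          (λ _ _ → lit 1ℚ) (λ _ _ _ → ≤-refl) mix-round T x crowded)
        (potential-≤ T ε₂ (C-≥1 (ι-≥0 n) (ι-≥1 n)))
        where
        ε₁≤ε₂ : ε₁ ≤ ε₂
        ε₁≤ε₂ = by-gap (phaseError-≥0 T) refl

      after-alive : ∀ x → Alive x → miss (4 ℕ.* T) x ≤ ε₄
      after-alive x alive = ≤-trans
        (drift (λ y → κ y ≤? + 15 / 16) 0≤r δ-≥0 0≤ε₃ after-crowded
          (λ y al → inv-≥0 al) (growth-potential-≥1 alive-granularity) (growth-round alive-granularity) T x alive)
        (potential-≤ T ε₃ (C-≥1 (ι-≥0 n) (inv-≤n (alive-granularity x alive))))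

  -- Opaque, since _+_ with a large literal on the left unfolds one successor at a time.
  opaque
    affine : ℕ → ℕ → ℕ → ℕ
    affine c d k = c ℕ.+ d ℕ.* k

    ι-affine : ∀ c d k → ι (affine c d k) ≡ ι c + ι d * ι k
    ι-affine c d k = trans (ι-+ c (d ℕ.* k)) (cong (_+_ (ι c)) (ι-* d k))

  -- 16 C + 4 · 2¹⁸ K₀: four phases, each with error at most 4Cν + K₀L · 2¹⁸ν.
  M₀ : ℕ
  M₀ = affine 4294967312 1048576 K₀

  ιM₀ : ι M₀ ≡ ι 4294967312 + ι 1048576 * ι K₀
  ιM₀ = ι-affine 4294967312 1048576 K₀

  -- The 2 guarantees ⌊log₂ n⌋ ≥ 1; the other term is what the exponent 1/4 requires in `whp`.
  n₀ : ℕ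
  n₀ = 2 ℕ.+ 16 ℕ.* M₀ ℕ.^ 4

  -- From an error of order log n / n to the exponent 1/4

  module _ {n : ℕ} .{{_ : NonZero n}} (n₀≤n : n₀ ℕ.≤ n) where

    private
      L : ℕ
      L = ⌊log₂ n ⌋
      0≤ν : 0ℚ ≤ ν {n}
      0≤ν = ν-≥0 {n}

    1≤L : 1ℚ ≤ ι L
    1≤L = ι-mono-≤ (⌊log₂⌋-mono-≤ {2} {n} (ℕ.≤-trans (ℕ.m≤m+n 2 _) n₀≤n))

    miss-≤ : ∀ x → Alive {n} x → miss (4 ℕ.* K₀ ℕ.* L) x ≤ ι M₀ * ι L * ν {n}
    miss-≤ x alive = subst (λ T → miss T x ≤ ι M₀ * ι L * ν {n}) (sym (ℕ.*-assoc 4 K₀ L))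
      (≤-trans (after-alive (K₀ ℕ.* L) x alive)
        (subst₂ (λ T M → 0ℚ + (ρ * (C {n} * ι n) + T * δ {n}) + (ρ * (C {n} * ι n) + T * δ {n}) + (ρ * (C {n} * ι n) + T * δ {n}) + (ρ * (C {n} * ι n) + T * δ {n}) ≤ M * ι L * ν {n})
          (sym (ι-* K₀ L)) (sym ιM₀) (collect {ρ} {ι n} {ι K₀} 0≤ν 1≤L (r^[K₀l]n≤4ν L (ι-≥0 n) 0≤ν (nν≡1 {n}) n≤))))
      where
      ρ : ℚ
      ρ = r ^ (K₀ ℕ.* L)
      n≤ : ι n ≤ + 2 / 1 * ι (2 ℕ.^ L)
      n≤ = subst (ι n ≤_) (ι-* 2 (2 ℕ.^ L)) (ι-mono-≤ (n≤2*2^⌊log₂n⌋ n))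
      collect : ∀ {ρ n k l v} → 0ℚ ≤ v → 1ℚ ≤ l → ρ * n ≤ + 4 / 1 * v →
        let e = ρ * (+ 268435457 / 1 * n) + k * l * (+ 262144 / 1 * v) in
        0ℚ + e + e + e + e ≤ (+ 4294967312 / 1 + + 1048576 / 1 * k) * l * v
      collect {ρ} {n} {k} {l} {v} 0≤v 1≤l ρn≤ = by-gap
        (lit (+ 1073741828 / 1) ⊗ gap ρn≤ ⊕ lit (+ 4294967312 / 1) ⊗ 0≤v ⊗ gap 1≤l)
        (solve (ρ ∷ n ∷ k ∷ l ∷ v ∷ []) ring)

    16M⁴≤n : + 16 / 1 * (ι M₀ ^ 4) ≤ ι n
    16M⁴≤n = subst (_≤ ι n) (trans (ι-* 16 (M₀ ℕ.^ 4)) (cong (+ 16 / 1 *_) (ι-^ M₀ 4))) (ι-mono-≤ (ℕ.≤-trans (ℕ.m≤n+m _ 2) n₀≤n))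

    -- With l = ⌊log₂ n⌋, the crude l² ≤ 4n turns (M₀l/n)⁴·n into at most 16M₀⁴/n, which is at most
    -- 1 from `n₀` on. For the exponent 1/2 the same estimate would leave only the constant 4M₀².
    whp : ∀ {p} → p ≤ 1ℚ → 1ℚ - p ≤ ι M₀ * ι L * ν {n} → p ≥1- n ^- (+ 1 / 4)
    whp {p} p≤1 h = begin
      (1ℚ - p) ^ 4 * ι (n ℕ.^ 1)
        ≡⟨ cong (λ m → (1ℚ - p) ^ 4 * ι m) (ℕ.*-identityʳ n) ⟩
      (1ℚ - p) ^ 4 * ι n
        ≤⟨ *-monoʳ-≤-nonNeg (ι n) {{ℚ.nonNegative (ι-≥0 n)}} (^-mono-≤ 4 (gap p≤1) h) ⟩
      (k * l * ν {n}) ^ 4 * ι n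
        ≡⟨ regroup k l (ν {n}) (ι n) ⟩
      k ^ 4 * ((l * l) * (l * l)) * (ν {n} * ν {n} * ν {n}) * (ι n * ν {n})
        ≤⟨ fourth (^-≥0 4 (ι-≥0 M₀)) (sq l) 0≤ν (ι-≥0 n) l²≤4n ⟩
      k ^ 4 * (+ 16 / 1 * (ι n * ι n)) * (ν {n} * ν {n} * ν {n}) * (ι n * ν {n})
        ≡⟨ regroup′ (k ^ 4) (ι n) (ν {n}) ⟩
      + 16 / 1 * k ^ 4 * ν {n} * ((ι n * ν {n}) * (ι n * ν {n}) * (ι n * ν {n}))
        ≡⟨ cong (λ e → + 16 / 1 * k ^ 4 * ν {n} * (e * e * e)) (nν≡1 {n}) ⟩
      + 16 / 1 * k ^ 4 * ν {n} * (1ℚ * 1ℚ * 1ℚ)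
        ≡⟨ *-identityʳ (+ 16 / 1 * k ^ 4 * ν {n}) ⟩
      + 16 / 1 * k ^ 4 * ν {n}
        ≤⟨ *-monoʳ-≤-nonNeg (ν {n}) {{ℚ.nonNegative 0≤ν}} 16M⁴≤n ⟩
      ι n * ν {n}
        ≡⟨ nν≡1 {n} ⟩
      1ℚ ∎
      where
      open ≤-Reasoning
      k l : ℚ
      k = ι M₀
      l = ι L
      l²≤4n : l * l ≤ + 4 / 1 * ι n
      l²≤4n = ≤-trans (l²≤4*2^l L) (*-monoˡ-≤-nonNeg (+ 4 / 1) (ι-mono-≤ (2^⌊log₂n⌋≤n n)))
      regroup : ∀ m l v n → (m * l * v) * ((m * l * v) * ((m * l * v) * ((m * l * v) * 1ℚ))) * n ≡
        m * (m * (m * (m * 1ℚ))) * ((l * l) * (l * l)) * (v * v * v) * (n * v)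
      regroup = solve-∀ ring
      regroup′ : ∀ m n v → m * (+ 16 / 1 * (n * n)) * (v * v * v) * (n * v) ≡ + 16 / 1 * m * v * ((n * v) * (n * v) * (n * v))
      regroup′ = solve-∀ ring
      fourth : ∀ {m j v n} → 0ℚ ≤ m → 0ℚ ≤ j → 0ℚ ≤ v → 0ℚ ≤ n → j ≤ + 4 / 1 * n →
        m * (j * j) * (v * v * v) * (n * v) ≤ m * (+ 16 / 1 * (n * n)) * (v * v * v) * (n * v)
      fourth {m} {j} {v} {n} 0≤m 0≤j 0≤v 0≤n j≤ = by-gap
        (0≤m ⊗ (gap j≤ ⊗ (lit (+ 4 / 1) ⊗ 0≤n ⊕ 0≤j)) ⊗ (0≤v ⊗ 0≤v ⊗ 0≤v) ⊗ (0≤n ⊗ 0≤v))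
        (solve (m ∷ j ∷ v ∷ n ∷ []) ring)

    consensus-whp : ∀ x → q x ℕ.< n → Pr n (4 ℕ.* K₀ ℕ.* ⌊log₂ n ⌋) (convergesTo? colorConsensus? x) ≥1- n ^- (+ 1 / 4)
    consensus-whp x q<n = whp (Pr-≤1 T (convergesTo? colorConsensus? x))
      (subst (_≤ ι M₀ * ι L * ν {n}) (sym (1-Pr≡miss T x)) (miss-≤ x (coloured⇒alive x q<n)))
      where
      T = 4 ℕ.* K₀ ℕ.* L

    valid-whp : ∀ x → Pr n (4 ℕ.* K₀ ℕ.* ⌊log₂ n ⌋) (convergesTo? (validMonochromatic? x) x) ≥1- n ^- (+ 1 / 4)
    valid-whp x = go (q x ℕ.<? n)
      where
      T = 4 ℕ.* K₀ ℕ.* L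
      P? = convergesTo? {T = T} (validMonochromatic? x) x
      complement-mono : ∀ {p p′ e} → p ≤ p′ → 1ℚ - p ≤ e → 1ℚ - p′ ≤ e
      complement-mono {p} {p′} {e} p≤p′ h = by-gap (gap p≤p′ ⊕ gap h) (solve (p ∷ p′ ∷ e ∷ []) ring)
      certain : ∀ {p e} → 1ℚ ≤ p → 0ℚ ≤ e → 1ℚ - p ≤ e
      certain {p} {e} 1≤p 0≤e = by-gap (gap 1≤p ⊕ 0≤e) (solve (p ∷ e ∷ []) ring)
      go : Dec (q x ℕ.< n) → Pr n T P? ≥1- n ^- (+ 1 / 4)
      go (yes q<n) = whp (Pr-≤1 T P?) (complement-mono (Pr-mono T (convergesTo? colorConsensus? x) P? (consensus⇒valid x))
        (subst (_≤ ι M₀ * ι L * ν {n}) (sym (1-Pr≡miss T x)) (miss-≤ x (coloured⇒alive x q<n))))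
      -- Without a coloured node the all-undecided configuration is already there at time zero, and
      -- validity asks nothing of it.
      go (no q≮n) = whp (Pr-≤1 T P?) (certain (≤-reflexive (sym (Pr-certain T P? λ ω → zero , undecided , all , λ u≢u → contradiction refl u≢u)))
          (ι-≥0 M₀ ⊗ ι-≥0 L ⊗ 0≤ν))
        where
        all : ∀ u → x u ≡ undecided
        all = count≡n⇒all (λ u → x u ≟ₛ undecided) (ℕ.≤-antisym (count≤n (λ u → x u ≟ₛ undecided)) (ℕ.≮⇒≥ q≮n))

open import Data.Integer using (+_)
open import Data.Nat using (ℕ; NonZero; _*_; _≤_; _<_)
open import Data.Nat.Logarithm using (⌊log₂_⌋)
open import Data.Product using (∃-syntax; _×_; _,_)
open import Data.Rational as ℚ using (ℚ; 0ℚ)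
open import Data.Rational.Properties using (positive⁻¹)
open Analysis using (K₀; n₀; valid-whp; consensus-whp)

theorem3p1 : ∃[ K ] ∃[ c ] ∃[ n₀ ] (0ℚ ℚ.< c) ×
    ((n : ℕ) .{{_ : NonZero n}} → n₀ ≤ n → (x : Config n) →
    (Pr n (K * ⌊log₂ n ⌋) (convergesTo? (validMonochromatic? x) x) ≥1- n ^- c)
    × (q x < n →
    Pr n (K * ⌊log₂ n ⌋) (convergesTo? colorConsensus? x) ≥1- n ^- c))
theorem3p1 = 4 * K₀ , + 1 ℚ./ 4 , n₀ , positive⁻¹ (+ 1 ℚ./ 4) ,
  λ n n₀≤n x → valid-whp {n} n₀≤n x , consensus-whp {n} n₀≤n x
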